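{- Let $\Lambda$ be a superpartition of $(n|m)$ and $\Lambda'$ its conjugate. Then $$\overleftarrow{e_\Lambda}:=\tilde e_{\Lambda_m}\cdots\tilde e_{\Lambda_1}\,e_{\Lambda_{m+1}}\cdots e_{\Lambda_{\ell(\Lambda)}}=m_{\Lambda'}+\sum_{\Omega<\Lambda'}N_\Lambda^\Omega\, m_\Omega ,$$ where each $N_\Lambda^\Omega$ is an integer and $<$ is the Bruhat order on superpartitions. Hence $\{e_\Lambda:\Lambda\vdash(n|m)\}$ is a basis of the $\mathbb{Z}$-module $\mathscr{P}^{S_\infty}_{(n|m)}(\mathbb{Z})$.
   Context: Superpartitions. A superpartition of $(n|m)$, written $\Lambda\vdash(n|m)$, is $\Lambda=(\Lambda^a;\Lambda^s)=(\Lambda_1,\dots,\Lambda_m;\Lambda_{m+1},\Lambda_{m+2},\dots)$ with nonnegative integer entries, $\Lambda_1>\dots>\Lambda_m\ge 0$, $\Lambda_{m+1}\ge\Lambda_{m+2}\ge\dots\ge0$ (finitely many nonzero; trailing zeros of $\Lambda^s$ ignored) and $\sum_i\Lambda_i=n$; $\ell(\Lambda)=m+\#\{\text{nonzero parts of }\Lambda^s\}$. The diagram of $\Lambda$ is obtained by reordering all entries decreasingly, circling each entry coming from $\Lambda^a$ (when such an entry equals entries of $\Lambda^s$, the leftmost one is circled), drawing left-justified rows of boxes of these lengths from top to bottom, and adding a circle at the end of each row corresponding to a circled entry (a circled $0$ gives a row consisting of just a circle). The conjugate $\Lambda'$ is the superpartition whose diagram is the transpose of that of $\Lambda$. Bruhat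 order. For superpartitions $\Lambda,\Omega$ of the same $(n|m)$, let $\Lambda^c$, $\Omega^c$ be the compositions obtained by replacing the semicolon by a comma (padded with zeros to a common length). For compositions $\lambda,\mu$ let $\lambda^+$ be the decreasing rearrangement and $w_\lambda$ the minimal-length permutation with $\lambda=w_\lambda\lambda^+$; $\lambda\ge\mu$ iff either $\lambda^+>\mu^+$ in dominance order, or $\lambda^+=\mu^+$ and $w_\lambda\le w_\mu$ in the Bruhat order of the symmetric group. Set $\Omega\le\Lambda$ iff $\Omega^c\le\Lambda^c$. Symmetric superfunctions. The $x_i$ ($i\ge1$) commute, the $\theta_i$ anticommute ($\theta_i^2=0$) and commute with the $x_i$. $\mathscr{P}^{S_\infty}_{(n|m)}(\mathbb{Z})$ is the $\mathbb{Z}$-module of formal series with integer coefficients, homogeneous of degree $n$ in $x$ and $m$ in $\theta$, invariant under simultaneous permutations of the pairs $(x_i,\theta_i)$. $m_\Lambda$ is the sum of all distinct terms obtained from $\theta_1\cdots\theta_m x_1^{\Lambda_1}x_2^{\Lambda_2}\cdots$ by simultaneous permutations of the pairs $(x_i,\theta_i)$. Further, $e_n=\sum_{j_1<\dots<j_n}x_{j_1}\cdots x_{j_n}$, $e_0=1$, $\tilde e_n=\sum_{i\ge1}\sum_{j_1<\dots<j_n,\ i\notin\{j_1,\dots,j_n\}}\theta_i x_{j_1}\cdots x_{j_n}$, $\tilde e_0=\sum_i\theta_i$, and $e_\Lambda=\tilde e_{\Lambda_1}\cdots\tilde e_{\Lambda_m}e_{\Lambda_{m+1}}\cdots e_{\Lambda_{\ell(\Lambda)}}$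 (products taken in this order). -}

module Defs where

open import Data.Bool.Base using (Bool; true; false; if_then_else_; _∧_)
open import Data.Bool.Properties using (T?)
open import Data.Fin.Base using (Fin)
import Data.Fin.Properties as Fin
open import Data.Fin.Permutation using (Permutation′; _⟨$⟩ʳ_; _⟨$⟩ˡ_; _∘ₚ_; transpose) renaming (_≈_ to _≈ₚ_)
open import Data.Integer.Base using (ℤ; 0ℤ; 1ℤ; -1ℤ) renaming (_+_ to _+ℤ_; _*_ to _*ℤ_; _^_ to _^ℤ_)
open import Data.List.Base
open import Data.List.Properties using (≡-dec; map-∘; map-id; map-++; length-++)
open import Data.List.Relation.Binary.Permutation.Propositional using (↭-sym)
open import Data.List.Relation.Binary.Permutation.Propositional.Properties using (All-resp-↭; map⁺; ↭-length; merge-↭)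
open import Data.List.Relation.Unary.All as All using (All; []; _∷_; all?)
import Data.List.Relation.Unary.All.Properties as All
open import Data.List.Relation.Unary.AllPairs using (AllPairs; []; _∷_)
open import Data.List.Relation.Unary.Linked using (Linked; []; [-]; _∷_)
open import Data.List.Relation.Unary.Linked.Properties using (AllPairs⇒Linked; Linked⇒AllPairs)
open import Data.List.Relation.Unary.Unique.Propositional using (Unique)
open import Data.Nat.Base
import Data.Nat.ListAction.Properties as Sum
open import Data.Nat.ListAction using () renaming (sum to sumℕ)
open import Data.Nat.Properties
open import Data.Product.Base using (∃₂; _×_; _,_; proj₁; proj₂)
open import Data.Sum.Base using (_⊎_)
open import Data.Vec.Base as Vec using (Vec)
import Data.Vec.Properties as Vec
open import Function.Base using (_∘_; const)
open import Relation.Binary.Construct.Closure.ReflexiveTransitive using (Star)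
import Relation.Binary.Construct.Flip.EqAndOrd as Flip
open import Relation.Binary.PropositionalEquality using (_≡_; _≢_; refl; sym; trans; cong; cong₂; subst; module ≡-Reasoning)
open import Relation.Nullary.Decidable using (yes; no; does; _×-dec_; dec-true; dec-false)

module Decreasing where
  open import Data.List.Sort.InsertionSort.Base (Flip.decTotalOrder ≤-decTotalOrder) public using (sort)
  open import Data.List.Sort.InsertionSort.Properties (Flip.decTotalOrder ≤-decTotalOrder) public using (sort-↭)
open Decreasing using () renaming (sort to sort↓; sort-↭ to sort↓-↭)

private
  variable
    n m N : ℕ

-- (Λᵃ ; Λˢ), with Λˢ stored without its trailing zeros.
record Superpartition (n m : ℕ) : Set where
  field
    Λᵃ          : List ℕ
    Λˢ          : List ℕ
    Λᵃ-strict   : Linked _>_ Λᵃ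
    Λˢ-weak     : Linked _≥_ Λˢ
    Λˢ-positive : All (0 <_) Λˢ
    Λᵃ-length   : length Λᵃ ≡ m
    Λ-weight    : sumℕ (Λᵃ ++ Λˢ) ≡ n

open Superpartition

bit : Bool → ℕ
bit b = if b then 1 else 0

-- A row of a diagram: its number of boxes, and whether it ends with a circle.
Row : Set
Row = ℕ × Bool

circledRow plainRow : ℕ → Row
circledRow l = l , true
plainRow   l = l , false

-- `merge` takes the entry of its first argument on a tie, so that among equal
-- entries the leftmost one is circled.
mergeRows : List ℕ → List ℕ → List Row
mergeRows as ss = merge (λ r s → proj₁ r ≥? proj₁ s) (map circledRow as) (map plainRow ss)

rows : Superpartition n m → List Row
rows Λ = mergeRows (Λᵃ Λ) (Λˢ Λ)

data Cell : Set where
  blank box circle : Cell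

cell : Row → ℕ → Cell
cell (zero  , true)  zero    = circle
cell (zero  , false) zero    = blank
cell (zero  , _)     (suc _) = blank
cell (suc _ , _)     zero    = box
cell (suc l , c)     (suc j) = cell (l , c) j

drawRows : List Row → ℕ → ℕ → Cell
drawRows []      _       _ = blank
drawRows (r ∷ _) zero    j = cell r j
drawRows (_ ∷ R) (suc i) j = drawRows R i j

diagram : Superpartition n m → ℕ → ℕ → Cell
diagram Λ = drawRows (rows Λ)

-- If T is the transpose of a diagram, addColumn r T is the transpose of that
-- diagram with the row r, at least as long as all others, added on top.
addColumn : Row → List Row → List Row
addColumn (zero  , false) T             = T
addColumn (zero  , true)  T             = (0 , true) ∷ T
addColumn (suc l , c)     []            = (1 , false) ∷ addColumn (l , c) []
addColumn (suc l , c)     ((k , d) ∷ T) = (suc k , d) ∷ addColumn (l , c) T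

transposeRows : List Row → List Row
transposeRows = foldr addColumn []

marked unmarked : List (ℕ × Bool) → List ℕ
marked   []                = []
marked   ((l , true)  ∷ R) = l ∷ marked R
marked   ((_ , false) ∷ R) = marked R
unmarked []                = []
unmarked ((_ , true)  ∷ R) = unmarked R
unmarked ((l , false) ∷ R) = l ∷ unmarked R

module ConjugateProperties where

  _≽_ : Row → Row → Set
  (k , _) ≽ (l , c) = l + bit c ≤ k

  ≽-trans : ∀ {r s t} → r ≽ s → s ≽ t → r ≽ t
  ≽-trans r≽s s≽t = ≤-trans s≽t (≤-trans (m≤m+n _ _) r≽s)

  NonEmpty : Row → Set
  NonEmpty (l , c) = 0 < l + bit c

  record IsDiagram (R : List Row) : Set where
    constructor isDiagram
    field
      sorted   : Linked _≽_ R
      nonEmpty : All NonEmpty R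

  length-addColumn : ∀ l c T → length T ≤ l → length (addColumn (l , c) T) ≡ l + bit c
  length-addColumn zero    false []      _         = refl
  length-addColumn zero    true  []      _         = refl
  length-addColumn (suc l) c     []      _         = cong suc (length-addColumn l c [] z≤n)
  length-addColumn (suc l) c     (_ ∷ T) (s≤s T≤l) = cong suc (length-addColumn l c T T≤l)

  mutual
    length-transposeRows : ∀ l c R → Linked _≽_ ((l , c) ∷ R) → length (transposeRows ((l , c) ∷ R)) ≡ l + bit c
    length-transposeRows l c R s = length-addColumn l c (transposeRows R) (fits l c R s)

    fits : ∀ l c R → Linked _≽_ ((l , c) ∷ R) → length (transposeRows R) ≤ l
    fits l c []            [-]     = z≤n
    fits l c ((k , d) ∷ R) (p ∷ s) = subst (_≤ l) (sym (length-transposeRows k d R s)) p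

  draw-addColumn-zero : ∀ l c T i → length T ≤ l → drawRows (addColumn (l , c) T) i 0 ≡ cell (l , c) i
  draw-addColumn-zero zero    false []      zero    _         = refl
  draw-addColumn-zero zero    false []      (suc i) _         = refl
  draw-addColumn-zero zero    true  []      zero    _         = refl
  draw-addColumn-zero zero    true  []      (suc i) _         = refl
  draw-addColumn-zero (suc l) c     []      zero    _         = refl
  draw-addColumn-zero (suc l) c     []      (suc i) _         = draw-addColumn-zero l c [] i z≤n
  draw-addColumn-zero (suc l) c     (_ ∷ T) zero    _         = refl
  draw-addColumn-zero (suc l) c     (_ ∷ T) (suc i) (s≤s T≤l) = draw-addColumn-zero l c T i T≤l

  draw-addColumn-suc : ∀ l c T i j → length T ≤ l → drawRows (addColumn (l , c) T) i (suc j) ≡ drawRows T i j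
  draw-addColumn-suc zero    false []      i       j _         = refl
  draw-addColumn-suc zero    true  []      zero    j _         = refl
  draw-addColumn-suc zero    true  []      (suc i) j _         = refl
  draw-addColumn-suc (suc l) c     []      zero    zero    _   = refl
  draw-addColumn-suc (suc l) c     []      zero    (suc j) _   = refl
  draw-addColumn-suc (suc l) c     []      (suc i) j _         = draw-addColumn-suc l c [] i j z≤n
  draw-addColumn-suc (suc l) c     (_ ∷ T) zero    j _         = refl
  draw-addColumn-suc (suc l) c     (_ ∷ T) (suc i) j (s≤s T≤l) = draw-addColumn-suc l c T i j T≤l

  tail-sorted : ∀ {r R} → Linked _≽_ (r ∷ R) → Linked _≽_ R
  tail-sorted [-]     = []
  tail-sorted (_ ∷ s) = s

  draw-transposeRows : ∀ R → Linked _≽_ R → ∀ i j → drawRows (transposeRows R) i j ≡ drawRows R j i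
  draw-transposeRows []            _ i j       = refl
  draw-transposeRows ((l , c) ∷ R) s i zero    = draw-addColumn-zero l c (transposeRows R) i (fits l c R s)
  draw-transposeRows ((l , c) ∷ R) s i (suc j) =
    trans (draw-addColumn-suc l c (transposeRows R) i j (fits l c R s))
          (draw-transposeRows R (tail-sorted s) i j)

  sorted-addColumn : ∀ l c T → length T ≤ l → Linked _≽_ T → Linked _≽_ (addColumn (l , c) T)
  sorted-addColumn zero          false []          _         _       = []
  sorted-addColumn zero          true  []          _         _       = [-]
  sorted-addColumn (suc zero)    false []          _         _       = [-]
  sorted-addColumn (suc zero)    true  []          _         _       = ≤-refl ∷ [-]
  sorted-addColumn (suc (suc l)) c     []          _         _       = ≤-refl ∷ sorted-addColumn (suc l) c [] z≤n []
  sorted-addColumn (suc zero)    false (_ ∷ [])    _         _       = [-]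
  sorted-addColumn (suc zero)    true  (_ ∷ [])    _         _       = s≤s z≤n ∷ [-]
  sorted-addColumn (suc (suc l)) c     (_ ∷ [])    _         _       = s≤s z≤n ∷ sorted-addColumn (suc l) c [] z≤n []
  sorted-addColumn (suc (suc l)) c     (_ ∷ _ ∷ T) (s≤s T≤l) (p ∷ s) = s≤s p ∷ sorted-addColumn (suc l) c (_ ∷ T) T≤l s
  sorted-addColumn (suc zero)    c     (_ ∷ _ ∷ T) (s≤s ())

  nonEmpty-addColumn : ∀ l c T → All NonEmpty T → All NonEmpty (addColumn (l , c) T)
  nonEmpty-addColumn zero    false T       ps       = ps
  nonEmpty-addColumn zero    true  T       ps       = s≤s z≤n ∷ ps
  nonEmpty-addColumn (suc l) c     []      ps       = s≤s z≤n ∷ nonEmpty-addColumn l c [] []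
  nonEmpty-addColumn (suc l) c     (_ ∷ T) (_ ∷ ps) = s≤s z≤n ∷ nonEmpty-addColumn l c T ps

  isDiagram-transposeRows : ∀ R → Linked _≽_ R → IsDiagram (transposeRows R)
  isDiagram-transposeRows []            _ = isDiagram [] []
  isDiagram-transposeRows ((l , c) ∷ R) s with isDiagram-transposeRows R (tail-sorted s)
  ... | isDiagram t ps = isDiagram (sorted-addColumn l c _ (fits l c R s) t) (nonEmpty-addColumn l c _ ps)

  boxes circles : List Row → ℕ
  boxes   R = sumℕ (map proj₁ R)
  circles R = sumℕ (map (bit ∘ proj₂) R)

  boxes-addColumn : ∀ l c T → boxes (addColumn (l , c) T) ≡ l + boxes T
  boxes-addColumn zero    false T             = refl
  boxes-addColumn zero    true  T             = refl
  boxes-addColumn (suc l) c     []            = cong suc (boxes-addColumn l c [])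
  boxes-addColumn (suc l) c     ((k , d) ∷ T) = cong suc (begin
    k + boxes (addColumn (l , c) T)  ≡⟨ cong (k +_) (boxes-addColumn l c T) ⟩
    k + (l + boxes T)                ≡⟨ +-assoc k l _ ⟨
    k + l + boxes T                  ≡⟨ cong (_+ boxes T) (+-comm k l) ⟩
    l + k + boxes T                  ≡⟨ +-assoc l k _ ⟩
    l + (k + boxes T)                ∎)
    where open ≡-Reasoning

  circles-addColumn : ∀ l c T → circles (addColumn (l , c) T) ≡ bit c + circles T
  circles-addColumn zero    false T             = refl
  circles-addColumn zero    true  T             = refl
  circles-addColumn (suc l) c     []            = circles-addColumn l c []
  circles-addColumn (suc l) c     ((k , d) ∷ T) = begin
    bit d + circles (addColumn (l , c) T)  ≡⟨ cong (bit d +_) (circles-addColumn l c T) ⟩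
    bit d + (bit c + circles T)            ≡⟨ +-assoc (bit d) (bit c) _ ⟨
    bit d + bit c + circles T              ≡⟨ cong (_+ circles T) (+-comm (bit d) (bit c)) ⟩
    bit c + bit d + circles T              ≡⟨ +-assoc (bit c) (bit d) _ ⟩
    bit c + (bit d + circles T)            ∎
    where open ≡-Reasoning

  boxes-transposeRows : ∀ R → boxes (transposeRows R) ≡ boxes R
  boxes-transposeRows []            = refl
  boxes-transposeRows ((l , c) ∷ R) = trans (boxes-addColumn l c (transposeRows R)) (cong (l +_) (boxes-transposeRows R))

  circles-transposeRows : ∀ R → circles (transposeRows R) ≡ circles R
  circles-transposeRows []            = refl
  circles-transposeRows ((l , c) ∷ R) = trans (circles-addColumn l c (transposeRows R)) (cong (bit c +_) (circles-transposeRows R))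

  boxes-merge : ∀ A B → boxes (mergeRows A B) ≡ sumℕ (A ++ B)
  boxes-merge A B = begin
    boxes (mergeRows A B)                                          ≡⟨ Sum.sum-↭ (map⁺ proj₁ (merge-↭ _ (map circledRow A) (map plainRow B))) ⟩
    sumℕ (map proj₁ (map circledRow A ++ map plainRow B))                    ≡⟨ cong sumℕ (map-++ proj₁ (map circledRow A) _) ⟩
    sumℕ (map proj₁ (map circledRow A) ++ map proj₁ (map plainRow B))        ≡⟨ cong₂ (λ xs ys → sumℕ (xs ++ ys)) (map-∘ A) (map-∘ B) ⟨
    sumℕ (map (λ x → x) A ++ map (λ x → x) B)                      ≡⟨ cong₂ (λ xs ys → sumℕ (xs ++ ys)) (map-id A) (map-id B) ⟩
    sumℕ (A ++ B)                                                  ∎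
    where open ≡-Reasoning

  circles-++ : ∀ A B → circles (map circledRow A ++ map plainRow B) ≡ length A
  circles-++ (_ ∷ A) B       = cong suc (circles-++ A B)
  circles-++ []      (_ ∷ B) = circles-++ [] B
  circles-++ []      []      = refl

  circles-merge : ∀ A B → circles (mergeRows A B) ≡ length A
  circles-merge A B = trans (Sum.sum-↭ (map⁺ (bit ∘ proj₂) (merge-↭ _ (map circledRow A) (map plainRow B)))) (circles-++ A B)

  length-marked : ∀ R → length (marked R) ≡ circles R
  length-marked []                = refl
  length-marked ((_ , true)  ∷ R) = cong suc (length-marked R)
  length-marked ((_ , false) ∷ R) = length-marked R

  sum-parts : ∀ R → sumℕ (marked R ++ unmarked R) ≡ boxes R
  sum-parts R = trans (Sum.sum-++ (marked R) (unmarked R)) (go R)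
    where
    open ≡-Reasoning
    go : ∀ R → sumℕ (marked R) + sumℕ (unmarked R) ≡ boxes R
    go []                = refl
    go ((l , true)  ∷ R) = trans (+-assoc l _ _) (cong (l +_) (go R))
    go ((l , false) ∷ R) = begin
      sumℕ (marked R) + (l + sumℕ (unmarked R))  ≡⟨ +-assoc (sumℕ (marked R)) l _ ⟨
      sumℕ (marked R) + l + sumℕ (unmarked R)    ≡⟨ cong (_+ sumℕ (unmarked R)) (+-comm (sumℕ (marked R)) l) ⟩
      l + sumℕ (marked R) + sumℕ (unmarked R)    ≡⟨ +-assoc l _ _ ⟩
      l + (sumℕ (marked R) + sumℕ (unmarked R))  ≡⟨ cong (l +_) (go R) ⟩
      l + boxes R                              ∎

  All-marked : ∀ {P : ℕ → Set} R → All (λ r → proj₂ r ≡ true → P (proj₁ r)) R → All P (marked R)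
  All-marked []                []       = []
  All-marked ((_ , true)  ∷ R) (p ∷ ps) = p refl ∷ All-marked R ps
  All-marked ((_ , false) ∷ R) (_ ∷ ps) = All-marked R ps

  All-unmarked : ∀ {P : ℕ → Set} R → All (λ r → proj₂ r ≡ false → P (proj₁ r)) R → All P (unmarked R)
  All-unmarked []                []       = []
  All-unmarked ((_ , true)  ∷ R) (_ ∷ ps) = All-unmarked R ps
  All-unmarked ((_ , false) ∷ R) (p ∷ ps) = p refl ∷ All-unmarked R ps

  ≽-marked : ∀ k d R → All ((k , d) ≽_) R → All (k >_) (marked R)
  ≽-marked k _ R = All-marked R ∘ All.map (λ { {l , true} p refl → subst (_≤ k) (+-comm l 1) p })

  ≽-unmarked : ∀ k d R → All ((k , d) ≽_) R → All (k ≥_) (unmarked R)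
  ≽-unmarked k _ R = All-unmarked R ∘ All.map (λ { {l , false} p refl → subst (_≤ k) (+-identityʳ l) p })

  marked-strict : ∀ R → AllPairs _≽_ R → AllPairs _>_ (marked R)
  marked-strict []                []       = []
  marked-strict ((k , true)  ∷ R) (p ∷ ps) = ≽-marked k true R p ∷ marked-strict R ps
  marked-strict ((_ , false) ∷ R) (_ ∷ ps) = marked-strict R ps

  unmarked-weak : ∀ R → AllPairs _≽_ R → AllPairs _≥_ (unmarked R)
  unmarked-weak []                []       = []
  unmarked-weak ((_ , true)  ∷ R) (_ ∷ ps) = unmarked-weak R ps
  unmarked-weak ((k , false) ∷ R) (p ∷ ps) = ≽-unmarked k false R p ∷ unmarked-weak R ps

  unmarked-positive : ∀ R → All NonEmpty R → All (0 <_) (unmarked R)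
  unmarked-positive R = All-unmarked R ∘ All.map (λ { {l , false} p refl → subst (0 <_) (+-identityʳ l) p })

  merge-circled : ∀ k A B → All (k ≥_) B →
    mergeRows (k ∷ A) B ≡
    circledRow k ∷ mergeRows A B
  merge-circled k []      []      []      = refl
  merge-circled k (_ ∷ _) []      []      = refl
  merge-circled k A       (b ∷ B) (p ∷ _) rewrite dec-true (k ≥? b) p = refl

  merge-plain : ∀ k A B → All (k >_) A →
    mergeRows A (k ∷ B) ≡
    plainRow k ∷ mergeRows A B
  merge-plain k []      B []      = refl
  merge-plain k (a ∷ A) B (p ∷ _) rewrite dec-false (a ≥? k) (<⇒≱ p) = refl

  merge-parts : ∀ R → AllPairs _≽_ R →
    mergeRows (marked R) (unmarked R) ≡ R
  merge-parts []                []       = refl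
  merge-parts ((k , true)  ∷ R) (p ∷ ps) = trans (merge-circled k (marked R) (unmarked R) (≽-unmarked k true R p)) (cong (circledRow k ∷_) (merge-parts R ps))
  merge-parts ((k , false) ∷ R) (p ∷ ps) = trans (merge-plain k (marked R) (unmarked R) (≽-marked k false R p)) (cong (plainRow k ∷_) (merge-parts R ps))

  merge-All : ∀ {P : Row → Set} A B → All (P ∘ circledRow) A → All (P ∘ plainRow) B →
    All P (mergeRows A B)
  merge-All A B ps qs = All-resp-↭ (↭-sym (merge-↭ _ (map circledRow A) (map plainRow B))) (All.++⁺ (All.map⁺ ps) (All.map⁺ qs))

  merge-sorted : ∀ A B → AllPairs _>_ A → AllPairs _≥_ B →
    AllPairs _≽_ (mergeRows A B)
  merge-sorted []      []      _        _        = []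
  merge-sorted []      (b ∷ B) []       (q ∷ qs) = All.map⁺ (All.map (λ {x} → subst (_≤ b) (sym (+-identityʳ x))) q) ∷ merge-sorted [] B [] qs
  merge-sorted (a ∷ A) []      (p ∷ ps) []       =
    subst (AllPairs _≽_) (sym (merge-circled a A [] []))
      (merge-All A [] (All.map (λ {x} → subst (_≤ a) (+-comm 1 x)) p) [] ∷ merge-sorted A [] ps [])
  merge-sorted (a ∷ A) (b ∷ B) (p ∷ ps) (q ∷ qs)
    with a ≥? b | merge-sorted A (b ∷ B) ps (q ∷ qs) | merge-sorted (a ∷ A) B (p ∷ ps) qs
  ... | yes a≥b | rec | _ rewrite dec-true (a ≥? b) a≥b =
                  merge-All A (b ∷ B) (All.map (λ {x} → subst (_≤ a) (+-comm 1 x)) p)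
                    (All.map (λ {x} x≤b → subst (_≤ a) (sym (+-identityʳ x)) (≤-trans x≤b a≥b)) (≤-refl ∷ q))
                  ∷ rec
  ... | no  a≱b | _ | rec rewrite dec-false (a ≥? b) a≱b =
                  merge-All (a ∷ A) B
                    (All.map (λ {x} x≤a → subst (_≤ b) (+-comm 1 x) (≤-trans (s≤s x≤a) (≰⇒> a≱b))) (≤-refl ∷ All.map <⇒≤ p))
                    (All.map (λ {x} → subst (_≤ b) (sym (+-identityʳ x))) q)
                  ∷ rec

  rows-sorted : (Λ : Superpartition n m) → Linked _≽_ (rows Λ)
  rows-sorted Λ = AllPairs⇒Linked (merge-sorted (Λᵃ Λ) (Λˢ Λ)
    (Linked⇒AllPairs (λ p q → <-trans q p) (Λᵃ-strict Λ))
    (Linked⇒AllPairs (λ p q → ≤-trans q p) (Λˢ-weak Λ)))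

  transpose-sorted : (Λ : Superpartition n m) → AllPairs _≽_ (transposeRows (rows Λ))
  transpose-sorted Λ = Linked⇒AllPairs (λ {r} {s} {t} → ≽-trans {r} {s} {t})
    (IsDiagram.sorted (isDiagram-transposeRows (rows Λ) (rows-sorted Λ)))

open ConjugateProperties

conjugate : Superpartition n m → Superpartition n m
conjugate Λ = record
  { Λᵃ          = marked T
  ; Λˢ          = unmarked T
  ; Λᵃ-strict   = AllPairs⇒Linked (marked-strict T (transpose-sorted Λ))
  ; Λˢ-weak     = AllPairs⇒Linked (unmarked-weak T (transpose-sorted Λ))
  ; Λˢ-positive = unmarked-positive T (IsDiagram.nonEmpty (isDiagram-transposeRows (rows Λ) (rows-sorted Λ)))
  ; Λᵃ-length   = trans (length-marked T) (trans (circles-transposeRows (rows Λ)) (trans (circles-merge (Λᵃ Λ) (Λˢ Λ)) (Λᵃ-length Λ)))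
  ; Λ-weight    = trans (sum-parts T) (trans (boxes-transposeRows (rows Λ)) (trans (boxes-merge (Λᵃ Λ) (Λˢ Λ)) (Λ-weight Λ)))
  }
  where T = transposeRows (rows Λ)

diagram-conjugate : (Λ : Superpartition n m) → ∀ i j → diagram (conjugate Λ) i j ≡ diagram Λ j i
diagram-conjugate Λ i j =
  trans (cong (λ R → drawRows R i j) (merge-parts (transposeRows (rows Λ)) (transpose-sorted Λ)))
        (draw-transposeRows (rows Λ) (rows-sorted Λ) i j)

length≤weight : (Λ : Superpartition n m) → length (Λᵃ Λ ++ Λˢ Λ) ≤ n + m
length≤weight {n} {m} Λ = begin
  length (Λᵃ Λ ++ Λˢ Λ)              ≡⟨ length-++ (Λᵃ Λ) ⟩
  length (Λᵃ Λ) + length (Λˢ Λ)      ≡⟨ cong (_+ length (Λˢ Λ)) (Λᵃ-length Λ) ⟩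
  m + length (Λˢ Λ)                  ≤⟨ +-monoʳ-≤ m (go (Λˢ Λ) (Λˢ-positive Λ)) ⟩
  m + sumℕ (Λˢ Λ)                    ≤⟨ +-monoʳ-≤ m (m≤n+m _ (sumℕ (Λᵃ Λ))) ⟩
  m + (sumℕ (Λᵃ Λ) + sumℕ (Λˢ Λ))    ≡⟨ cong (m +_) (Sum.sum-++ (Λᵃ Λ) (Λˢ Λ)) ⟨
  m + sumℕ (Λᵃ Λ ++ Λˢ Λ)            ≡⟨ cong (m +_) (Λ-weight Λ) ⟩
  m + n                              ≡⟨ +-comm m n ⟩
  n + m                              ∎
  where
  open ≤-Reasoning
  go : ∀ ss → All (0 <_) ss → length ss ≤ sumℕ ss
  go []       []       = z≤n
  go (s ∷ ss) (p ∷ ps) = +-mono-≤ p (go ss ps)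

-- All superpartitions of (n|m) have length at most n + m, which serves as the
-- common length; further zeros would not change the order.
_ᶜ : Superpartition n m → Vec ℕ (n + m)
Λ ᶜ = Vec.padRight (length≤weight Λ) 0 (Vec.fromList (Λᵃ Λ ++ Λˢ Λ))

_⁺ : Vec ℕ N → Vec ℕ N
α ⁺ = Vec.cast (trans (↭-length (sort↓-↭ (Vec.toList α))) (Vec.length-toList α)) (Vec.fromList (sort↓ (Vec.toList α)))

infix 4 _⊴_ _◁_
_⊴_ _◁_ : Vec ℕ N → Vec ℕ N → Set
α ⊴ β = (∀ k → sumℕ (take k (Vec.toList α)) ≤ sumℕ (take k (Vec.toList β))) × Vec.sum α ≡ Vec.sum β
α ◁ β = α ⊴ β × α ≢ β

inversionsOn : (Fin N → Bool) → Permutation′ N → ℕ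
inversionsOn {N} S w = length (filter
  (λ (i , j) → (i Fin.<? j) ×-dec (w ⟨$⟩ʳ j Fin.<? w ⟨$⟩ʳ i) ×-dec T? (S i ∧ S j))
  (cartesianProduct (allFin N) (allFin N)))

ℓ : Permutation′ N → ℕ
ℓ = inversionsOn (const true)

infix 4 _≤ᴮ_

-- The Bruhat order, generated by u < ut for t a transposition with ℓ(u) < ℓ(ut).
-- The first alternative is there because permutations are compared up to _≈ₚ_.
_≤ᴮ_ : Permutation′ N → Permutation′ N → Set
_≤ᴮ_ = Star λ u v → u ≈ₚ v ⊎ ∃₂ λ i j → v ≈ₚ transpose i j ∘ₚ u × ℓ u < ℓ v

-- wβ = α, where (wβ)_{w(i)} = β_i.
Carries : Permutation′ N → Vec ℕ N → Vec ℕ N → Set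
Carries w β α = ∀ i → Vec.lookup α (w ⟨$⟩ʳ i) ≡ Vec.lookup β i

-- w = w_α
IsMinimal : Permutation′ N → Vec ℕ N → Set
IsMinimal w α = Carries w (α ⁺) α × (∀ v → Carries v (α ⁺) α → ℓ w ≤ ℓ v)

infix 4 _≤ᶜ_
_≤ᶜ_ : Vec ℕ N → Vec ℕ N → Set
β ≤ᶜ α = β ⁺ ◁ α ⁺
       ⊎ (α ⁺ ≡ β ⁺ × ∃₂ λ w v → IsMinimal w α × IsMinimal v β × w ≤ᴮ v)

infix 4 _≼_ _≺_
_≼_ _≺_ : Superpartition n m → Superpartition n m → Set
Ω ≼ Λ = Ω ᶜ ≤ᶜ Λ ᶜ
Ω ≺ Λ = Ω ≼ Λ × Ω ≢ Λ

-- The word (α₁ , ε₁) ∷ … ∷ (α_N , ε_N) ∷ [] stands for the monomial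
-- θ₁^ε₁ ⋯ θ_N^ε_N x₁^α₁ ⋯ x_N^α_N; appending (0 , false) does not change it.
Monomial : Set
Monomial = List (ℕ × Bool)

degree θ-degree : Monomial → ℕ
degree   w = sumℕ (map proj₁ w)
θ-degree w = sumℕ (map (bit ∘ proj₂) w)

-- A formal series is given by its coefficients.
Series : Set
Series = Monomial → ℤ

infix 4 _≈_
_≈_ : Series → Series → Set
f ≈ g = ∀ w → f w ≡ g w

infixl 6 _⊕_
_⊕_ : Series → Series → Series
(f ⊕ g) w = f w +ℤ g w

infixr 8 _⊙_
_⊙_ : ℤ → Series → Series
(c ⊙ f) w = c *ℤ f w

𝟘 𝟙 : Series
𝟘 w = 0ℤ
𝟙 w = if does (degree w + θ-degree w ≟ 0) then 1ℤ else 0ℤ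

sgn : ℕ → ℤ
sgn k = -1ℤ ^ℤ k

splitExponents : ℕ × Bool → List ((ℕ × Bool) × (ℕ × Bool))
splitExponents (a , ε) = cartesianProductWith (λ (b , c) (β , γ) → (b , β) , (c , γ))
  (map (λ b → b , a ∸ b) (upTo (suc a)))
  (if ε then (true , false) ∷ (false , true) ∷ [] else (false , false) ∷ [])

factorisations : Monomial → List (Monomial × Monomial)
factorisations []      = ([] , []) ∷ []
factorisations (x ∷ w) = cartesianProductWith (λ (p , q) (u , v) → p ∷ u , q ∷ v)
  (splitExponents x) (factorisations w)

-- The number of pairs (i , j) with θᵢ in u, θⱼ in v and i > j.
crossings : Monomial → Monomial → ℕ
crossings (_ ∷ u) ((_ , γ) ∷ v) = bit γ * θ-degree u + crossings u v
crossings _       _             = 0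

infixl 7 _⊛_
_⊛_ : Series → Series → Series
(f ⊛ g) w = foldr _+ℤ_ 0ℤ
  (map (λ (u , v) → sgn (crossings u v) *ℤ (f u *ℤ g v)) (factorisations w))

∏ : List Series → Series
∏ = foldr _⊛_ 𝟙

-- The terms of e_n and ẽ_n are pairwise distinct monomials with coefficient 1:
-- those with n factors x and, respectively, 0 or 1 factor θ, all of whose
-- indices are distinct.
squarefree : ℕ → ℕ → Series
squarefree k n w =
  if does (all? (λ (α , ε) → α + bit ε ≤? 1) w ×-dec (degree w ≟ n) ×-dec (θ-degree w ≟ k))
  then 1ℤ else 0ℤ

e ẽ : ℕ → Series
e = squarefree 0
ẽ = squarefree 1

e[_] e⃖[_] : Superpartition n m → Series
e[ Λ ]  = ∏ (map ẽ (Λᵃ Λ) ++ map e (Λˢ Λ))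
e⃖[ Λ ] = ∏ (map ẽ (reverse (Λᵃ Λ)) ++ map e (Λˢ Λ))

ascents : List ℕ → ℕ
ascents []       = 0
ascents (a ∷ as) = length (filter (a <?_) as) + ascents as

-- The term θ_{j₁}⋯θ_{jₘ} x_{j₁}^Λ₁ x_{j₂}^Λ₂ ⋯ is determined by its underlying
-- monomial: as Λ₁ > … > Λₘ, the index jₖ is the position of the exponent Λₖ
-- among those carried by a θ. Putting the θs in increasing order of indices
-- costs one sign for each pair k < l with jₖ > jₗ, that is, for each pair of
-- positions at which these exponents increase.
m[_] : Superpartition n m → Series
m[ Λ ] w =
  if does (≡-dec _≟_ (sort↓ (marked w)) (Λᵃ Λ) ×-dec ≡-dec _≟_ (sort↓ (filter (0 <?_) (unmarked w))) (Λˢ Λ))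
  then sgn (ascents (marked w)) else 0ℤ

permute : (w : Monomial) → Permutation′ (length w) → Monomial
permute w σ = tabulate (λ i → lookup w (σ ⟨$⟩ˡ i))

-- σ sends θ_{i₁}⋯θ_{iₖ} with i₁ < … < iₖ to θ_{σ(i₁)}⋯θ_{σ(iₖ)}, whose sign
-- relative to the monomial with increasing indices is given by the inversions
-- of σ among i₁ , … , iₖ.
record 𝒫 (n m : ℕ) (f : Series) : Set where
  field
    wellDefined : ∀ w → f (w ∷ʳ (0 , false)) ≡ f w
    homogeneous : ∀ w → f w ≢ 0ℤ → degree w ≡ n × θ-degree w ≡ m
    symmetric   : ∀ w (σ : Permutation′ (length w)) →
                  f (permute w σ) ≡ sgn (inversionsOn (proj₂ ∘ lookup w) σ) *ℤ f w

linearCombination : {I : Set} → (I → ℤ) → (I → Series) → List I → Series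
linearCombination c v []       = 𝟘
linearCombination c v (i ∷ is) = c i ⊙ v i ⊕ linearCombination c v is

record IsBasis {I : Set} (M : Series → Set) (v : I → Series) : Set where
  field
    member      : ∀ i → M (v i)
    spanning    : ∀ f → M f → ∃₂ λ c is → Unique is × f ≈ linearCombination c v is
    independent : ∀ c is → Unique is → linearCombination c v is ≈ 𝟘 → All (λ i → c i ≡ 0ℤ) is

{-# OPTIONS --safe #-}

-- The coefficient of a monomial in a product of factors e and ẽ counts, with
-- signs, the ways to write the monomial as a product of squarefree monomials,
-- one for each row of the diagram of Λ. Such a squarefree monomial has at most
-- min(k , l) factors x and at most min(k , l + c) factors x and θ with index at
-- most k, where l and c are the numbers of boxes and circles of the row. Adding
-- up, the first k rows of Ω have no more boxes, and no more boxes and circles,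
-- than the first k rows of Λ′ if m_Ω occurs in e_Λ; and for Ω = Λ′ all bounds
-- are attained, so there is only one factorisation. The comparison of boxes is
-- the dominance order. If Ω and Λ′ have the same boxes, the other comparison
-- says that the circles of Ω are lower than those of Λ′, and moving circles
-- down one row at a time is a chain in the Bruhat order. The basis property
-- follows by elimination along the sum of all these partial sums.
module Submission where

open import Defs
open import Data.Bool.Base using (Bool; true; false; if_then_else_; _∧_; _∨_; T)
open import Data.Bool.Properties using (T?; ∧-assoc; ∧-identityʳ; ∧-zeroʳ; ∧-distribˡ-∨)
open import Data.Fin.Base as Fin using (Fin; zero; suc; toℕ; inject₁; punchIn)
open import Data.Fin.Permutation as Perm using (Permutation′; _⟨$⟩ʳ_; _⟨$⟩ˡ_; _∘ₚ_)
import Data.Fin.Properties as Fin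
import Data.Integer.Base as ℤ
open import Data.Integer.Base using (ℤ; 0ℤ; 1ℤ; -1ℤ; -_) renaming (_+_ to _+ℤ_; _*_ to _*ℤ_)
import Data.Integer.Properties as ℤ
open import Data.Integer.Tactic.RingSolver using (solve-∀)
open import Data.List.Base hiding (sum)
open import Data.List.Membership.Propositional using (_∈_; lose)
import Data.List.Membership.Propositional.Properties as ∈
open import Data.List.Properties using (≡-dec; map-∘; map-id; map-++; length-++; ++-assoc; ∷-injective; ++-identityʳ; filter-++; length-replicate; length-map; take-[]; unfold-reverse; take-map; filter-all; filter-none; map-tabulate; tabulate-cong; tabulate-lookup)
open import Data.List.Relation.Binary.Permutation.Propositional as ↭ using (_↭_; ↭-refl; ↭-sym; ↭-trans; ↭-reflexive)
import Data.List.Relation.Binary.Permutation.Propositional.Properties as ↭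
import Data.List.Relation.Binary.Permutation.Setoid.Properties as Permutationₛ
open import Data.List.Relation.Unary.All as All using (All; []; _∷_; all?)
import Data.List.Relation.Unary.All.Properties as All
open import Data.List.Relation.Unary.AllPairs as AllPairs using (AllPairs; []; _∷_)
import Data.List.Relation.Unary.AllPairs.Properties as AllPairs
open import Data.List.Relation.Unary.Any using (here; there)
open import Data.List.Relation.Unary.Linked as Linked using (Linked; []; [-]; _∷_; linked?)
open import Data.List.Relation.Unary.Linked.Properties using (Linked⇒AllPairs)
open import Data.List.Relation.Unary.Unique.DecSetoid.Properties using (deduplicate-!)
open import Data.List.Relation.Unary.Unique.Propositional using (Unique)
import Data.List.Relation.Unary.Unique.Propositional.Properties as Unique
open import Data.Nat.Base
open import Data.Nat.ListAction using () renaming (sum to sumℕ)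
import Data.Nat.ListAction.Properties as Sum
open import Data.Nat.Properties
open import Data.Nat.Tactic.RingSolver using () renaming (solve-∀ to solveℕ-∀)
open import Data.Product.Base using (Σ-syntax; ∃; ∃₂; _×_; _,_; proj₁; proj₂)
open import Data.Sum.Base using (_⊎_; inj₁; inj₂)
open import Data.Vec.Base as Vec using (Vec; []; _∷_)
import Data.Vec.Properties as Vec
open import Function.Base using (_∘_; const; id)
open import Relation.Binary.Construct.Closure.ReflexiveTransitive using (gmap; _◅_; _◅◅_) renaming (ε to ε⋆)
import Relation.Binary.Construct.Flip.EqAndOrd as Flip
open import Relation.Binary.Definitions using (tri<; tri≈; tri>)
open import Relation.Binary.PropositionalEquality using (_≡_; _≢_; refl; sym; trans; cong; cong₂; subst; subst₂; setoid; module ≡-Reasoning)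
open import Relation.Binary.PropositionalEquality.Properties using (decSetoid)
open import Relation.Nullary using (¬_; Dec; contradiction)
open import Relation.Nullary.Decidable using (yes; no; does; _×-dec_; dec-true; dec-false; decidable-stable; map′; ¬?)
open import Algebra.Properties.CommutativeMonoid.Sum +-0-commutativeMonoid using (sum; sum-cong-≗; sum-permute)
open import Algebra.Properties.CommutativeSemigroup +-commutativeSemigroup using () renaming (interchange to +-interchange)
import Data.List.Sort.InsertionSort.Properties (Flip.decTotalOrder ≤-decTotalOrder) as InsertionSort

open Superpartition
open ConjugateProperties

-- Products of series

-- A symmetric series has infinitely many coefficients, yet its values at the finitely many words
-- `rows Γ` determine it: any other monomial either has coefficient 0 in every symmetric series of
-- the given degrees, or is related to one `rows Γ` by a sign that does not depend on the series. As
-- `m[ Ω ]` is 1 at `rows Ω` and 0 at every other `rows Γ`, these values are the coefficients of the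
-- monomial expansion. Invariance under all permutations carries a sign counting inversions,
-- unwieldy in a product. An adjacent transposition has a local sign, so products are treated with
-- that symmetry alone, and its equivalence with the full one is a separate argument. The order of
-- the factors `ẽ` affects only signs. With increasing degrees the θs of the leading word come out
-- sorted, which gives the coefficient 1; in the order of `e[ Λ ]` it is 1 or -1, still a unit, as
-- elimination over ℤ requires. Elimination does not use the Bruhat order but the relation `⊑` given
-- by the two families of bounds: it implies `≼` and makes the natural number `rank` strictly
-- monotone.

Letter : Set
Letter = ℕ × Bool

∑ : {A : Set} → List A → (A → ℤ) → ℤ
∑ xs f = foldr _+ℤ_ 0ℤ (map f xs)

∑-cong : {A : Set} (xs : List A) {f g : A → ℤ} → All (λ x → f x ≡ g x) xs → ∑ xs f ≡ ∑ xs g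
∑-cong []       []       = refl
∑-cong (x ∷ xs) (p ∷ ps) = cong₂ _+ℤ_ p (∑-cong xs ps)

∑-cong′ : {A : Set} (xs : List A) {f g : A → ℤ} → (∀ x → f x ≡ g x) → ∑ xs f ≡ ∑ xs g
∑-cong′ xs f≗g = ∑-cong xs (All.universal f≗g xs)

∑-zero : {A : Set} (xs : List A) {f : A → ℤ} → All (λ x → f x ≡ 0ℤ) xs → ∑ xs f ≡ 0ℤ
∑-zero []       []       = refl
∑-zero (x ∷ xs) (p ∷ ps) = cong₂ _+ℤ_ p (∑-zero xs ps)

∑-map : {A B : Set} (xs : List A) (h : A → B) (f : B → ℤ) → ∑ (map h xs) f ≡ ∑ xs (f ∘ h)
∑-map xs h f = cong (foldr _+ℤ_ 0ℤ) (sym (map-∘ xs))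

∑-++ : {A : Set} (xs ys : List A) (f : A → ℤ) → ∑ (xs ++ ys) f ≡ ∑ xs f +ℤ ∑ ys f
∑-++ []       ys f = sym (ℤ.+-identityˡ _)
∑-++ (x ∷ xs) ys f = trans (cong (f x +ℤ_) (∑-++ xs ys f)) (sym (ℤ.+-assoc (f x) _ _))

∑-cartesianProductWith : {A B C : Set} (h : A → B → C) (xs : List A) (ys : List B) (f : C → ℤ) →
  ∑ (cartesianProductWith h xs ys) f ≡ ∑ xs (λ x → ∑ ys (λ y → f (h x y)))
∑-cartesianProductWith h []       ys f = refl
∑-cartesianProductWith h (x ∷ xs) ys f = trans (∑-++ (map (h x) ys) _ f)
  (cong₂ _+ℤ_ (∑-map ys (h x) f) (∑-cartesianProductWith h xs ys f))

∑-+ : {A : Set} (xs : List A) (f g : A → ℤ) → ∑ xs (λ x → f x +ℤ g x) ≡ ∑ xs f +ℤ ∑ xs g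
∑-+ []       f g = refl
∑-+ (x ∷ xs) f g = trans (cong (f x +ℤ g x +ℤ_) (∑-+ xs f g)) (interchange (f x) (g x) (∑ xs f) (∑ xs g))
  where
  interchange : ∀ a b c d → a +ℤ b +ℤ (c +ℤ d) ≡ a +ℤ c +ℤ (b +ℤ d)
  interchange = solve-∀

∑-swap : {A B : Set} (xs : List A) (ys : List B) (f : A → B → ℤ) →
  ∑ xs (λ x → ∑ ys (f x)) ≡ ∑ ys (λ y → ∑ xs (λ x → f x y))
∑-swap []       ys f = sym (∑-zero ys (All.universal (λ _ → refl) ys))
∑-swap (x ∷ xs) ys f = trans (cong (∑ ys (f x) +ℤ_) (∑-swap xs ys f)) (sym (∑-+ ys (f x) _))

∑-*ˡ : {A : Set} (c : ℤ) (xs : List A) (f : A → ℤ) → ∑ xs (λ x → c *ℤ f x) ≡ c *ℤ ∑ xs f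
∑-*ˡ c []       f = sym (ℤ.*-zeroʳ c)
∑-*ˡ c (x ∷ xs) f = trans (cong (c *ℤ f x +ℤ_) (∑-*ˡ c xs f)) (sym (ℤ.*-distribˡ-+ c (f x) _))

∑-single : {A : Set} {xs : List A} {x : A} → Unique xs → x ∈ xs →
  (f : A → ℤ) → (∀ y → y ∈ xs → y ≢ x → f y ≡ 0ℤ) → ∑ xs f ≡ f x
∑-single {xs = y ∷ xs} (y∉ ∷ _) (here refl) f vanish = begin
  f y +ℤ ∑ xs f  ≡⟨ cong (f y +ℤ_) (∑-zero xs (All.tabulate λ {z} z∈ → vanish z (there z∈) λ { refl → All.lookup y∉ z∈ refl })) ⟩
  f y +ℤ 0ℤ      ≡⟨ ℤ.+-identityʳ _ ⟩
  f y            ∎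
  where open ≡-Reasoning
∑-single {xs = y ∷ xs} {x} (y∉ ∷ u) (there x∈) f vanish = begin
  f y +ℤ ∑ xs f  ≡⟨ cong₂ _+ℤ_ (vanish y (here refl) λ { refl → All.lookup y∉ x∈ refl }) (∑-single u x∈ f λ z z∈ → vanish z (there z∈)) ⟩
  0ℤ +ℤ f x      ≡⟨ ℤ.+-identityˡ _ ⟩
  f x            ∎
  where open ≡-Reasoning

∑-nonzero : {A : Set} (xs : List A) (f : A → ℤ) → ∑ xs f ≢ 0ℤ → ∃ λ x → x ∈ xs × f x ≢ 0ℤ
∑-nonzero []       f s≢0 = contradiction refl s≢0
∑-nonzero (x ∷ xs) f s≢0 with f x ℤ.≟ 0ℤ
... | no  fx≢0 = x , here refl , fx≢0
... | yes fx≡0 with ∑-nonzero xs f (λ s≡0 → s≢0 (cong₂ _+ℤ_ fx≡0 s≡0))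
...   | y , y∈ , fy≢0 = y , there y∈ , fy≢0

sgn-+ : ∀ a b → sgn (a + b) ≡ sgn a *ℤ sgn b
sgn-+ a b = ℤ.^-distribˡ-+-* -1ℤ a b

sgn² : ∀ a → sgn a *ℤ sgn a ≡ 1ℤ
sgn² zero    = refl
sgn² (suc a) = trans (square (sgn a)) (sgn² a)
  where
  square : ∀ s → -1ℤ *ℤ s *ℤ (-1ℤ *ℤ s) ≡ s *ℤ s
  square = solve-∀

θ : Letter → ℕ
θ (_ , ε) = bit ε

degree-++ : ∀ u v → degree (u ++ v) ≡ degree u + degree v
degree-++ u v = trans (cong sumℕ (map-++ proj₁ u v)) (Sum.sum-++ (map proj₁ u) _)

θ-degree-++ : ∀ u v → θ-degree (u ++ v) ≡ θ-degree u + θ-degree v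
θ-degree-++ u v = trans (cong sumℕ (map-++ (bit ∘ proj₂) u v)) (Sum.sum-++ (map (bit ∘ proj₂) u) _)

degree-↭ : ∀ {u v} → u ↭ v → degree u ≡ degree v
degree-↭ p = Sum.sum-↭ (↭.map⁺ proj₁ p)

θ-degree-↭ : ∀ {u v} → u ↭ v → θ-degree u ≡ θ-degree v
θ-degree-↭ p = Sum.sum-↭ (↭.map⁺ (bit ∘ proj₂) p)

-- The bits are added in ℕ, so each θ of the product lies in exactly one factor; equal θs in both
-- factors, whose product is 0, are excluded.
SplitLetter : Letter → Letter → Letter → Set
SplitLetter (a , ε) (b , β) (c , γ) = a ≡ b + c × bit ε ≡ bit β + bit γ

infixr 5 _∷_
data Split : Monomial → Monomial → Monomial → Set where
  []  : Split [] [] []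
  _∷_ : ∀ {x p q w u v} → SplitLetter x p q → Split w u v → Split (x ∷ w) (p ∷ u) (q ∷ v)

∈-splitExponents⁻ : ∀ x {p q} → (p , q) ∈ splitExponents x → SplitLetter x p q
∈-splitExponents⁻ (a , ε) pq∈
  with ∈.∈-cartesianProductWith⁻ (λ (b , c) (β , γ) → (b , β) , (c , γ)) (map (λ b → b , a ∸ b) (upTo (suc a))) (if ε then (true , false) ∷ (false , true) ∷ [] else (false , false) ∷ []) pq∈
... | (b , c) , (β , γ) , bc∈ , βγ∈ , refl with ∈.∈-map⁻ (λ b → b , a ∸ b) bc∈
...   | b , b∈ , refl = sym (m+[n∸m]≡n (≤-pred (∈.∈-upTo⁻ b∈))) , bits ε βγ∈
  where
  bits : ∀ ε → (β , γ) ∈ (if ε then (true , false) ∷ (false , true) ∷ [] else (false , false) ∷ []) → bit ε ≡ bit β + bit γ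
  bits true  (here refl)         = refl
  bits true  (there (here refl)) = refl
  bits false (here refl)         = refl

∈-splitExponents⁺ : ∀ x {p q} → SplitLetter x p q → (p , q) ∈ splitExponents x
∈-splitExponents⁺ (a , ε) {b , β} {c , γ} (refl , ε≡) =
  ∈.∈-cartesianProductWith⁺ (λ (b , c) (β , γ) → (b , β) , (c , γ))
    (subst (λ d → (b , d) ∈ map (λ b → b , a ∸ b) (upTo (suc a))) (m+n∸m≡n b c)
      (∈.∈-map⁺ (λ b → b , a ∸ b) (∈.∈-upTo⁺ (s≤s (m≤m+n b c)))))
    (bits ε β γ ε≡)
  where
  bits : ∀ ε β γ → bit ε ≡ bit β + bit γ → (β , γ) ∈ (if ε then (true , false) ∷ (false , true) ∷ [] else (false , false) ∷ [])
  bits true  true  false _ = here refl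
  bits true  false true  _ = there (here refl)
  bits false false false _ = here refl

splitExponents-unique : ∀ x → Unique (splitExponents x)
splitExponents-unique (a , ε) = Unique.cartesianProductWith⁺ _ (λ { refl → refl , refl })
  (Unique.map⁺ (λ { refl → refl }) (Unique.upTo⁺ (suc a))) (bits ε)
  where
  bits : ∀ ε → Unique (if ε then (true , false) ∷ (false , true) ∷ [] else (false , false) ∷ [])
  bits true  = ((λ ()) ∷ []) ∷ [] ∷ []
  bits false = [] ∷ []

∈-factorisations⁻ : ∀ w {u v} → (u , v) ∈ factorisations w → Split w u v
∈-factorisations⁻ []      (here refl) = []
∈-factorisations⁻ (x ∷ w) uv∈
  with ∈.∈-cartesianProductWith⁻ (λ (p , q) (u , v) → p ∷ u , q ∷ v) (splitExponents x) (factorisations w) uv∈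
... | _ , _ , pq∈ , uv∈′ , refl = ∈-splitExponents⁻ x pq∈ ∷ ∈-factorisations⁻ w uv∈′

∈-factorisations⁺ : ∀ {w u v} → Split w u v → (u , v) ∈ factorisations w
∈-factorisations⁺ []              = here refl
∈-factorisations⁺ (_∷_ {x} px ps) =
  ∈.∈-cartesianProductWith⁺ (λ (p , q) (u , v) → p ∷ u , q ∷ v) (∈-splitExponents⁺ x px) (∈-factorisations⁺ ps)

factorisations-unique : ∀ w → Unique (factorisations w)
factorisations-unique []      = [] ∷ []
factorisations-unique (x ∷ w) = Unique.cartesianProductWith⁺ _ (λ { refl → refl , refl })
  (splitExponents-unique x) (factorisations-unique w)

-- An arbitrary function of both factors in place of the summand of `⊛`: inductions on the word can
-- then absorb its leading letters into the kernel.
Kernel : Set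
Kernel = Monomial → Monomial → ℤ

convolve : Kernel → Series
convolve h w = ∑ (factorisations w) (λ (u , v) → h u v)

convolve-∷ : ∀ h x w → convolve h (x ∷ w) ≡ ∑ (splitExponents x) (λ (p , q) → convolve (λ u v → h (p ∷ u) (q ∷ v)) w)
convolve-∷ h x w = ∑-cartesianProductWith (λ (p , q) (u , v) → p ∷ u , q ∷ v) (splitExponents x) (factorisations w) (λ (u , v) → h u v)

convolve-cong : ∀ {h k} w → (∀ u v → Split w u v → h u v ≡ k u v) → convolve h w ≡ convolve k w
convolve-cong w h≗k = ∑-cong (factorisations w) (All.tabulate λ {(u , v)} uv∈ → h≗k u v (∈-factorisations⁻ w uv∈))

convolve-*ˡ : ∀ c h w → convolve (λ u v → c *ℤ h u v) w ≡ c *ℤ convolve h w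
convolve-*ˡ c h w = ∑-*ˡ c (factorisations w) (λ (u , v) → h u v)

-- The sign is -1 exactly when both exchanged letters carry a θ.
AdjacentSymmetric : Series → Set
AdjacentSymmetric f = ∀ u x y v → f (u ++ y ∷ x ∷ v) ≡ sgn (θ x * θ y) *ℤ f (u ++ x ∷ y ∷ v)

-- Both factors are rearranged at the same two positions. The sums `θ p + θ q` and `θ p′ + θ q′` are
-- the θs of the product letters there, so this is the sign expected of the product.
AdjacentSymmetricKernel : Kernel → Set
AdjacentSymmetricKernel h = ∀ {u′ v′} u v p p′ q q′ → length u ≡ length v →
  h (u ++ p′ ∷ p ∷ u′) (v ++ q′ ∷ q ∷ v′) ≡ sgn ((θ p + θ q) * (θ p′ + θ q′)) *ℤ h (u ++ p ∷ p′ ∷ u′) (v ++ q ∷ q′ ∷ v′)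

-- Exchanging two letters exchanges the order in which their splittings are chosen, so at the front
-- of the word the claim is an interchange of two sums. Deeper in the word, the first letter is
-- moved into the kernel.
convolve-adjacent : ∀ {h} → AdjacentSymmetricKernel h → AdjacentSymmetric (convolve h)
convolve-adjacent {h} hs [] x y w = begin
  convolve h (y ∷ x ∷ w)                                   ≡⟨ twice y x ⟩
  ∑ Y (λ b → ∑ X (λ a → convolve (shift b a) w))           ≡⟨ ∑-swap Y X _ ⟩
  ∑ X (λ a → ∑ Y (λ b → convolve (shift b a) w))           ≡⟨ ∑-cong X (All.tabulate λ {a} a∈ → ∑-cong Y (All.tabulate λ {b} b∈ → sign a b (∈-splitExponents⁻ x a∈) (∈-splitExponents⁻ y b∈))) ⟩
  ∑ X (λ a → ∑ Y (λ b → s *ℤ convolve (shift a b) w))      ≡⟨ ∑-cong′ X (λ a → ∑-*ˡ s Y _) ⟩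
  ∑ X (λ a → s *ℤ ∑ Y (λ b → convolve (shift a b) w))      ≡⟨ ∑-*ˡ s X _ ⟩
  s *ℤ ∑ X (λ a → ∑ Y (λ b → convolve (shift a b) w))      ≡⟨ cong (s *ℤ_) (twice x y) ⟨
  s *ℤ convolve h (x ∷ y ∷ w)                              ∎
  where
  open ≡-Reasoning
  s = sgn (θ x * θ y)
  X = splitExponents x
  Y = splitExponents y
  shift : Letter × Letter → Letter × Letter → Kernel
  shift (p , q) (p′ , q′) u v = h (p ∷ p′ ∷ u) (q ∷ q′ ∷ v)
  twice : ∀ x y → convolve h (x ∷ y ∷ w) ≡ ∑ (splitExponents x) (λ a → ∑ (splitExponents y) (λ b → convolve (shift a b) w))
  twice x y = trans (convolve-∷ h x (y ∷ w)) (∑-cong′ (splitExponents x) λ (p , q) → convolve-∷ (λ u v → h (p ∷ u) (q ∷ v)) y w)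
  sign : ∀ a b → SplitLetter x (proj₁ a) (proj₂ a) → SplitLetter y (proj₁ b) (proj₂ b) →
    convolve (shift b a) w ≡ s *ℤ convolve (shift a b) w
  sign (p , q) (p′ , q′) (_ , θx) (_ , θy) = trans
    (convolve-cong w λ u v _ → trans (hs [] [] p p′ q q′ refl) (cong₂ (λ i j → sgn (i * j) *ℤ _) (sym θx) (sym θy)))
    (convolve-*ˡ s _ w)
convolve-adjacent {h} hs (z ∷ u) x y w = begin
  convolve h (z ∷ u ++ y ∷ x ∷ w)                               ≡⟨ convolve-∷ h z (u ++ y ∷ x ∷ w) ⟩
  ∑ Z (λ c → convolve (shift c) (u ++ y ∷ x ∷ w))               ≡⟨ ∑-cong′ Z (λ (p , q) → convolve-adjacent (λ u v r r′ t t′ u≡v → hs (p ∷ u) (q ∷ v) r r′ t t′ (cong suc u≡v)) u x y w) ⟩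
  ∑ Z (λ c → s *ℤ convolve (shift c) (u ++ x ∷ y ∷ w))          ≡⟨ ∑-*ˡ s Z _ ⟩
  s *ℤ ∑ Z (λ c → convolve (shift c) (u ++ x ∷ y ∷ w))          ≡⟨ cong (s *ℤ_) (convolve-∷ h z (u ++ x ∷ y ∷ w)) ⟨
  s *ℤ convolve h (z ∷ u ++ x ∷ y ∷ w)                          ∎
  where
  open ≡-Reasoning
  s = sgn (θ x * θ y)
  Z = splitExponents z
  shift : Letter × Letter → Kernel
  shift (p , q) u v = h (p ∷ u) (q ∷ v)

convolve-∷ʳ : ∀ h w → convolve h (w ∷ʳ (0 , false)) ≡ convolve (λ u v → h (u ∷ʳ (0 , false)) (v ∷ʳ (0 , false))) w
convolve-∷ʳ h []      = refl
convolve-∷ʳ h (x ∷ w) = begin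
  convolve h (x ∷ w ∷ʳ z)                                                      ≡⟨ convolve-∷ h x (w ∷ʳ z) ⟩
  ∑ X (λ (p , q) → convolve (λ u v → h (p ∷ u) (q ∷ v)) (w ∷ʳ z))              ≡⟨ ∑-cong′ X (λ (p , q) → convolve-∷ʳ (λ u v → h (p ∷ u) (q ∷ v)) w) ⟩
  ∑ X (λ (p , q) → convolve (λ u v → h (p ∷ u ∷ʳ z) (q ∷ v ∷ʳ z)) w)           ≡⟨ convolve-∷ (λ u v → h (u ∷ʳ z) (v ∷ʳ z)) x w ⟨
  convolve (λ u v → h (u ∷ʳ z) (v ∷ʳ z)) (x ∷ w)                               ∎
  where
  open ≡-Reasoning
  X = splitExponents x
  z = (0 , false)

-- Only pairs inside the two exchanged positions change: `θ q * θ p′` crossings there become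
-- `θ q′ * θ p`. All other pairs keep their relative order.
sgn-crossings-adjacent : ∀ {u′ v′} u v p p′ q q′ → length u ≡ length v →
  sgn (crossings (u ++ p′ ∷ p ∷ u′) (v ++ q′ ∷ q ∷ v′)) ≡ sgn (θ q′ * θ p + θ q * θ p′) *ℤ sgn (crossings (u ++ p ∷ p′ ∷ u′) (v ++ q ∷ q′ ∷ v′))
sgn-crossings-adjacent {u′} {v′} [] [] (_ , p) (_ , p′) (_ , q) (_ , q′) refl = begin
  sgn (i′ * (j + t) + (i * t + r))
    ≡⟨ cong sgn (expand i i′ j t r) ⟩
  sgn (i′ * j + (i * t + i′ * t + r))
    ≡⟨ sgn-+ (i′ * j) _ ⟩
  sgn (i′ * j) *ℤ sgn (i * t + i′ * t + r)
    ≡⟨ cong (λ s → sgn (i′ * j) *ℤ s) (ℤ.*-identityˡ _) ⟨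
  sgn (i′ * j) *ℤ (1ℤ *ℤ sgn (i * t + i′ * t + r))
    -- The old crossing term `i * j′` is absent from this side; inserting its sign squared supplies
    -- it once for the ratio and once for the old count.
    ≡⟨ cong (λ s → sgn (i′ * j) *ℤ (s *ℤ sgn (i * t + i′ * t + r))) (sgn² (i * j′)) ⟨
  sgn (i′ * j) *ℤ (sgn (i * j′) *ℤ sgn (i * j′) *ℤ sgn (i * t + i′ * t + r))
    ≡⟨ regroup (sgn (i′ * j)) (sgn (i * j′)) _ ⟩
  sgn (i′ * j) *ℤ sgn (i * j′) *ℤ (sgn (i * j′) *ℤ sgn (i * t + i′ * t + r))
    ≡⟨ cong₂ _*ℤ_ (sgn-+ (i′ * j) (i * j′)) (sgn-+ (i * j′) _) ⟨
  sgn (i′ * j + i * j′) *ℤ sgn (i * j′ + (i * t + i′ * t + r))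
    ≡⟨ cong (λ k → sgn (i′ * j + i * j′) *ℤ sgn k) (collect i i′ j′ t r) ⟩
  sgn (i′ * j + i * j′) *ℤ sgn (i * (j′ + t) + (i′ * t + r)) ∎
  where
  open ≡-Reasoning
  i = bit q
  i′ = bit q′
  j = bit p
  j′ = bit p′
  t = θ-degree u′
  r = crossings u′ v′
  expand : ∀ i i′ j t r → i′ * (j + t) + (i * t + r) ≡ i′ * j + (i * t + i′ * t + r)
  expand = solveℕ-∀
  collect : ∀ i i′ j t r → i * j + (i * t + i′ * t + r) ≡ i * (j + t) + (i′ * t + r)
  collect = solveℕ-∀
  regroup : ∀ a b c → a *ℤ (b *ℤ b *ℤ c) ≡ a *ℤ b *ℤ (b *ℤ c)
  regroup = solve-∀
sgn-crossings-adjacent {u′} {v′} (x ∷ u) ((_ , γ) ∷ v) p p′ q q′ u≡v = begin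
  sgn (bit γ * θ-degree (u ++ p′ ∷ p ∷ u′) + c′)             ≡⟨ cong (λ t → sgn (bit γ * t + c′)) (θ-degree-↭ (↭.++⁺ˡ u (↭.swap p′ p ↭-refl))) ⟩
  sgn (bit γ * t + c′)                                       ≡⟨ sgn-+ (bit γ * t) _ ⟩
  sgn (bit γ * t) *ℤ sgn c′                                  ≡⟨ cong (sgn (bit γ * t) *ℤ_) (sgn-crossings-adjacent u v p p′ q q′ (suc-injective u≡v)) ⟩
  sgn (bit γ * t) *ℤ (s *ℤ sgn c)                            ≡⟨ rotate (sgn (bit γ * t)) s (sgn c) ⟩
  s *ℤ (sgn (bit γ * t) *ℤ sgn c)                            ≡⟨ cong (s *ℤ_) (sgn-+ (bit γ * t) _) ⟨
  s *ℤ sgn (bit γ * t + c)                                   ∎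
  where
  open ≡-Reasoning
  t = θ-degree (u ++ p ∷ p′ ∷ u′)
  c = crossings (u ++ p ∷ p′ ∷ u′) (v ++ q ∷ q′ ∷ v′)
  c′ = crossings (u ++ p′ ∷ p ∷ u′) (v ++ q′ ∷ q ∷ v′)
  s = sgn (θ q′ * θ p + θ q * θ p′)
  rotate : ∀ a b c → a *ℤ (b *ℤ c) ≡ b *ℤ (a *ℤ c)
  rotate = solve-∀

Homogeneous : ℕ → ℕ → Series → Set
Homogeneous n m f = ∀ w → f w ≢ 0ℤ → degree w ≡ n × θ-degree w ≡ m

-- `𝒫` with the symmetry reduced to adjacent transpositions, a form that passes to products; both
-- forms are converted into each other further on.
record Symmetric (n m : ℕ) (f : Series) : Set where
  field
    wellDefined : ∀ w → f (w ∷ʳ (0 , false)) ≡ f w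
    homogeneous : Homogeneous n m f
    adjacent    : AdjacentSymmetric f

productKernel : Series → Series → Kernel
productKernel f g u v = sgn (crossings u v) *ℤ (f u *ℤ g v)

-- The three signs combine: `q′p + qp′` from the crossings, `pp′` from `f` and `qq′` from `g` add up
-- to `(p + q)(p′ + q′)`.
productKernel-adjacent : ∀ {f g} → AdjacentSymmetric f → AdjacentSymmetric g → AdjacentSymmetricKernel (productKernel f g)
productKernel-adjacent {f} {g} fs gs {u′} {v′} u v p p′ q q′ u≡v = begin
  sgn (crossings (u ++ p′ ∷ p ∷ u′) (v ++ q′ ∷ q ∷ v′)) *ℤ (f (u ++ p′ ∷ p ∷ u′) *ℤ g (v ++ q′ ∷ q ∷ v′))
    ≡⟨ cong₂ _*ℤ_ (sgn-crossings-adjacent u v p p′ q q′ u≡v) (cong₂ _*ℤ_ (fs u p p′ u′) (gs v q q′ v′)) ⟩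
  sgn (θ q′ * θ p + θ q * θ p′) *ℤ c *ℤ (sgn (θ p * θ p′) *ℤ F *ℤ (sgn (θ q * θ q′) *ℤ G))
    ≡⟨ regroup (sgn (θ q′ * θ p + θ q * θ p′)) c (sgn (θ p * θ p′)) F (sgn (θ q * θ q′)) G ⟩
  sgn (θ q′ * θ p + θ q * θ p′) *ℤ (sgn (θ p * θ p′) *ℤ sgn (θ q * θ q′)) *ℤ (c *ℤ (F *ℤ G))
    ≡⟨ cong (_*ℤ (c *ℤ (F *ℤ G))) (trans (sgn-+ (θ q′ * θ p + θ q * θ p′) _) (cong (sgn (θ q′ * θ p + θ q * θ p′) *ℤ_) (sgn-+ (θ p * θ p′) _))) ⟨
  sgn (θ q′ * θ p + θ q * θ p′ + (θ p * θ p′ + θ q * θ q′)) *ℤ (c *ℤ (F *ℤ G))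
    ≡⟨ cong (λ k → sgn k *ℤ (c *ℤ (F *ℤ G))) (factor (θ p) (θ q) (θ p′) (θ q′)) ⟩
  sgn ((θ p + θ q) * (θ p′ + θ q′)) *ℤ (c *ℤ (F *ℤ G)) ∎
  where
  open ≡-Reasoning
  c = sgn (crossings (u ++ p ∷ p′ ∷ u′) (v ++ q ∷ q′ ∷ v′))
  F = f (u ++ p ∷ p′ ∷ u′)
  G = g (v ++ q ∷ q′ ∷ v′)
  regroup : ∀ a c d F e G → a *ℤ c *ℤ (d *ℤ F *ℤ (e *ℤ G)) ≡ a *ℤ (d *ℤ e) *ℤ (c *ℤ (F *ℤ G))
  regroup = solve-∀
  factor : ∀ p q p′ q′ → q′ * p + q * p′ + (p * p′ + q * q′) ≡ (p + q) * (p′ + q′)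
  factor = solveℕ-∀

crossings-∷ʳ : ∀ {w} u v → Split w u v → crossings (u ∷ʳ (0 , false)) (v ∷ʳ (0 , false)) ≡ crossings u v
crossings-∷ʳ []      []            []       = refl
crossings-∷ʳ (_ ∷ u) ((_ , γ) ∷ v) (_ ∷ ps) = cong₂ (λ s t → bit γ * s + t)
  (trans (θ-degree-++ u _) (+-identityʳ _)) (crossings-∷ʳ u v ps)

degree-split : ∀ {w u v} → Split w u v → degree w ≡ degree u + degree v
degree-split [] = refl
degree-split {(a , _) ∷ w} {(b , _) ∷ u} {(c , _) ∷ v} ((refl , _) ∷ ps) = trans (cong (b + c +_) (degree-split ps)) (+-interchange b c _ _)

θ-degree-split : ∀ {w u v} → Split w u v → θ-degree w ≡ θ-degree u + θ-degree v
θ-degree-split [] = refl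
θ-degree-split {_ ∷ w} {p ∷ u} {q ∷ v} ((_ , θx) ∷ ps) = trans (cong₂ _+_ θx (θ-degree-split ps)) (+-interchange (θ p) (θ q) _ _)

-- The source of all support statements: degrees and prefix bounds of a product are read off a
-- single nonvanishing factorisation, and cancellation is harmless.
⊛-support : ∀ f g w → (f ⊛ g) w ≢ 0ℤ → ∃₂ λ u v → Split w u v × f u ≢ 0ℤ × g v ≢ 0ℤ
⊛-support f g w fg≢0 with ∑-nonzero (factorisations w) (λ (u , v) → productKernel f g u v) fg≢0
... | (u , v) , uv∈ , h≢0 = u , v , ∈-factorisations⁻ w uv∈
  , (λ fu≡0 → h≢0 (trans (cong (λ a → sgn (crossings u v) *ℤ (a *ℤ g v)) fu≡0) (ℤ.*-zeroʳ (sgn (crossings u v)))))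
  , (λ gv≡0 → h≢0 (trans (cong (λ a → sgn (crossings u v) *ℤ (f u *ℤ a)) gv≡0) (trans (cong (sgn (crossings u v) *ℤ_) (ℤ.*-zeroʳ (f u))) (ℤ.*-zeroʳ (sgn (crossings u v))))))

⊛-symmetric : ∀ {n m n′ m′ f g} → Symmetric n m f → Symmetric n′ m′ g → Symmetric (n + n′) (m + m′) (f ⊛ g)
⊛-symmetric {f = f} {g} F G = record
  { wellDefined = λ w → trans (convolve-∷ʳ (productKernel f g) w) (convolve-cong w λ u v s →
      cong₂ _*ℤ_ (cong sgn (crossings-∷ʳ u v s)) (cong₂ _*ℤ_ (F.wellDefined u) (G.wellDefined v)))
  ; homogeneous = λ w fg≢0 → let u , v , s , fu , gv = ⊛-support f g w fg≢0 in
      trans (degree-split s) (cong₂ _+_ (proj₁ (F.homogeneous u fu)) (proj₁ (G.homogeneous v gv))) ,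
      trans (θ-degree-split s) (cong₂ _+_ (proj₂ (F.homogeneous u fu)) (proj₂ (G.homogeneous v gv)))
  ; adjacent    = convolve-adjacent (productKernel-adjacent {f} {g} F.adjacent G.adjacent)
  }
  where
  module F = Symmetric F
  module G = Symmetric G

indicator : {P : Set} → Dec P → ℤ
indicator P? = if does P? then 1ℤ else 0ℤ

indicator-⇔ : {P Q : Set} (P? : Dec P) (Q? : Dec Q) → (P → Q) → (Q → P) → indicator P? ≡ indicator Q?
indicator-⇔ (yes p) (yes q) f g = refl
indicator-⇔ (yes p) (no ¬q) f g = contradiction (f p) ¬q
indicator-⇔ (no ¬p) (yes q) f g = contradiction (g q) ¬p
indicator-⇔ (no ¬p) (no ¬q) f g = refl

indicator-nonzero : {P : Set} (P? : Dec P) → indicator P? ≢ 0ℤ → P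
indicator-nonzero (yes p) _   = p
indicator-nonzero (no _)  0≢0 = contradiction refl 0≢0

-- At most one θ occurs, so that no sign arises.
invariant⇒adjacent : ∀ {f} → (∀ {u v} → u ↭ v → f u ≡ f v) → (∀ w → f w ≢ 0ℤ → θ-degree w ≤ 1) → AdjacentSymmetric f
invariant⇒adjacent {f} inv θ≤1 u x y v = trans (inv (↭.++⁺ˡ u (↭.swap y x ↭-refl))) (sym (sign x y))
  where
  sign : ∀ x y → sgn (θ x * θ y) *ℤ f (u ++ x ∷ y ∷ v) ≡ f (u ++ x ∷ y ∷ v)
  sign (_ , false) y           = ℤ.*-identityˡ _
  sign (_ , true)  (_ , false) = ℤ.*-identityˡ _
  sign (a , true)  (b , true)  with f (u ++ (a , true) ∷ (b , true) ∷ v) ℤ.≟ 0ℤ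
  ... | yes f≡0 = trans (cong (-1ℤ *ℤ_) f≡0) (sym f≡0)
  ... | no  f≢0 = contradiction (≤-trans (m≤n+m _ (θ-degree u)) (≤-trans (≤-reflexive (sym (θ-degree-++ u _))) (θ≤1 _ f≢0))) λ { (s≤s ()) }

degree-∷ʳ : ∀ w → degree (w ∷ʳ (0 , false)) ≡ degree w
degree-∷ʳ w = trans (degree-++ w _) (+-identityʳ _)

θ-degree-∷ʳ : ∀ w → θ-degree (w ∷ʳ (0 , false)) ≡ θ-degree w
θ-degree-∷ʳ w = trans (θ-degree-++ w _) (+-identityʳ _)

𝟙-symmetric : Symmetric 0 0 𝟙
𝟙-symmetric = record
  { wellDefined = λ w → same (cong₂ _+_ (degree-∷ʳ w) (θ-degree-∷ʳ w))
  ; homogeneous = homogeneous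
  ; adjacent    = invariant⇒adjacent {𝟙} (λ s → same (cong₂ _+_ (degree-↭ s) (θ-degree-↭ s)))
                    (λ w 1≢0 → ≤-trans (≤-reflexive (proj₂ (homogeneous w 1≢0))) z≤n)
  }
  where
  same : ∀ {i j} → i ≡ j → indicator (i ≟ 0) ≡ indicator (j ≟ 0)
  same refl = refl
  homogeneous : Homogeneous 0 0 𝟙
  homogeneous w 1≢0 = let d≡0 = indicator-nonzero (degree w + θ-degree w ≟ 0) 1≢0 in
    m+n≡0⇒m≡0 _ d≡0 , m+n≡0⇒n≡0 (degree w) d≡0

-- A row stands for `e l` or `ẽ l` according to its circle, so a product of such factors is encoded
-- by a list of rows.
squarefreeFactor : Letter → Series
squarefreeFactor (l , c) = squarefree (bit c) l

SquarefreeLetter : Letter → Set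
SquarefreeLetter (α , ε) = α + bit ε ≤ 1

squarefreeLetter? : ∀ x → Dec (SquarefreeLetter x)
squarefreeLetter? (α , ε) = α + bit ε ≤? 1

squarefree? : ∀ k n w → Dec (All SquarefreeLetter w × degree w ≡ n × θ-degree w ≡ k)
squarefree? k n w = all? squarefreeLetter? w ×-dec (degree w ≟ n) ×-dec (θ-degree w ≟ k)

squarefreeFactor-symmetric : ∀ l c → Symmetric l (bit c) (squarefreeFactor (l , c))
squarefreeFactor-symmetric l c = record
  { wellDefined = λ w → indicator-⇔ (squarefree? (bit c) l (w ∷ʳ (0 , false))) (squarefree? (bit c) l w)
      (λ (a , d , t) → All.++⁻ˡ w a , trans (sym (degree-∷ʳ w)) d , trans (sym (θ-degree-∷ʳ w)) t)
      (λ (a , d , t) → All.++⁺ a (z≤n ∷ []) , trans (degree-∷ʳ w) d , trans (θ-degree-∷ʳ w) t)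
  ; homogeneous = homogeneous
  ; adjacent    = invariant⇒adjacent {squarefreeFactor (l , c)}
      (λ {u} {v} s → indicator-⇔ (squarefree? (bit c) l u) (squarefree? (bit c) l v) (resp s) (resp (↭-sym s)))
      (λ w f≢0 → subst (_≤ 1) (sym (proj₂ (homogeneous w f≢0))) (bit≤1 c))
  }
  where
  resp : ∀ {u v} → u ↭ v → All SquarefreeLetter u × degree u ≡ l × θ-degree u ≡ bit c → All SquarefreeLetter v × degree v ≡ l × θ-degree v ≡ bit c
  resp s (a , d , t) = ↭.All-resp-↭ s a , trans (sym (degree-↭ s)) d , trans (sym (θ-degree-↭ s)) t
  homogeneous : Homogeneous l (bit c) (squarefreeFactor (l , c))
  homogeneous w f≢0 = proj₂ (indicator-nonzero (squarefree? (bit c) l w) f≢0)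
  bit≤1 : ∀ c → bit c ≤ 1
  bit≤1 true  = s≤s z≤n
  bit≤1 false = z≤n

∏-squarefree-symmetric : ∀ F → Symmetric (degree F) (θ-degree F) (∏ (map squarefreeFactor F))
∏-squarefree-symmetric []            = 𝟙-symmetric
∏-squarefree-symmetric ((l , c) ∷ F) = ⊛-symmetric (squarefreeFactor-symmetric l c) (∏-squarefree-symmetric F)

-- Symmetry under adjacent transpositions and under all permutations

infix 4 _<ᶠ_
-- Boolean, so that inversion counts become sums of bits; the bounds are independent, so that
-- elements before and after `punchIn` compare without coercions.
_<ᶠ_ : ∀ {i j} → Fin i → Fin j → Bool
a <ᶠ b = toℕ a <ᵇ toℕ b

length-filter-tabulate : {A : Set} {P : A → Set} (P? : ∀ x → Dec (P x)) → ∀ {k} (f : Fin k → A) →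
  length (filter P? (tabulate f)) ≡ sum (λ i → bit (does (P? (f i))))
length-filter-tabulate P? {zero}  f = refl
length-filter-tabulate P? {suc k} f with does (P? (f zero))
... | true  = cong suc (length-filter-tabulate P? (f ∘ suc))
... | false = length-filter-tabulate P? (f ∘ suc)

length-filter-++ : {A : Set} {P : A → Set} (P? : ∀ x → Dec (P x)) → ∀ xs ys →
  length (filter P? (xs ++ ys)) ≡ length (filter P? xs) + length (filter P? ys)
length-filter-++ P? xs ys = trans (cong length (filter-++ P? xs ys)) (length-++ (filter P? xs))

length-filter-product : {A B : Set} {P : A × B → Set} (P? : ∀ x → Dec (P x)) → ∀ {k l} (f : Fin k → A) (g : Fin l → B) →
  length (filter P? (cartesianProduct (tabulate f) (tabulate g))) ≡ sum (λ i → sum (λ j → bit (does (P? (f i , g j)))))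
length-filter-product P? {zero}  f g = refl
length-filter-product P? {suc k} f g = trans
  (length-filter-++ P? (map (f zero ,_) (tabulate g)) _)
  (cong₂ _+_ (trans (cong (length ∘ filter P?) (map-tabulate g (f zero ,_))) (length-filter-tabulate P? (λ j → f zero , g j)))
             (length-filter-product P? (f ∘ suc) g))

inverted : ∀ {N} → (Fin N → Bool) → (Fin N → Fin N) → Fin N → Fin N → ℕ
inverted S σ i j = bit ((i <ᶠ j) ∧ ((σ j <ᶠ σ i) ∧ (S i ∧ S j)))

inversionsOn-sum : ∀ {N} S (σ : Permutation′ N) → inversionsOn S σ ≡ sum (λ i → sum (inverted S (σ ⟨$⟩ʳ_) i))
inversionsOn-sum {N} S σ = length-filter-product
  (λ (i , j) → (i Fin.<? j) ×-dec (σ ⟨$⟩ʳ j Fin.<? σ ⟨$⟩ʳ i) ×-dec T? (S i ∧ S j)) id id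

punchIn-<ᶠ : ∀ {N} k (a b : Fin N) → (punchIn k a <ᶠ punchIn k b) ≡ (a <ᶠ b)
punchIn-<ᶠ zero    a       b       = refl
punchIn-<ᶠ (suc k) zero    zero    = refl
punchIn-<ᶠ (suc k) zero    (suc b) = refl
punchIn-<ᶠ (suc k) (suc a) zero    = refl
punchIn-<ᶠ (suc k) (suc a) (suc b) = punchIn-<ᶠ k a b

punchIn-<ᶠ-self : ∀ {N} k (a : Fin N) → (punchIn k a <ᶠ k) ≡ (a <ᶠ k)
punchIn-<ᶠ-self zero    a       = refl
punchIn-<ᶠ-self (suc k) zero    = refl
punchIn-<ᶠ-self (suc k) (suc a) = punchIn-<ᶠ-self k a

sum-0 : ∀ {N} (f : Fin N → ℕ) → (∀ i → f i ≡ 0) → sum f ≡ 0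
sum-0 {zero}  f f≡0 = refl
sum-0 {suc N} f f≡0 = cong₂ _+_ (f≡0 zero) (sum-0 (f ∘ suc) (f≡0 ∘ suc))

-- Position 0 is inverted with the positions whose image lies below `k`. Among the others,
-- `punchIn k` preserves the order, so their inversions are those of `τ`.
inversionsOn-suc : ∀ {N} S (σ : Permutation′ (suc N)) k (τ : Permutation′ N) →
  σ ⟨$⟩ʳ zero ≡ k → (∀ j → σ ⟨$⟩ʳ suc j ≡ punchIn k (τ ⟨$⟩ʳ j)) →
  inversionsOn S σ ≡ sum (λ j → bit ((τ ⟨$⟩ʳ j <ᶠ k) ∧ (S zero ∧ S (suc j)))) + inversionsOn (S ∘ suc) τ
inversionsOn-suc S σ k τ refl σ-suc = trans (inversionsOn-sum S σ) (cong₂ _+_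
  (sum-cong-≗ λ j → cong (λ b → bit (b ∧ (S zero ∧ S (suc j))))
    (trans (cong (_<ᶠ k) (σ-suc j)) (punchIn-<ᶠ-self k (τ ⟨$⟩ʳ j))))
  (trans (sum-cong-≗ λ i → sum-cong-≗ λ j → cong (λ b → bit ((i <ᶠ j) ∧ (b ∧ (S (suc i) ∧ S (suc j)))))
    (trans (cong₂ _<ᶠ_ (σ-suc j) (σ-suc i)) (punchIn-<ᶠ k (τ ⟨$⟩ʳ j) (τ ⟨$⟩ʳ i))))
    (sym (inversionsOn-sum (S ∘ suc) τ))))

<ᵇ-asym : ∀ a b → (a <ᵇ b) ∧ (b <ᵇ a) ≡ false
<ᵇ-asym zero    zero    = refl
<ᵇ-asym zero    (suc b) = refl
<ᵇ-asym (suc a) zero    = refl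
<ᵇ-asym (suc a) (suc b) = <ᵇ-asym a b

inversionsOn-id : ∀ {N} (S : Fin N → Bool) → inversionsOn S Perm.id ≡ 0
inversionsOn-id S = trans (inversionsOn-sum S Perm.id) (sum-0 _ λ i → sum-0 _ λ j →
  cong bit (trans (sym (∧-assoc (i <ᶠ j) _ _)) (cong (_∧ (S i ∧ S j)) (<ᵇ-asym (toℕ i) (toℕ j)))))

adjacent-∷ : ∀ {f} x → AdjacentSymmetric f → AdjacentSymmetric (f ∘ (x ∷_))
adjacent-∷ x fs u = fs (x ∷ u)

-- The letter at position `k` passes each earlier letter once, and each passage contributes the sign
-- of one adjacent exchange.
bring-to-front : ∀ {f} → AdjacentSymmetric f → ∀ {N} (g : Fin (suc N) → Letter) k →
  f (tabulate g) ≡ sgn (sum (λ i → bit (i <ᶠ k) * (θ (g k) * θ (g i)))) *ℤ f (g k ∷ tabulate (g ∘ punchIn k))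
bring-to-front {f} fs {N} g zero = trans (sym (ℤ.*-identityˡ _))
  (cong (λ k → sgn k *ℤ f (tabulate g)) (sym (sum-0 {suc N} (λ i → bit (i <ᶠ zero {suc N}) * (θ (g zero) * θ (g i))) λ _ → refl)))
bring-to-front {f} fs {suc N} g (suc k) = begin
  f (tabulate g)                                  ≡⟨ bring-to-front {f ∘ (g zero ∷_)} (adjacent-∷ {f} (g zero) fs) (g ∘ suc) k ⟩
  sgn s *ℤ f (g zero ∷ g (suc k) ∷ t)             ≡⟨ cong (sgn s *ℤ_) (fs [] (g (suc k)) (g zero) t) ⟩
  sgn s *ℤ (sgn r *ℤ f (g (suc k) ∷ g zero ∷ t))  ≡⟨ rotate (sgn s) (sgn r) _ ⟩
  sgn r *ℤ sgn s *ℤ f (g (suc k) ∷ g zero ∷ t)    ≡⟨ cong (_*ℤ f (g (suc k) ∷ g zero ∷ t)) (trans (cong (λ i → sgn i *ℤ sgn s) (sym (+-identityʳ r))) (sym (sgn-+ (r + 0) s))) ⟩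
  sgn (r + 0 + s) *ℤ f (g (suc k) ∷ g zero ∷ t)   ∎
  where
  open ≡-Reasoning
  t = tabulate (g ∘ suc ∘ punchIn k)
  s = sum (λ i → bit (i <ᶠ k) * (θ (g (suc k)) * θ (g (suc i))))
  r = θ (g (suc k)) * θ (g zero)
  rotate : ∀ a b c → a *ℤ (b *ℤ c) ≡ b *ℤ a *ℤ c
  rotate = solve-∀

bit-∧ : ∀ a b → bit (a ∧ b) ≡ bit a * bit b
bit-∧ true  b = sym (+-identityʳ _)
bit-∧ false b = refl

-- Bringing the image of the first letter back to the front leaves the tail permuted by `τ`. The
-- letters passed are those that `σ` inverts with position 0, which is the recursion of
-- `inversionsOn-suc`.
adjacent⇒symmetric : ∀ {f} → AdjacentSymmetric f → ∀ w (σ : Permutation′ (length w)) →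
  f (permute w σ) ≡ sgn (inversionsOn (proj₂ ∘ lookup w) σ) *ℤ f w
adjacent⇒symmetric fs [] σ = sym (ℤ.*-identityˡ _)
adjacent⇒symmetric {f} fs (x ∷ w) σ = begin
  f (tabulate g)                                            ≡⟨ bring-to-front {f} fs g k ⟩
  sgn (sum (λ i → bit (i <ᶠ k) * (θ (g k) * θ (g i)))) *ℤ f (g k ∷ tabulate (g ∘ punchIn k))
    ≡⟨ cong₂ (λ s t → sgn s *ℤ f t) count (cong₂ _∷_ gk≡x (tabulate-cong rest)) ⟩
  sgn s *ℤ f (x ∷ permute w τ)                              ≡⟨ cong (sgn s *ℤ_) (adjacent⇒symmetric {f ∘ (x ∷_)} (adjacent-∷ {f} x fs) w τ) ⟩
  sgn s *ℤ (sgn r *ℤ f (x ∷ w))                             ≡⟨ ℤ.*-assoc (sgn s) (sgn r) _ ⟨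
  sgn s *ℤ sgn r *ℤ f (x ∷ w)                               ≡⟨ cong (_*ℤ f (x ∷ w)) (sgn-+ s r) ⟨
  sgn (s + r) *ℤ f (x ∷ w)                                  ≡⟨ cong (λ i → sgn i *ℤ f (x ∷ w)) (inversionsOn-suc S σ k τ refl (Perm.punchIn-permute σ zero)) ⟨
  sgn (inversionsOn S σ) *ℤ f (x ∷ w)                       ∎
  where
  open ≡-Reasoning
  S = proj₂ ∘ lookup (x ∷ w)
  g : Fin (suc (length w)) → Letter
  g i = lookup (x ∷ w) (σ ⟨$⟩ˡ i)
  k = σ ⟨$⟩ʳ zero
  τ = Perm.remove zero σ
  s = sum (λ j → bit ((τ ⟨$⟩ʳ j <ᶠ k) ∧ (S zero ∧ S (suc j))))
  r = inversionsOn (S ∘ suc) τ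
  gσ : ∀ i → g (σ ⟨$⟩ʳ i) ≡ lookup (x ∷ w) i
  gσ i = cong (lookup (x ∷ w)) (Perm.inverseˡ σ)
  gk≡x : g k ≡ x
  gk≡x = gσ zero
  rest : ∀ i → g (punchIn k i) ≡ lookup w (τ ⟨$⟩ˡ i)
  rest i = trans (cong (g ∘ punchIn k) (sym (Perm.inverseʳ τ))) (trans (cong g (sym (Perm.punchIn-permute σ zero (τ ⟨$⟩ˡ i)))) (gσ (suc (τ ⟨$⟩ˡ i))))
  k<k : ∀ {N} (k : Fin N) → (k <ᶠ k) ≡ false
  k<k zero    = refl
  k<k (suc k) = k<k k
  count : sum (λ i → bit (i <ᶠ k) * (θ (g k) * θ (g i))) ≡ s
  count = trans (sum-permute (λ i → bit (i <ᶠ k) * (θ (g k) * θ (g i))) σ) (cong₂ _+_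
    (cong (λ b → bit b * (θ (g k) * θ (g k))) (k<k k))
    (sum-cong-≗ λ j → begin
      bit (σ ⟨$⟩ʳ suc j <ᶠ k) * (θ (g k) * θ (g (σ ⟨$⟩ʳ suc j)))  ≡⟨ cong₂ _*_ (cong bit (trans (cong (_<ᶠ k) (Perm.punchIn-permute σ zero j)) (punchIn-<ᶠ-self k (τ ⟨$⟩ʳ j)))) (cong₂ (λ y z → θ y * θ z) gk≡x (gσ (suc j))) ⟩
      bit (τ ⟨$⟩ʳ j <ᶠ k) * (bit (S zero) * bit (S (suc j)))      ≡⟨ cong (bit (τ ⟨$⟩ʳ j <ᶠ k) *_) (bit-∧ (S zero) _) ⟨
      bit (τ ⟨$⟩ʳ j <ᶠ k) * bit (S zero ∧ S (suc j))              ≡⟨ bit-∧ (τ ⟨$⟩ʳ j <ᶠ k) _ ⟨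
      bit ((τ ⟨$⟩ʳ j <ᶠ k) ∧ (S zero ∧ S (suc j)))                ∎))

adjacentSwap : ∀ (u : Monomial) x y v → Permutation′ (length (u ++ x ∷ y ∷ v))
adjacentSwap []      x y v = Perm.swap Perm.id
adjacentSwap (_ ∷ u) x y v = Perm.lift₀ (adjacentSwap u x y v)

permute-adjacentSwap : ∀ u x y v → permute (u ++ x ∷ y ∷ v) (adjacentSwap u x y v) ≡ u ++ y ∷ x ∷ v
permute-adjacentSwap []      x y v = cong (λ t → y ∷ x ∷ t) (tabulate-lookup v)
permute-adjacentSwap (z ∷ u) x y v = cong (z ∷_) (permute-adjacentSwap u x y v)

inversionsOn-adjacentSwap : ∀ u x y v → inversionsOn (proj₂ ∘ lookup (u ++ x ∷ y ∷ v)) (adjacentSwap u x y v) ≡ θ x * θ y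
inversionsOn-adjacentSwap [] (a , α) (b , β) v = begin
  inversionsOn S (Perm.swap Perm.id)                                   ≡⟨ inversionsOn-suc S (Perm.swap Perm.id) (suc zero) Perm.id refl swap-suc ⟩
  bit (α ∧ β) + sum {length v} (λ _ → 0) + inversionsOn (S ∘ suc) Perm.id  ≡⟨ cong₂ (λ s t → bit (α ∧ β) + s + t) (sum-0 {length v} (λ _ → 0) λ _ → refl) (inversionsOn-id (S ∘ suc)) ⟩
  bit (α ∧ β) + 0 + 0                                                  ≡⟨ trans (+-identityʳ _) (+-identityʳ _) ⟩
  bit (α ∧ β)                                                          ≡⟨ bit-∧ α β ⟩
  bit α * bit β                                                        ∎
  where
  open ≡-Reasoning
  S = proj₂ ∘ lookup ((a , α) ∷ (b , β) ∷ v)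
  swap-suc : ∀ j → Perm.swap {length v} Perm.id ⟨$⟩ʳ suc j ≡ punchIn (suc zero) j
  swap-suc zero    = refl
  swap-suc (suc j) = refl
inversionsOn-adjacentSwap (z ∷ u) x y v = trans
  (inversionsOn-suc (proj₂ ∘ lookup (z ∷ u ++ x ∷ y ∷ v)) (Perm.lift₀ (adjacentSwap u x y v)) zero (adjacentSwap u x y v) refl λ _ → refl)
  (cong₂ _+_ (sum-0 {length (u ++ x ∷ y ∷ v)} _ λ _ → refl) (inversionsOn-adjacentSwap u x y v))

𝒫⇒Symmetric : ∀ {n m f} → 𝒫 n m f → Symmetric n m f
𝒫⇒Symmetric {f = f} P = record
  { wellDefined = wellDefined
  ; homogeneous = homogeneous
  ; adjacent    = λ u x y v → begin
      f (u ++ y ∷ x ∷ v)                                                   ≡⟨ cong f (permute-adjacentSwap u x y v) ⟨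
      f (permute (u ++ x ∷ y ∷ v) (adjacentSwap u x y v))                  ≡⟨ symmetric (u ++ x ∷ y ∷ v) (adjacentSwap u x y v) ⟩
      sgn (inversionsOn (proj₂ ∘ lookup (u ++ x ∷ y ∷ v)) (adjacentSwap u x y v)) *ℤ f (u ++ x ∷ y ∷ v)  ≡⟨ cong (λ i → sgn i *ℤ f (u ++ x ∷ y ∷ v)) (inversionsOn-adjacentSwap u x y v) ⟩
      sgn (θ x * θ y) *ℤ f (u ++ x ∷ y ∷ v)                                ∎
  }
  where
  open 𝒫 P
  open ≡-Reasoning

Symmetric⇒𝒫 : ∀ {n m f} → Symmetric n m f → 𝒫 n m f
Symmetric⇒𝒫 {f = f} F = record
  { wellDefined = wellDefined
  ; homogeneous = homogeneous
  ; symmetric   = adjacent⇒symmetric {f} adjacent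
  }
  where open Symmetric F

-- Monomial symmetric superfunctions

sort↓ : List ℕ → List ℕ
sort↓ = Decreasing.sort

sort↓-↭ : ∀ xs → sort↓ xs ↭ xs
sort↓-↭ = Decreasing.sort-↭

sort↓-sorted : ∀ xs → Linked _≥_ (sort↓ xs)
sort↓-sorted = InsertionSort.sort-↗

sort↓-pairs : ∀ xs → AllPairs _≥_ (sort↓ xs)
sort↓-pairs xs = Linked⇒AllPairs (λ p q → ≤-trans q p) (sort↓-sorted xs)

sorted-unique : ∀ {xs ys} → AllPairs _≥_ xs → AllPairs _≥_ ys → xs ↭ ys → xs ≡ ys
sorted-unique {[]}     {ys}     _        _        p = sym (↭.↭-empty-inv (↭-sym p))
sorted-unique {x ∷ xs} {[]}     _        _        p with () ← ↭.↭-empty-inv p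
sorted-unique {x ∷ xs} {y ∷ ys} (a ∷ as) (b ∷ bs) p
  with refl ← ≤-antisym (All.lookup (≤-refl ∷ b) (↭.∈-resp-↭ p (here refl)))
                        (All.lookup (≤-refl ∷ a) (↭.∈-resp-↭ (↭-sym p) (here refl)))
  = cong (x ∷_) (sorted-unique as bs (↭.drop-∷ p))

sort↓-cong : ∀ {xs ys} → xs ↭ ys → sort↓ xs ≡ sort↓ ys
sort↓-cong {xs} {ys} p = sorted-unique (sort↓-pairs xs) (sort↓-pairs ys)
  (↭-trans (sort↓-↭ xs) (↭-trans p (↭-sym (sort↓-↭ ys))))

sort↓-fixed : ∀ {xs} → AllPairs _≥_ xs → sort↓ xs ≡ xs
sort↓-fixed {xs} s = sorted-unique (sort↓-pairs xs) s (sort↓-↭ xs)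

marked-++ : ∀ u v → marked (u ++ v) ≡ marked u ++ marked v
marked-++ []                v = refl
marked-++ ((l , true)  ∷ u) v = cong (l ∷_) (marked-++ u v)
marked-++ ((_ , false) ∷ u) v = marked-++ u v

unmarked-++ : ∀ u v → unmarked (u ++ v) ≡ unmarked u ++ unmarked v
unmarked-++ []                v = refl
unmarked-++ ((_ , true)  ∷ u) v = unmarked-++ u v
unmarked-++ ((l , false) ∷ u) v = cong (l ∷_) (unmarked-++ u v)

marked-↭ : ∀ {u v} → u ↭ v → marked u ↭ marked v
marked-↭ ↭.refl                                    = ↭-refl
marked-↭ (↭.prep (l , true) p)                     = ↭.prep l (marked-↭ p)
marked-↭ (↭.prep (_ , false) p)                    = marked-↭ p
marked-↭ (↭.swap (k , true) (l , true) p)          = ↭.swap k l (marked-↭ p)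
marked-↭ (↭.swap (k , true) (l , false) p)         = ↭.prep k (marked-↭ p)
marked-↭ (↭.swap (k , false) (l , true) p)         = ↭.prep l (marked-↭ p)
marked-↭ (↭.swap (k , false) (l , false) p)        = marked-↭ p
marked-↭ (↭.trans p q)                             = ↭-trans (marked-↭ p) (marked-↭ q)

unmarked-↭ : ∀ {u v} → u ↭ v → unmarked u ↭ unmarked v
unmarked-↭ ↭.refl                                  = ↭-refl
unmarked-↭ (↭.prep (l , false) p)                  = ↭.prep l (unmarked-↭ p)
unmarked-↭ (↭.prep (_ , true) p)                   = unmarked-↭ p
unmarked-↭ (↭.swap (k , false) (l , false) p)      = ↭.swap k l (unmarked-↭ p)
unmarked-↭ (↭.swap (k , false) (l , true) p)       = ↭.prep k (unmarked-↭ p)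
unmarked-↭ (↭.swap (k , true) (l , false) p)       = ↭.prep l (unmarked-↭ p)
unmarked-↭ (↭.swap (k , true) (l , true) p)        = unmarked-↭ p
unmarked-↭ (↭.trans p q)                           = ↭-trans (unmarked-↭ p) (unmarked-↭ q)

marked-circled : ∀ A B → marked (map circledRow A ++ map plainRow B) ≡ A
marked-circled (a ∷ A) B       = cong (a ∷_) (marked-circled A B)
marked-circled []      (_ ∷ B) = marked-circled [] B
marked-circled []      []      = refl

unmarked-plain : ∀ A B → unmarked (map circledRow A ++ map plainRow B) ≡ B
unmarked-plain (_ ∷ A) B       = unmarked-plain A B
unmarked-plain []      (b ∷ B) = cong (b ∷_) (unmarked-plain [] B)
unmarked-plain []      []      = refl

-- The zero letters are kept at the end because a rearrangement cannot delete them; `pad-invariant`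
-- discards them afterwards.
normalForm : List ℕ → List ℕ → ℕ → Monomial
normalForm P Q k = (map circledRow P ++ map plainRow Q) ++ replicate k (0 , false)

positive : List ℕ → List ℕ
positive = filter (0 <?_)

word-↭ : ∀ w → ∃ λ k → w ↭ normalForm (marked w) (positive (unmarked w)) k
word-↭ []                    = 0 , ↭-refl
word-↭ ((l , true)      ∷ w) = let k , p = word-↭ w in k , ↭.prep _ p
word-↭ ((zero , false)  ∷ w) = let k , p = word-↭ w in
  suc k , ↭-trans (↭.prep _ p) (↭-sym (↭.shift (0 , false) (map circledRow (marked w) ++ map plainRow (positive (unmarked w))) (replicate k (0 , false))))
word-↭ ((suc l , false) ∷ w) = let k , p = word-↭ w in
  k , ↭-trans (↭.prep _ p) (↭-sym (↭.++⁺ʳ (replicate k (0 , false)) (↭.shift (suc l , false) (map circledRow (marked w)) (map plainRow (positive (unmarked w))))))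

normalise : ∀ w → ∃ λ k → w ↭ normalForm (sort↓ (marked w)) (sort↓ (positive (unmarked w))) k
normalise w = let k , p = word-↭ w in k , ↭-trans p (↭.++⁺ʳ (replicate k (0 , false)) (↭.++⁺
  (↭.map⁺ circledRow (↭-sym (sort↓-↭ (marked w)))) (↭.map⁺ plainRow (↭-sym (sort↓-↭ (positive (unmarked w)))))))

degree-replicate : ∀ k → degree (replicate k (0 , false)) ≡ 0
degree-replicate zero    = refl
degree-replicate (suc k) = degree-replicate k

θ-degree-replicate : ∀ k → θ-degree (replicate k (0 , false)) ≡ 0
θ-degree-replicate zero    = refl
θ-degree-replicate (suc k) = θ-degree-replicate k

degree-parts : ∀ P Q → degree (map circledRow P ++ map plainRow Q) ≡ sumℕ (P ++ Q)
degree-parts (p ∷ P) Q       = cong (p +_) (degree-parts P Q)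
degree-parts []      (q ∷ Q) = cong (q +_) (degree-parts [] Q)
degree-parts []      []      = refl

degree-normalForm : ∀ P Q k → degree (normalForm P Q k) ≡ sumℕ (P ++ Q)
degree-normalForm P Q k = trans (degree-++ (map circledRow P ++ map plainRow Q) (replicate k (0 , false)))
  (trans (cong₂ _+_ (degree-parts P Q) (degree-replicate k)) (+-identityʳ _))

θ-degree-normalForm : ∀ P Q k → θ-degree (normalForm P Q k) ≡ length P
θ-degree-normalForm P Q k = trans (θ-degree-++ (map circledRow P ++ map plainRow Q) (replicate k (0 , false)))
  (trans (cong₂ _+_ (circles-++ P Q) (θ-degree-replicate k)) (+-identityʳ _))

-- The sign is the same for all series: this is what relates an arbitrary
-- symmetric series to the monomial ones.
↭-sign : ∀ {u v} → u ↭ v → ∃ λ k → ∀ f → AdjacentSymmetric f → f u ≡ sgn k *ℤ f v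
↭-sign ↭.refl          = 0 , λ f fs → sym (ℤ.*-identityˡ _)
↭-sign (↭.prep x p)    = let k , s = ↭-sign p in k , λ f fs → s (f ∘ (x ∷_)) (adjacent-∷ {f} x fs)
↭-sign (↭.swap {xs = xs} {ys} x y p) = let k , s = ↭-sign p in θ y * θ x + k , λ f fs → begin
  f (x ∷ y ∷ xs)                           ≡⟨ fs [] y x _ ⟩
  sgn (θ y * θ x) *ℤ f (y ∷ x ∷ xs)        ≡⟨ cong (sgn (θ y * θ x) *ℤ_) (s (λ w → f (y ∷ x ∷ w)) (λ u → fs (y ∷ x ∷ u))) ⟩
  sgn (θ y * θ x) *ℤ (sgn k *ℤ f (y ∷ x ∷ ys))  ≡⟨ ℤ.*-assoc (sgn (θ y * θ x)) (sgn k) _ ⟨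
  sgn (θ y * θ x) *ℤ sgn k *ℤ f (y ∷ x ∷ ys)    ≡⟨ cong (_*ℤ f (y ∷ x ∷ ys)) (sgn-+ (θ y * θ x) k) ⟨
  sgn (θ y * θ x + k) *ℤ f (y ∷ x ∷ ys)    ∎
  where open ≡-Reasoning
↭-sign (↭.trans {xs = u} {v} {w} p q) = let k , s = ↭-sign p ; l , t = ↭-sign q in k + l , λ f fs → begin
  f u                          ≡⟨ s f fs ⟩
  sgn k *ℤ f v                 ≡⟨ cong (sgn k *ℤ_) (t f fs) ⟩
  sgn k *ℤ (sgn l *ℤ f w)      ≡⟨ ℤ.*-assoc (sgn k) (sgn l) _ ⟨
  sgn k *ℤ sgn l *ℤ f w        ≡⟨ cong (_*ℤ f w) (sgn-+ k l) ⟨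
  sgn (k + l) *ℤ f w           ∎
  where open ≡-Reasoning

pad-invariant : ∀ {n m f} → Symmetric n m f → ∀ w k → f (w ++ replicate k (0 , false)) ≡ f w
pad-invariant {f = f} F w zero    = cong f (++-identityʳ w)
pad-invariant {f = f} F w (suc k) = trans (cong f (sym (++-assoc w ((0 , false) ∷ []) (replicate k (0 , false)))))
  (trans (pad-invariant F (w ∷ʳ (0 , false)) k) (Symmetric.wellDefined F w))

countAbove : ℕ → List ℕ → ℕ
countAbove a B = length (filter (a <?_) B)

countAbove-∷ : ∀ a b B → countAbove a (b ∷ B) ≡ bit (a <ᵇ b) + countAbove a B
countAbove-∷ a b B with a <ᵇ b
... | true  = refl
... | false = refl

<ᵇ-total : ∀ a b → a ≢ b → bit (a <ᵇ b) + bit (b <ᵇ a) ≡ 1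
<ᵇ-total zero    zero    0≢0 = contradiction refl 0≢0
<ᵇ-total zero    (suc b) _   = refl
<ᵇ-total (suc a) zero    _   = refl
<ᵇ-total (suc a) (suc b) a≢b = <ᵇ-total a b (a≢b ∘ cong suc)

-- Of the two orders of the unequal neighbours exactly one is an ascent, and every comparison with
-- another entry is the same on both sides.
sgn-ascents-swap : ∀ A a b B → a ≢ b → sgn (ascents (A ++ b ∷ a ∷ B)) ≡ -1ℤ *ℤ sgn (ascents (A ++ a ∷ b ∷ B))
sgn-ascents-swap [] a b B a≢b = begin
  sgn (countAbove b (a ∷ B) + (c + d))          ≡⟨ cong (λ i → sgn (i + (c + d))) (countAbove-∷ b a B) ⟩
  sgn (y + c′ + (c + d))                         ≡⟨ cong sgn (expand y c′ c d) ⟩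
  sgn (y + (c′ + c + d))                         ≡⟨ sgn-+ y _ ⟩
  sgn y *ℤ r                                    ≡⟨ cong (_*ℤ r) flip ⟩
  -1ℤ *ℤ sgn x *ℤ r                             ≡⟨ ℤ.*-assoc -1ℤ (sgn x) r ⟩
  -1ℤ *ℤ (sgn x *ℤ r)                           ≡⟨ cong (-1ℤ *ℤ_) (sgn-+ x _) ⟨
  -1ℤ *ℤ sgn (x + (c′ + c + d))                  ≡⟨ cong (λ i → -1ℤ *ℤ sgn i) (collect x c′ c d) ⟩
  -1ℤ *ℤ sgn (x + c + (c′ + d))                  ≡⟨ cong (λ i → -1ℤ *ℤ sgn (i + (c′ + d))) (countAbove-∷ a b B) ⟨
  -1ℤ *ℤ sgn (countAbove a (b ∷ B) + (c′ + d))   ∎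
  where
  open ≡-Reasoning
  c = countAbove a B
  c′ = countAbove b B
  d = ascents B
  x = bit (a <ᵇ b)
  y = bit (b <ᵇ a)
  r = sgn (c′ + c + d)
  expand : ∀ y c′ c d → y + c′ + (c + d) ≡ y + (c′ + c + d)
  expand = solveℕ-∀
  collect : ∀ x c′ c d → x + (c′ + c + d) ≡ x + c + (c′ + d)
  collect = solveℕ-∀
  flip : sgn y ≡ -1ℤ *ℤ sgn x
  flip = begin
    sgn y                    ≡⟨ ℤ.*-identityˡ (sgn y) ⟨
    1ℤ *ℤ sgn y              ≡⟨ cong (_*ℤ sgn y) (sgn² x) ⟨
    sgn x *ℤ sgn x *ℤ sgn y  ≡⟨ ℤ.*-assoc (sgn x) (sgn x) (sgn y) ⟩
    sgn x *ℤ (sgn x *ℤ sgn y) ≡⟨ cong (sgn x *ℤ_) (trans (sym (sgn-+ x y)) (cong sgn (<ᵇ-total a b a≢b))) ⟩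
    sgn x *ℤ -1ℤ             ≡⟨ ℤ.*-comm (sgn x) -1ℤ ⟩
    -1ℤ *ℤ sgn x             ∎
sgn-ascents-swap (z ∷ A) a b B a≢b = begin
  sgn (countAbove z (A ++ b ∷ a ∷ B) + ascents (A ++ b ∷ a ∷ B))   ≡⟨ cong (λ i → sgn (i + ascents (A ++ b ∷ a ∷ B))) (↭.↭-length (↭.filter-↭ (z <?_) (↭.++⁺ˡ A (↭.swap b a ↭-refl)))) ⟩
  sgn (c + ascents (A ++ b ∷ a ∷ B))                               ≡⟨ sgn-+ c _ ⟩
  sgn c *ℤ sgn (ascents (A ++ b ∷ a ∷ B))                          ≡⟨ cong (sgn c *ℤ_) (sgn-ascents-swap A a b B a≢b) ⟩
  sgn c *ℤ (-1ℤ *ℤ sgn (ascents (A ++ a ∷ b ∷ B)))                 ≡⟨ rotate (sgn c) (sgn (ascents (A ++ a ∷ b ∷ B))) ⟩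
  -1ℤ *ℤ (sgn c *ℤ sgn (ascents (A ++ a ∷ b ∷ B)))                 ≡⟨ cong (-1ℤ *ℤ_) (sgn-+ c _) ⟨
  -1ℤ *ℤ sgn (c + ascents (A ++ a ∷ b ∷ B))                        ∎
  where
  open ≡-Reasoning
  c = countAbove z (A ++ a ∷ b ∷ B)
  rotate : ∀ a b → a *ℤ (-1ℤ *ℤ b) ≡ -1ℤ *ℤ (a *ℤ b)
  rotate = solve-∀

superpartition-≡ : ∀ {n m} {Λ Ω : Superpartition n m} → Λᵃ Λ ≡ Λᵃ Ω → Λˢ Λ ≡ Λˢ Ω → Λ ≡ Ω
superpartition-≡ {Λ = record { Λᵃ-strict = a ; Λˢ-weak = b ; Λˢ-positive = c ; Λᵃ-length = d ; Λ-weight = e }}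
                 {record { Λᵃ-strict = a′ ; Λˢ-weak = b′ ; Λˢ-positive = c′ ; Λᵃ-length = d′ ; Λ-weight = e′ }} refl refl
  with refl ← Linked.irrelevant ≤-irrelevant a a′
     | refl ← Linked.irrelevant ≤-irrelevant b b′
     | refl ← All.irrelevant ≤-irrelevant c c′
     | refl ← ≡-irrelevant d d′
     | refl ← ≡-irrelevant e e′ = refl

Λᵃ-pairs : ∀ {n m} (Λ : Superpartition n m) → AllPairs _>_ (Λᵃ Λ)
Λᵃ-pairs Λ = Linked⇒AllPairs (λ p q → <-trans q p) (Λᵃ-strict Λ)

Λˢ-pairs : ∀ {n m} (Λ : Superpartition n m) → AllPairs _≥_ (Λˢ Λ)
Λˢ-pairs Λ = Linked⇒AllPairs (λ p q → ≤-trans q p) (Λˢ-weak Λ)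

>⇒≥-pairs : ∀ {xs} → AllPairs _>_ xs → AllPairs _≥_ xs
>⇒≥-pairs = AllPairs.map <⇒≤

-- The condition for `w` to be, up to sign, a term of the monomial function of `Λ`.
HasType : ∀ {n m} → Superpartition n m → Monomial → Set
HasType Λ w = sort↓ (marked w) ≡ Λᵃ Λ × sort↓ (positive (unmarked w)) ≡ Λˢ Λ

hasType? : ∀ {n m} (Λ : Superpartition n m) w → Dec (HasType Λ w)
hasType? Λ w = ≡-dec _≟_ (sort↓ (marked w)) (Λᵃ Λ) ×-dec ≡-dec _≟_ (sort↓ (positive (unmarked w))) (Λˢ Λ)

m-yes : ∀ {n m} (Λ : Superpartition n m) w → HasType Λ w → m[ Λ ] w ≡ sgn (ascents (marked w))
m-yes Λ w t = cong (λ b → if b then sgn (ascents (marked w)) else 0ℤ) (dec-true (hasType? Λ w) t)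

m-no : ∀ {n m} (Λ : Superpartition n m) w → ¬ HasType Λ w → m[ Λ ] w ≡ 0ℤ
m-no Λ w ¬t = cong (λ b → if b then sgn (ascents (marked w)) else 0ℤ) (dec-false (hasType? Λ w) ¬t)

HasType-↭ : ∀ {n m} (Λ : Superpartition n m) {u v} → u ↭ v → HasType Λ u → HasType Λ v
HasType-↭ Λ p (s , t) = trans (sort↓-cong (marked-↭ (↭-sym p))) s
                      , trans (sort↓-cong (↭.filter-↭ (0 <?_) (unmarked-↭ (↭-sym p)))) t

strict⇒unique-↭ : ∀ {xs ys} → AllPairs _>_ xs → xs ↭ ys → Unique ys
strict⇒unique-↭ s p = Permutationₛ.Unique-resp-↭ (setoid ℕ) (↭.↭⇒↭ₛ p) (AllPairs.map >⇒≢ s)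

no-repetition : ∀ {a : ℕ} A {B} → ¬ Unique (A ++ a ∷ a ∷ B)
no-repetition []      ((a≢a ∷ _) ∷ _) = a≢a refl
no-repetition (_ ∷ A) (_ ∷ u)         = no-repetition A u

rows-↭ : ∀ {n m} (Λ : Superpartition n m) → rows Λ ↭ map circledRow (Λᵃ Λ) ++ map plainRow (Λˢ Λ)
rows-↭ Λ = ↭.merge-↭ _ (map circledRow (Λᵃ Λ)) (map plainRow (Λˢ Λ))

rows-pairs : ∀ {n m} (Λ : Superpartition n m) → AllPairs _≽_ (rows Λ)
rows-pairs Λ = merge-sorted (Λᵃ Λ) (Λˢ Λ) (Λᵃ-pairs Λ) (Λˢ-pairs Λ)

marked-rows : ∀ {n m} (Λ : Superpartition n m) → marked (rows Λ) ≡ Λᵃ Λ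
marked-rows Λ = sorted-unique (>⇒≥-pairs (marked-strict (rows Λ) (rows-pairs Λ))) (>⇒≥-pairs (Λᵃ-pairs Λ))
  (↭-trans (marked-↭ (rows-↭ Λ)) (↭-reflexive (marked-circled (Λᵃ Λ) (Λˢ Λ))))

unmarked-rows : ∀ {n m} (Λ : Superpartition n m) → unmarked (rows Λ) ≡ Λˢ Λ
unmarked-rows Λ = sorted-unique (unmarked-weak (rows Λ) (rows-pairs Λ)) (Λˢ-pairs Λ)
  (↭-trans (unmarked-↭ (rows-↭ Λ)) (↭-reflexive (unmarked-plain (Λᵃ Λ) (Λˢ Λ))))

rows-injective : ∀ {n m} {Λ Ω : Superpartition n m} → rows Λ ≡ rows Ω → Λ ≡ Ω
rows-injective {Λ = Λ} {Ω} eq = superpartition-≡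
  (trans (sym (marked-rows Λ)) (trans (cong marked eq) (marked-rows Ω)))
  (trans (sym (unmarked-rows Λ)) (trans (cong unmarked eq) (unmarked-rows Ω)))

rows-hasType : ∀ {n m} (Λ : Superpartition n m) → HasType Λ (rows Λ)
rows-hasType Λ =
  trans (cong sort↓ (marked-rows Λ)) (sort↓-fixed (>⇒≥-pairs (Λᵃ-pairs Λ))) ,
  trans (cong (sort↓ ∘ positive) (unmarked-rows Λ))
    (trans (cong sort↓ (filter-all (0 <?_) (Λˢ-positive Λ))) (sort↓-fixed (Λˢ-pairs Λ)))

HasType-injective : ∀ {n m} {Λ Ω : Superpartition n m} {w} → HasType Λ w → HasType Ω w → Λ ≡ Ω
HasType-injective (a , s) (a′ , s′) = superpartition-≡ (trans (sym a) a′) (trans (sym s) s′)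

ascents-strict : ∀ {xs} → AllPairs _>_ xs → ascents xs ≡ 0
ascents-strict []                = refl
ascents-strict {x ∷ _} (ps ∷ ss) = cong₂ _+_ (cong length (filter-none (x <?_) (All.map <⇒≯ ps))) (ascents-strict ss)

m-rows : ∀ {n m} (Λ : Superpartition n m) → m[ Λ ] (rows Λ) ≡ 1ℤ
m-rows Λ = trans (m-yes Λ (rows Λ) (rows-hasType Λ))
  (cong sgn (trans (cong ascents (marked-rows Λ)) (ascents-strict (Λᵃ-pairs Λ))))

m-rows-≢ : ∀ {n m} (Λ Ω : Superpartition n m) → Λ ≢ Ω → m[ Λ ] (rows Ω) ≡ 0ℤ
m-rows-≢ Λ Ω Λ≢Ω = m-no Λ (rows Ω) λ t → Λ≢Ω (HasType-injective {Λ = Λ} {Ω} {rows Ω} t (rows-hasType Ω))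

m-adjacent : ∀ {n m} (Λ : Superpartition n m) → AdjacentSymmetric m[ Λ ]
m-adjacent Λ u x y v with hasType? Λ (u ++ x ∷ y ∷ v)
... | no  ¬t = trans (m-no Λ (u ++ y ∷ x ∷ v) (¬t ∘ HasType-↭ Λ (↭.++⁺ˡ u (↭.swap y x ↭-refl))))
                     (sym (trans (cong (sgn (θ x * θ y) *ℤ_) (m-no Λ (u ++ x ∷ y ∷ v) ¬t)) (ℤ.*-zeroʳ (sgn (θ x * θ y)))))
... | yes t  = trans (m-yes Λ (u ++ y ∷ x ∷ v) (HasType-↭ Λ (↭.++⁺ˡ u (↭.swap x y ↭-refl)) t))
                     (trans (sign x y t) (cong (sgn (θ x * θ y) *ℤ_) (sym (m-yes Λ (u ++ x ∷ y ∷ v) t))))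
  where
  same : ∀ x y → marked (y ∷ x ∷ v) ≡ marked (x ∷ y ∷ v) →
    sgn (ascents (marked (u ++ y ∷ x ∷ v))) ≡ 1ℤ *ℤ sgn (ascents (marked (u ++ x ∷ y ∷ v)))
  same x y eq = trans (cong (sgn ∘ ascents) (trans (marked-++ u (y ∷ x ∷ v)) (trans (cong (marked u ++_) eq) (sym (marked-++ u (x ∷ y ∷ v)))))) (sym (ℤ.*-identityˡ _))
  sign : ∀ x y → HasType Λ (u ++ x ∷ y ∷ v) →
    sgn (ascents (marked (u ++ y ∷ x ∷ v))) ≡ sgn (θ x * θ y) *ℤ sgn (ascents (marked (u ++ x ∷ y ∷ v)))
  sign (a , false) (b , β)     _ = same (a , false) (b , β) (flip β)
    where
    flip : ∀ β → marked ((b , β) ∷ (a , false) ∷ v) ≡ marked ((a , false) ∷ (b , β) ∷ v)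
    flip true  = refl
    flip false = refl
  sign (a , true)  (b , false) _ = same (a , true) (b , false) refl
  sign (a , true)  (b , true)  (s , _) = begin
    sgn (ascents (marked (u ++ (b , true) ∷ (a , true) ∷ v)))          ≡⟨ cong (sgn ∘ ascents) (marked-++ u _) ⟩
    sgn (ascents (marked u ++ b ∷ a ∷ marked v))                       ≡⟨ sgn-ascents-swap (marked u) a b (marked v) a≢b ⟩
    -1ℤ *ℤ sgn (ascents (marked u ++ a ∷ b ∷ marked v))                ≡⟨ cong (λ t → -1ℤ *ℤ sgn (ascents t)) (marked-++ u _) ⟨
    -1ℤ *ℤ sgn (ascents (marked (u ++ (a , true) ∷ (b , true) ∷ v)))   ∎
    where
    open ≡-Reasoning
    a≢b : a ≢ b
    -- The exponents carried by θs form a rearrangement of the strictly decreasing `Λᵃ`, so two of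
    -- them cannot agree.
    a≢b refl = no-repetition (marked u) (strict⇒unique-↭ (Λᵃ-pairs Λ)
      (↭-trans (↭-reflexive (sym s)) (↭-trans (sort↓-↭ _) (↭-reflexive (marked-++ u _)))))

m-symmetric : ∀ {n m} (Λ : Superpartition n m) → Symmetric n m m[ Λ ]
m-symmetric {n} {m} Λ = record
  { wellDefined = wellDefined
  ; homogeneous = homogeneous
  ; adjacent    = m-adjacent Λ
  }
  where
  marked-∷ʳ : ∀ w → marked (w ∷ʳ (0 , false)) ≡ marked w
  marked-∷ʳ w = trans (marked-++ w _) (++-identityʳ _)
  positive-∷ʳ : ∀ w → positive (unmarked (w ∷ʳ (0 , false))) ≡ positive (unmarked w)
  positive-∷ʳ w = trans (cong positive (unmarked-++ w _)) (trans (filter-++ (0 <?_) (unmarked w) _) (++-identityʳ _))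
  wellDefined : ∀ w → m[ Λ ] (w ∷ʳ (0 , false)) ≡ m[ Λ ] w
  wellDefined w rewrite marked-∷ʳ w | positive-∷ʳ w = refl
  homogeneous : Homogeneous n m m[ Λ ]
  homogeneous w m≢0 with hasType? Λ w
  ... | no  ¬t      = contradiction (m-no Λ w ¬t) m≢0
  ... | yes (s , t) = let k , p = normalise w in
    trans (degree-↭ p) (trans (degree-normalForm (sort↓ (marked w)) (sort↓ (positive (unmarked w))) k) (trans (cong₂ (λ P Q → sumℕ (P ++ Q)) s t) (Λ-weight Λ))) ,
    trans (θ-degree-↭ p) (trans (θ-degree-normalForm (sort↓ (marked w)) (sort↓ (positive (unmarked w))) k) (trans (cong length s) (Λᵃ-length Λ)))

strict-or-repeated : ∀ {xs} → Linked _≥_ xs → Linked _>_ xs ⊎ ∃₂ λ A a → ∃ λ B → xs ≡ A ++ a ∷ a ∷ B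
strict-or-repeated []  = inj₁ []
strict-or-repeated [-] = inj₁ [-]
strict-or-repeated (_∷_ {x} {y} x≥y s) with strict-or-repeated s
... | inj₂ (A , a , B , eq) = inj₂ (x ∷ A , a , B , cong (x ∷_) eq)
... | inj₁ t with y ≟ x
...   | yes refl = inj₂ ([] , x , _ , refl)
...   | no  y≢x  = inj₁ (≤∧≢⇒< x≥y y≢x ∷ t)

-- Applied to a word with two equal neighbouring circled letters: exchanging them negates the
-- coefficient and leaves the word unchanged.
fixed-by-negation : ∀ a → a ≡ -1ℤ *ℤ a → a ≡ 0ℤ
fixed-by-negation (ℤ.+ zero)   _ = refl
fixed-by-negation (ℤ.+ suc _)  ()
fixed-by-negation (ℤ.-[1+ _ ]) ()

-- Sorting `w` either reveals a wrong degree or a repeated circled exponent, which kills every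
-- coefficient, or leads to some `rows Ω` with a sign common to all `f`.
classify : ∀ n m w →
  (∀ f → Symmetric n m f → f w ≡ 0ℤ) ⊎
  Σ[ Ω ∈ Superpartition n m ] (∀ f → Symmetric n m f → f w ≡ m[ Ω ] w *ℤ f (rows Ω))
classify n m w with degree w ≟ n | θ-degree w ≟ m
... | no ≢n  | _      = inj₁ λ f F → decidable-stable (f w ℤ.≟ 0ℤ) λ f≢0 → ≢n (proj₁ (Symmetric.homogeneous F w f≢0))
... | yes _  | no ≢m  = inj₁ λ f F → decidable-stable (f w ℤ.≟ 0ℤ) λ f≢0 → ≢m (proj₂ (Symmetric.homogeneous F w f≢0))
... | yes ≡n | yes ≡m with normalise w | strict-or-repeated (sort↓-sorted (marked w))
...   | k , p | inj₂ (A , a , B , eq) = inj₁ λ f F → let j , s = ↭-sign p in begin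
  f w                        ≡⟨ s f (Symmetric.adjacent F) ⟩
  sgn j *ℤ f W               ≡⟨ cong (sgn j *ℤ_) (fixed-by-negation (f W) (trans (cong f (sym split)) (trans (Symmetric.adjacent F A′ (a , true) (a , true) B′) (cong (λ v → -1ℤ *ℤ f v) split)))) ⟩
  sgn j *ℤ 0ℤ                ≡⟨ ℤ.*-zeroʳ (sgn j) ⟩
  0ℤ                         ∎
  where
  open ≡-Reasoning
  W = normalForm (sort↓ (marked w)) (sort↓ (positive (unmarked w))) k
  Q = map plainRow (sort↓ (positive (unmarked w)))
  A′ = map circledRow A
  B′ = (map circledRow B ++ Q) ++ replicate k (0 , false)
  split : A′ ++ (a , true) ∷ (a , true) ∷ B′ ≡ W
  split = begin
    A′ ++ ((a , true) ∷ (a , true) ∷ map circledRow B ++ Q) ++ replicate k (0 , false)    ≡⟨ ++-assoc A′ _ (replicate k (0 , false)) ⟨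
    (A′ ++ (map circledRow (a ∷ a ∷ B) ++ Q)) ++ replicate k (0 , false)                  ≡⟨ cong (_++ replicate k (0 , false)) (++-assoc A′ _ Q) ⟨
    ((A′ ++ map circledRow (a ∷ a ∷ B)) ++ Q) ++ replicate k (0 , false)                  ≡⟨ cong (λ P → (P ++ Q) ++ replicate k (0 , false)) (map-++ circledRow A (a ∷ a ∷ B)) ⟨
    (map circledRow (A ++ a ∷ a ∷ B) ++ Q) ++ replicate k (0 , false)                     ≡⟨ cong (λ P → normalForm P (sort↓ (positive (unmarked w))) k) eq ⟨
    W                                                                                     ∎
...   | k , p | inj₁ strict = inj₂ (Ω , λ f F → begin
  f w                                                ≡⟨ eval f F ⟩
  -- The sign `sgn j` is not computed: the same formula for `m[ Ω ]`, which is 1 at `rows Ω`,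
  -- identifies it as `m[ Ω ] w`.
  sgn j *ℤ f (rows Ω)                                ≡⟨ cong (_*ℤ f (rows Ω)) (sym (trans (eval m[ Ω ] (m-symmetric Ω)) (trans (cong (sgn j *ℤ_) (m-rows Ω)) (ℤ.*-identityʳ (sgn j))))) ⟩
  m[ Ω ] w *ℤ f (rows Ω)                             ∎)
  where
  open ≡-Reasoning
  P = sort↓ (marked w)
  Q = sort↓ (positive (unmarked w))
  Ω : Superpartition n m
  Ω = record
    { Λᵃ          = P
    ; Λˢ          = Q
    ; Λᵃ-strict   = strict
    ; Λˢ-weak     = sort↓-sorted (positive (unmarked w))
    ; Λˢ-positive = ↭.All-resp-↭ (↭-sym (sort↓-↭ (positive (unmarked w)))) (All.all-filter (0 <?_) (unmarked w))
    ; Λᵃ-length   = trans (sym (θ-degree-normalForm P Q k)) (trans (sym (θ-degree-↭ p)) ≡m)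
    ; Λ-weight    = trans (sym (degree-normalForm P Q k)) (trans (sym (degree-↭ p)) ≡n)
    }
  p′ : w ↭ rows Ω ++ replicate k (0 , false)
  p′ = ↭-trans p (↭.++⁺ʳ (replicate k (0 , false)) (↭-sym (rows-↭ Ω)))
  j = proj₁ (↭-sign p′)
  eval : ∀ f → Symmetric n m f → f w ≡ sgn j *ℤ f (rows Ω)
  eval f F = trans (proj₂ (↭-sign p′) f (Symmetric.adjacent F)) (cong (sgn j *ℤ_) (pad-invariant F (rows Ω) k))

-- Reduces an identity of series to one value for each superpartition.
agree-on-rows : ∀ {n m f g} → Symmetric n m f → Symmetric n m g →
  (∀ (Γ : Superpartition n m) → f (rows Γ) ≡ g (rows Γ)) → f ≈ g
agree-on-rows {n} {m} {f} {g} F G same w with classify n m w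
... | inj₁ vanish     = trans (vanish f F) (sym (vanish g G))
... | inj₂ (Ω , eval) = trans (eval f F) (trans (cong (m[ Ω ] w *ℤ_) (same Ω)) (sym (eval g G)))

-- Supports and leading words of products

size : Monomial → ℕ
size w = degree w + θ-degree w

split-take : ∀ k {w u v} → Split w u v → Split (take k w) (take k u) (take k v)
split-take zero    s        = []
split-take (suc k) []       = []
split-take (suc k) (p ∷ ps) = p ∷ split-take k ps

size-split : ∀ {w u v} → Split w u v → size w ≡ size u + size v
size-split {w} {u} {v} s = trans (cong₂ _+_ (degree-split s) (θ-degree-split s)) (+-interchange (degree u) (degree v) (θ-degree u) (θ-degree v))

split-length : ∀ {w u v} → Split w u v → length u ≡ length w × length v ≡ length w
split-length []       = refl , refl
split-length (_ ∷ ps) = let p , q = split-length ps in cong suc p , cong suc q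

degree-take≤ : ∀ k w → degree (take k w) ≤ degree w
degree-take≤ zero    w       = z≤n
degree-take≤ (suc k) []      = z≤n
degree-take≤ (suc k) (x ∷ w) = +-monoʳ-≤ (proj₁ x) (degree-take≤ k w)

θ-degree-take≤ : ∀ k w → θ-degree (take k w) ≤ θ-degree w
θ-degree-take≤ zero    w       = z≤n
θ-degree-take≤ (suc k) []      = z≤n
θ-degree-take≤ (suc k) (x ∷ w) = +-monoʳ-≤ (θ x) (θ-degree-take≤ k w)

size-∷ : ∀ x w → size (x ∷ w) ≡ proj₁ x + θ x + size w
size-∷ x w = +-interchange (proj₁ x) (degree w) (θ x) (θ-degree w)

size-take-squarefree : ∀ k {w} → All SquarefreeLetter w → size (take k w) ≤ k
size-take-squarefree zero    _                  = z≤n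
size-take-squarefree (suc k) []                 = z≤n
size-take-squarefree (suc k) {x ∷ w} (p ∷ ps) =
  ≤-trans (≤-reflexive (size-∷ x (take k w))) (+-mono-≤ p (size-take-squarefree k ps))

-- The number of boxes, respectively of boxes and circles, in the first k
-- columns of the diagram with rows F.
boxBound sizeBound : ℕ → List Row → ℕ
boxBound  k F = sumℕ (map (λ r → k ⊓ proj₁ r) F)
sizeBound k F = sumℕ (map (λ r → k ⊓ (proj₁ r + θ r)) F)

squarefreeFactor-bound : ∀ k r w → squarefreeFactor r w ≢ 0ℤ →
  degree (take k w) ≤ k ⊓ proj₁ r × size (take k w) ≤ k ⊓ (proj₁ r + θ r)
squarefreeFactor-bound k (l , c) w f≢0 with indicator-nonzero (squarefree? (bit c) l w) f≢0
... | a , refl , t =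
  ⊓-glb (≤-trans (m≤m+n _ _) (size-take-squarefree k a)) (degree-take≤ k w) ,
  ⊓-glb (size-take-squarefree k a) (+-mono-≤ (degree-take≤ k w) (≤-trans (θ-degree-take≤ k w) (≤-reflexive t)))

∏-bound : ∀ k F w → ∏ (map squarefreeFactor F) w ≢ 0ℤ →
  degree (take k w) ≤ boxBound k F × size (take k w) ≤ sizeBound k F
∏-bound k [] w f≢0 =
  let d≡0 , t≡0 = Symmetric.homogeneous 𝟙-symmetric w f≢0
      d≤0 = ≤-trans (degree-take≤ k w) (≤-reflexive d≡0)
  in d≤0 , +-mono-≤ d≤0 (≤-trans (θ-degree-take≤ k w) (≤-reflexive t≡0))
∏-bound k (r ∷ F) w f≢0 =
  let u , v , s , fu , gv = ⊛-support (squarefreeFactor r) (∏ (map squarefreeFactor F)) w f≢0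
      p , q   = squarefreeFactor-bound k r u fu
      p′ , q′ = ∏-bound k F v gv
  in ≤-trans (≤-reflexive (degree-split (split-take k s))) (+-mono-≤ p p′) ,
     ≤-trans (≤-reflexive (size-split (split-take k s))) (+-mono-≤ q q′)

-- The row read as a squarefree monomial in `L` indices: its boxes are x₁, ..., x_l and its circle
-- is the θ of index l + 1. These are the smallest possible indices.
strip : ℕ → Row → Monomial
strip zero    _           = []
strip (suc L) (suc l , c) = (1 , false) ∷ strip L (l , c)
strip (suc L) (zero  , c) = (0 , c) ∷ strip L (0 , false)

-- The product up to sign, provided that no index carries a θ in both words: `∨` keeps a repeated θ,
-- where the product would vanish. `Disjoint` rules this out.
addWords : Monomial → Monomial → Monomial
addWords = zipWith λ (a , α) (b , β) → a + b , α ∨ β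

-- The column lengths of the diagram with rows `F`, a column being circled when one of its cells is
-- a circle.
leadingWord : ℕ → List Row → Monomial
leadingWord L []      = replicate L (0 , false)
leadingWord L (r ∷ F) = addWords (strip L r) (leadingWord L F)

length-strip : ∀ L r → length (strip L r) ≡ L
length-strip zero    r           = refl
length-strip (suc L) (suc l , c) = cong suc (length-strip L (l , c))
length-strip (suc L) (zero  , c) = cong suc (length-strip L (0 , false))

degree-take-strip : ∀ k L l c → l + bit c ≤ L → degree (take k (strip L (l , c))) ≡ k ⊓ l
degree-take-strip zero    L       l       c _       = refl
degree-take-strip (suc k) zero    zero    c _       = refl
degree-take-strip (suc k) (suc L) (suc l) c (s≤s p) = cong suc (degree-take-strip k L l c p)
degree-take-strip (suc k) (suc L) zero    c _       = trans (degree-take-strip k L 0 false z≤n) (⊓-zeroʳ k)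

size-take-strip : ∀ k L l c → l + bit c ≤ L → size (take k (strip L (l , c))) ≡ k ⊓ (l + bit c)
size-take-strip zero    L       l       c     _       = refl
size-take-strip (suc k) zero    zero    false _       = refl
size-take-strip (suc k) (suc L) (suc l) c     (s≤s p) = cong suc (size-take-strip k L l c p)
size-take-strip (suc k) (suc L) zero    true  _       = trans (size-∷ (0 , true) (take k (strip L (0 , false)))) (cong suc (trans (size-take-strip k L 0 false z≤n) (trans (⊓-zeroʳ k) (sym (⊓-zeroʳ k)))))
size-take-strip (suc k) (suc L) zero    false _       = trans (size-take-strip k L 0 false z≤n) (⊓-zeroʳ k)

squarefree-strip : ∀ L r → All SquarefreeLetter (strip L r)
squarefree-strip zero    r               = []
squarefree-strip (suc L) (suc l , c)     = s≤s z≤n ∷ squarefree-strip L (l , c)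
squarefree-strip (suc L) (zero  , true)  = s≤s z≤n ∷ squarefree-strip L (0 , false)
squarefree-strip (suc L) (zero  , false) = z≤n ∷ squarefree-strip L (0 , false)

degree-strip : ∀ L l c → l + bit c ≤ L → degree (strip L (l , c)) ≡ l
degree-strip zero    zero    c _       = refl
degree-strip (suc L) (suc l) c (s≤s p) = cong suc (degree-strip L l c p)
degree-strip (suc L) zero    c _       = degree-strip L 0 false z≤n

θ-degree-strip : ∀ L l c → l + bit c ≤ L → θ-degree (strip L (l , c)) ≡ bit c
θ-degree-strip zero    zero    false _       = refl
θ-degree-strip (suc L) (suc l) c     (s≤s p) = θ-degree-strip L l c p
θ-degree-strip (suc L) zero    c     _       = trans (cong (bit c +_) (θ-degree-strip L 0 false z≤n)) (+-identityʳ _)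

squarefreeFactor-strip : ∀ L r → proj₁ r + θ r ≤ L → squarefreeFactor r (strip L r) ≡ 1ℤ
squarefreeFactor-strip L (l , c) fit = cong (λ b → if b then 1ℤ else 0ℤ)
  (dec-true (squarefree? (bit c) l (strip L (l , c))) (squarefree-strip L (l , c) , degree-strip L l c fit , θ-degree-strip L l c fit))

-- A circled row comes before another one in a product only if it is shorter;
-- the θs then appear in increasing order.
Before Apart : Row → Row → Set
Before (l , c) (l′ , c′) = c ≡ false ⊎ c′ ≡ false ⊎ l < l′
Apart  (l , c) (l′ , c′) = c ≡ false ⊎ c′ ≡ false ⊎ l ≢ l′

data Disjoint : Monomial → Monomial → Set where
  []  : Disjoint [] []
  _∷_ : ∀ {x y u v} → proj₂ x ∧ proj₂ y ≡ false → Disjoint u v → Disjoint (x ∷ u) (y ∷ v)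

disjoint-strip : ∀ L r s → Apart r s → Disjoint (strip L r) (strip L s)
disjoint-strip zero    r               s               _                  = []
disjoint-strip (suc L) (suc l , c)     (suc l′ , c′)   a                  = refl ∷ disjoint-strip L (l , c) (l′ , c′) (shift a)
  where
  shift : Apart (suc l , c) (suc l′ , c′) → Apart (l , c) (l′ , c′)
  shift (inj₁ p)        = inj₁ p
  shift (inj₂ (inj₁ p)) = inj₂ (inj₁ p)
  shift (inj₂ (inj₂ p)) = inj₂ (inj₂ (p ∘ cong suc))
disjoint-strip (suc L) (suc l , c)     (zero , c′)     _                  = refl ∷ disjoint-strip L (l , c) (0 , false) (inj₂ (inj₁ refl))
disjoint-strip (suc L) (zero , c)      (suc l′ , c′)   _                  = ∧-zeroʳ c ∷ disjoint-strip L (0 , false) (l′ , c′) (inj₁ refl)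
disjoint-strip (suc L) (zero , _)      (zero , c′)     (inj₁ refl)        = refl ∷ disjoint-strip L (0 , false) (0 , false) (inj₁ refl)
disjoint-strip (suc L) (zero , c)      (zero , _)      (inj₂ (inj₁ refl)) = ∧-zeroʳ c ∷ disjoint-strip L (0 , false) (0 , false) (inj₁ refl)
disjoint-strip (suc L) (zero , c)      (zero , _)      (inj₂ (inj₂ 0≢0))  = contradiction refl 0≢0

disjoint-addWords : ∀ {u v v′} → Disjoint u v → Disjoint u v′ → Disjoint u (addWords v v′)
disjoint-addWords []       []       = []
disjoint-addWords {x ∷ _} (p ∷ ps) (q ∷ qs) = trans (∧-distribˡ-∨ (proj₂ x) _ _) (cong₂ _∨_ p q) ∷ disjoint-addWords ps qs

disjoint-replicate : ∀ u → Disjoint u (replicate (length u) (0 , false))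
disjoint-replicate []      = []
disjoint-replicate (x ∷ u) = ∧-zeroʳ (proj₂ x) ∷ disjoint-replicate u

-- The circle of a row of length l sits in column l + 1, so circled rows of different lengths have
-- their θs at different indices.
disjoint-leadingWord : ∀ L r F → All (Apart r) F → Disjoint (strip L r) (leadingWord L F)
disjoint-leadingWord L r []      []       = subst (λ k → Disjoint (strip L r) (replicate k (0 , false))) (length-strip L r) (disjoint-replicate (strip L r))
disjoint-leadingWord L r (s ∷ F) (a ∷ as) = disjoint-addWords (disjoint-strip L r s a) (disjoint-leadingWord L r F as)

split-addWords : ∀ {u v} → Disjoint u v → Split (addWords u v) u v
split-addWords []       = []
split-addWords {x ∷ _} {y ∷ _} (p ∷ ps) = (refl , bits (proj₂ x) (proj₂ y) p) ∷ split-addWords ps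
  where
  bits : ∀ α β → α ∧ β ≡ false → bit (α ∨ β) ≡ bit α + bit β
  bits true  false _ = refl
  bits false β     _ = refl

Fits : ℕ → Row → Set
Fits L r = proj₁ r + θ r ≤ L

length-leadingWord : ∀ L F → AllPairs Apart F → length (leadingWord L F) ≡ L
length-leadingWord L []      []       = length-replicate L
length-leadingWord L (r ∷ F) (a ∷ as) = trans (sym (proj₁ (split-length (split-addWords (disjoint-leadingWord L r F a))))) (length-strip L r)

take-replicate : ∀ k L → degree (take k (replicate L (0 , false))) ≡ 0 × θ-degree (take k (replicate L (0 , false))) ≡ 0
take-replicate zero    L       = refl , refl
take-replicate (suc k) zero    = refl , refl
take-replicate (suc k) (suc L) = take-replicate k L

-- Each strip fills the first columns and so attains its bounds for all `k` at once; both statistics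
-- are additive over a splitting.
leadingWord-stats : ∀ k L F → All (Fits L) F → AllPairs Apart F →
  degree (take k (leadingWord L F)) ≡ boxBound k F × size (take k (leadingWord L F)) ≡ sizeBound k F
leadingWord-stats k L []            []       []       = let p , q = take-replicate k L in p , cong₂ _+_ p q
leadingWord-stats k L ((l , c) ∷ F) (f ∷ fs) (a ∷ as) =
  let s = split-take k (split-addWords (disjoint-leadingWord L (l , c) F a))
      p , q = leadingWord-stats k L F fs as
  in trans (degree-split s) (cong₂ _+_ (degree-take-strip k L l c f) p) ,
     trans (size-split s) (cong₂ _+_ (size-take-strip k L l c f) q)

bit-injective : ∀ α β → bit α ≡ bit β → α ≡ β
bit-injective true  true  _ = refl
bit-injective false false _ = refl

-- Successive differences of the degrees give the exponents; those of the sizes, reduced by the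
-- exponents, give the θs.
stats-injective : ∀ u v → length u ≡ length v →
  (∀ k → k ≤ length u → degree (take k u) ≡ degree (take k v)) →
  (∀ k → k ≤ length u → size (take k u) ≡ size (take k v)) → u ≡ v
stats-injective []            []            _  _ _ = refl
stats-injective ((a , α) ∷ u) ((b , β) ∷ v) l≡ d≡ s≡
  with refl ← trans (sym (+-identityʳ a)) (trans (d≡ 1 (s≤s z≤n)) (+-identityʳ b))
  with refl ← bit-injective α β (trans (sym (+-identityʳ _)) (trans (+-cancelˡ-≡ (a + 0) _ _ (s≡ 1 (s≤s z≤n))) (+-identityʳ _)))
  = cong ((a , α) ∷_) (stats-injective u v (suc-injective l≡)
      (λ k k≤ → +-cancelˡ-≡ a _ _ (d≡ (suc k) (s≤s k≤)))
      (λ k k≤ → +-cancelˡ-≡ (a + bit α) _ _ (trans (sym (size-∷ (a , α) (take k u))) (trans (s≡ (suc k) (s≤s k≤)) (size-∷ (a , α) (take k v))))))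

+-tight : ∀ {a a′ b b′} → a ≤ a′ → b ≤ b′ → a + b ≡ a′ + b′ → a ≡ a′ × b ≡ b′
+-tight {a} {a′} {b} {b′} a≤a′ b≤b′ eq = a≡a′ , +-cancelˡ-≡ a b b′ (trans eq (cong (_+ b′) (sym a≡a′)))
  where
  a≡a′ : a ≡ a′
  a≡a′ = ≤-antisym a≤a′ (+-cancelʳ-≤ b′ a′ a (≤-trans (≤-reflexive (sym eq)) (+-monoʳ-≤ a b≤b′)))

leadingCrossings : ℕ → List Row → ℕ
leadingCrossings L []      = 0
leadingCrossings L (r ∷ F) = crossings (strip L r) (leadingWord L F) + leadingCrossings L F

-- Both factors of a factorisation of the leading word meet their bounds, so
-- they are the leading words of the factors.
leadingCoefficient : ∀ L F → All (Fits L) F → AllPairs Apart F →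
  ∏ (map squarefreeFactor F) (leadingWord L F) ≡ sgn (leadingCrossings L F)
leadingCoefficient L [] [] [] = cong (λ b → if b then 1ℤ else 0ℤ) (dec-true (size (replicate L (0 , false)) ≟ 0) (cong₂ _+_ (degree-replicate L) (θ-degree-replicate L)))
leadingCoefficient L (r@(l , c) ∷ F) (fit ∷ fits) (a ∷ as) = begin
  ∑ (factorisations W) (λ (u , v) → h u v)     ≡⟨ ∑-single (factorisations-unique W) (∈-factorisations⁺ split) (λ (u , v) → h u v) vanish ⟩
  sgn k *ℤ (f U *ℤ g V)                        ≡⟨ cong (sgn k *ℤ_) (cong₂ _*ℤ_ (squarefreeFactor-strip L r fit) (leadingCoefficient L F fits as)) ⟩
  sgn k *ℤ (1ℤ *ℤ sgn (leadingCrossings L F))  ≡⟨ cong (sgn k *ℤ_) (ℤ.*-identityˡ _) ⟩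
  sgn k *ℤ sgn (leadingCrossings L F)          ≡⟨ sgn-+ k _ ⟨
  sgn (k + leadingCrossings L F)               ∎
  where
  open ≡-Reasoning
  f = squarefreeFactor r
  g = ∏ (map squarefreeFactor F)
  h = productKernel f g
  U = strip L r
  V = leadingWord L F
  W = leadingWord L (r ∷ F)
  k = crossings U V
  split : Split W U V
  split = split-addWords (disjoint-leadingWord L r F a)
  vanish : ∀ uv → uv ∈ factorisations W → uv ≢ (U , V) → h (proj₁ uv) (proj₂ uv) ≡ 0ℤ
  vanish (u , v) uv∈ uv≢ with f u ℤ.≟ 0ℤ | g v ℤ.≟ 0ℤ
  ... | yes fu≡0 | _        = trans (cong (λ a → sgn (crossings u v) *ℤ (a *ℤ g v)) fu≡0) (ℤ.*-zeroʳ (sgn (crossings u v)))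
  ... | no _     | yes gv≡0 = trans (cong (λ a → sgn (crossings u v) *ℤ (f u *ℤ a)) gv≡0) (trans (cong (sgn (crossings u v) *ℤ_) (ℤ.*-zeroʳ (f u))) (ℤ.*-zeroʳ (sgn (crossings u v))))
  ... | no fu≢0  | no gv≢0  = contradiction (cong₂ _,_
      (stats-injective u U (trans (proj₁ (split-length s)) (sym (proj₁ (split-length split)))) (λ k _ → proj₁ (degrees k)) (λ k _ → proj₁ (sizes k)))
      (stats-injective v V (trans (proj₂ (split-length s)) (sym (proj₂ (split-length split)))) (λ k _ → proj₂ (degrees k)) (λ k _ → proj₂ (sizes k)))) uv≢
    where
    s = ∈-factorisations⁻ W uv∈
    degrees : ∀ k → degree (take k u) ≡ degree (take k U) × degree (take k v) ≡ degree (take k V)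
    degrees k = +-tight
      (≤-trans (proj₁ (squarefreeFactor-bound k r u fu≢0)) (≤-reflexive (sym (degree-take-strip k L l c fit))))
      (≤-trans (proj₁ (∏-bound k F v gv≢0)) (≤-reflexive (sym (proj₁ (leadingWord-stats k L F fits as)))))
      (trans (sym (degree-split (split-take k s))) (degree-split (split-take k split)))
    sizes : ∀ k → size (take k u) ≡ size (take k U) × size (take k v) ≡ size (take k V)
    sizes k = +-tight
      (≤-trans (proj₂ (squarefreeFactor-bound k r u fu≢0)) (≤-reflexive (sym (size-take-strip k L l c fit))))
      (≤-trans (proj₂ (∏-bound k F v gv≢0)) (≤-reflexive (sym (proj₂ (leadingWord-stats k L F fits as)))))
      (trans (sym (size-split (split-take k s))) (size-split (split-take k split)))

θ-degree-strip-plain : ∀ L l → θ-degree (strip L (l , false)) ≡ 0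
θ-degree-strip-plain zero    l       = refl
θ-degree-strip-plain (suc L) zero    = θ-degree-strip-plain L 0
θ-degree-strip-plain (suc L) (suc l) = θ-degree-strip-plain L l

crossings-plain : ∀ u v → θ-degree u ≡ 0 → crossings u v ≡ 0
crossings-plain []      v             t = refl
crossings-plain (x ∷ u) []            t = refl
crossings-plain (x ∷ u) ((_ , γ) ∷ v) t = cong₂ _+_
  (trans (cong (bit γ *_) (m+n≡0⇒n≡0 (θ x) t)) (*-zeroʳ (bit γ))) (crossings-plain u v (m+n≡0⇒n≡0 (θ x) t))

crossings-strip-plain : ∀ u L l → crossings u (strip L (l , false)) ≡ 0
crossings-strip-plain []      L       l       = refl
crossings-strip-plain (x ∷ u) zero    l       = refl
crossings-strip-plain (x ∷ u) (suc L) (suc l) = crossings-strip-plain u L l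
crossings-strip-plain (x ∷ u) (suc L) zero    = crossings-strip-plain u L 0

-- When both rows are circled, the first is the shorter one, so its θ has the smaller index and need
-- not be moved past the other.
crossings-strip : ∀ L r s → Before r s → crossings (strip L r) (strip L s) ≡ 0
crossings-strip L       (l , _) s       (inj₁ refl)        = crossings-plain (strip L (l , false)) (strip L s) (θ-degree-strip-plain L l)
crossings-strip L       r       (l , _) (inj₂ (inj₁ refl)) = crossings-strip-plain (strip L r) L l
crossings-strip zero    r       s       (inj₂ (inj₂ p))    = refl
crossings-strip (suc L) (zero  , c) (suc l′ , c′) (inj₂ (inj₂ p))       = crossings-plain (strip L (0 , false)) (strip L (l′ , c′)) (θ-degree-strip-plain L 0)
crossings-strip (suc L) (suc l , c) (suc l′ , c′) (inj₂ (inj₂ (s≤s p))) = crossings-strip L (l , c) (l′ , c′) (inj₂ (inj₂ p))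

crossings-addWords : ∀ u v v′ → crossings u v ≡ 0 → crossings u v′ ≡ 0 → crossings u (addWords v v′) ≡ 0
crossings-addWords []      v             v′             p q = refl
crossings-addWords (x ∷ u) []            v′             p q = refl
crossings-addWords (x ∷ u) (y ∷ v)       []             p q = refl
crossings-addWords (x ∷ u) ((_ , α) ∷ v) ((_ , β) ∷ v′) p q = cong₂ _+_
  (bits α β (m+n≡0⇒m≡0 (bit α * θ-degree u) p) (m+n≡0⇒m≡0 (bit β * θ-degree u) q))
  (crossings-addWords u v v′ (m+n≡0⇒n≡0 (bit α * θ-degree u) p) (m+n≡0⇒n≡0 (bit β * θ-degree u) q))
  where
  bits : ∀ α β {t} → bit α * t ≡ 0 → bit β * t ≡ 0 → bit (α ∨ β) * t ≡ 0
  bits true  β p q = p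
  bits false β p q = q

crossings-leadingWord : ∀ L r F → All (Before r) F → crossings (strip L r) (leadingWord L F) ≡ 0
crossings-leadingWord L r []      []       = none (strip L r) L
  where
  none : ∀ u L → crossings u (replicate L (0 , false)) ≡ 0
  none []      L       = refl
  none (x ∷ u) zero    = refl
  none (x ∷ u) (suc L) = none u L
crossings-leadingWord L r (s ∷ F) (b ∷ bs) = crossings-addWords (strip L r) (strip L s) (leadingWord L F) (crossings-strip L r s b) (crossings-leadingWord L r F bs)

leadingCrossings-ordered : ∀ L F → AllPairs Before F → leadingCrossings L F ≡ 0
leadingCrossings-ordered L []      []       = refl
leadingCrossings-ordered L (r ∷ F) (b ∷ bs) = cong₂ _+_ (crossings-leadingWord L r F b) (leadingCrossings-ordered L F bs)

-- Conjugation and dominance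

factors factors⃖ : ∀ {n m} → Superpartition n m → List Row
factors  Λ = map circledRow (Λᵃ Λ) ++ map plainRow (Λˢ Λ)
factors⃖ Λ = map circledRow (reverse (Λᵃ Λ)) ++ map plainRow (Λˢ Λ)

map-squarefreeFactor : ∀ A B → map ẽ A ++ map e B ≡ map squarefreeFactor (map circledRow A ++ map plainRow B)
map-squarefreeFactor A B = trans (cong₂ _++_ (map-∘ A) (map-∘ B)) (sym (map-++ squarefreeFactor (map circledRow A) (map plainRow B)))

e-factors : ∀ {n m} (Λ : Superpartition n m) → e[ Λ ] ≡ ∏ (map squarefreeFactor (factors Λ))
e-factors Λ = cong ∏ (map-squarefreeFactor (Λᵃ Λ) (Λˢ Λ))

e⃖-factors : ∀ {n m} (Λ : Superpartition n m) → e⃖[ Λ ] ≡ ∏ (map squarefreeFactor (factors⃖ Λ))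
e⃖-factors Λ = cong ∏ (map-squarefreeFactor (reverse (Λᵃ Λ)) (Λˢ Λ))

factors-↭ : ∀ {n m} (Λ : Superpartition n m) → factors Λ ↭ rows Λ
factors-↭ Λ = ↭-sym (rows-↭ Λ)

factors⃖-↭ : ∀ {n m} (Λ : Superpartition n m) → factors⃖ Λ ↭ rows Λ
factors⃖-↭ Λ = ↭-trans (↭.++⁺ʳ (map plainRow (Λˢ Λ)) (↭.map⁺ circledRow (↭.↭-reverse (Λᵃ Λ)))) (factors-↭ Λ)

-- `Before` and `Apart` hold automatically when the second row is plain; only pairs of circled rows
-- need an argument.
circled-first : ∀ {R : ℕ → ℕ → Set} {Q : Row → Row → Set} A B → AllPairs R A →
  (∀ {a b} → R a b → Q (circledRow a) (circledRow b)) → (∀ r b → Q r (plainRow b)) →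
  AllPairs Q (map circledRow A ++ map plainRow B)
circled-first {R} {Q} A B pairs circled plain = AllPairs.++⁺
  (AllPairs.map⁺ (AllPairs.map circled pairs)) (plains B)
  (All.map⁺ (All.universal (λ a → All.map⁺ (All.universal (plain (circledRow a)) B)) A))
  where
  plains : ∀ B → AllPairs Q (map plainRow B)
  plains []      = []
  plains (b ∷ B) = All.map⁺ (All.universal (plain (plainRow b)) B) ∷ plains B

AllPairs-reverse : ∀ {R : ℕ → ℕ → Set} {xs} → AllPairs R xs → AllPairs (λ x y → R y x) (reverse xs)
AllPairs-reverse []                              = []
AllPairs-reverse {R} (_∷_ {x = x} {xs = xs} p ps) = subst (AllPairs (λ x y → R y x)) (sym (unfold-reverse x xs))
  (AllPairs.++⁺ (AllPairs-reverse ps) ([] ∷ []) (All.map (_∷ []) (↭.All-resp-↭ (↭-sym (↭.↭-reverse xs)) p)))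

factors-apart : ∀ {n m} (Λ : Superpartition n m) → AllPairs Apart (factors Λ)
factors-apart Λ = circled-first (Λᵃ Λ) (Λˢ Λ) (Λᵃ-pairs Λ) (λ a>b → inj₂ (inj₂ (>⇒≢ a>b))) (λ _ _ → inj₂ (inj₁ refl))

factors⃖-ordered : ∀ {n m} (Λ : Superpartition n m) → AllPairs Before (factors⃖ Λ)
factors⃖-ordered Λ = circled-first (reverse (Λᵃ Λ)) (Λˢ Λ) (AllPairs-reverse (Λᵃ-pairs Λ)) (λ a<b → inj₂ (inj₂ a<b)) (λ _ _ → inj₂ (inj₁ refl))

Before⇒Apart : ∀ {r s} → Before r s → Apart r s
Before⇒Apart (inj₁ p)        = inj₁ p
Before⇒Apart (inj₂ (inj₁ p)) = inj₂ (inj₁ p)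
Before⇒Apart (inj₂ (inj₂ p)) = inj₂ (inj₂ (<⇒≢ p))

fits-size : ∀ F → All (Fits (size F)) F
fits-size []      = []
fits-size (r ∷ F) = subst (λ L → All (Fits L) (r ∷ F)) (sym (size-∷ r F))
  (m≤m+n (proj₁ r + θ r) (size F) ∷ All.map (λ p → ≤-trans p (m≤n+m (size F) (proj₁ r + θ r))) (fits-size F))

degree-rows : ∀ {n m} (Λ : Superpartition n m) → degree (rows Λ) ≡ n
degree-rows Λ = trans (boxes-merge (Λᵃ Λ) (Λˢ Λ)) (Λ-weight Λ)

θ-degree-rows : ∀ {n m} (Λ : Superpartition n m) → θ-degree (rows Λ) ≡ m
θ-degree-rows Λ = trans (circles-merge (Λᵃ Λ) (Λˢ Λ)) (Λᵃ-length Λ)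

length-parts : ∀ {n m} (Λ : Superpartition n m) → length (rows Λ) ≡ length (Λᵃ Λ ++ Λˢ Λ)
length-parts Λ = begin
  length (rows Λ)                                                         ≡⟨ ↭.↭-length (rows-↭ Λ) ⟩
  length (map circledRow (Λᵃ Λ) ++ map plainRow (Λˢ Λ))                   ≡⟨ length-++ (map circledRow (Λᵃ Λ)) ⟩
  length (map circledRow (Λᵃ Λ)) + length (map plainRow (Λˢ Λ))           ≡⟨ cong₂ _+_ (length-map circledRow (Λᵃ Λ)) (length-map plainRow (Λˢ Λ)) ⟩
  length (Λᵃ Λ) + length (Λˢ Λ)                                           ≡⟨ length-++ (Λᵃ Λ) ⟨
  length (Λᵃ Λ ++ Λˢ Λ)                                                   ∎
  where open ≡-Reasoning

length-rows : ∀ {n m} (Λ : Superpartition n m) → length (rows Λ) ≤ n + m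
length-rows Λ = subst (_≤ _) (sym (length-parts Λ)) (length≤weight Λ)

-- No row exceeds the n + m boxes and circles of the whole diagram, so strips with n + m indices cut
-- nothing off.
fits-rows : ∀ {n m} (Λ : Superpartition n m) {F} → F ↭ rows Λ → All (Fits (n + m)) F
fits-rows Λ {F} p = subst (λ L → All (Fits L) F)
  (cong₂ _+_ (trans (degree-↭ p) (degree-rows Λ)) (trans (θ-degree-↭ p) (θ-degree-rows Λ))) (fits-size F)

-- A new row of length `l` adds one box to each of the first `l` rows of the transpose, hence
-- `k ⊓ l` boxes to the first `k`.
degree-take-addColumn : ∀ k l c T → length T ≤ l → degree (take k (addColumn (l , c) T)) ≡ k ⊓ l + degree (take k T)
degree-take-addColumn zero          l       c     T             _       = refl
degree-take-addColumn (suc k)       zero    true  []            _       = cong (degree) (take-[] k)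
degree-take-addColumn (suc k)       zero    false []            _       = refl
degree-take-addColumn (suc zero)    (suc l) c     []            _       = refl
degree-take-addColumn (suc (suc k)) (suc l) c     []            _       = cong suc (degree-take-addColumn (suc k) l c [] z≤n)
degree-take-addColumn (suc k)       (suc l) c     ((a , d) ∷ T) (s≤s p) = cong suc (trans
  (cong (a +_) (degree-take-addColumn k l c T p)) (+-rotate a (k ⊓ l) (degree (take k T))))
  where
  +-rotate : ∀ a b c → a + (b + c) ≡ b + (a + c)
  +-rotate = solveℕ-∀

size-take-addColumn : ∀ k l c T → length T ≤ l → size (take k (addColumn (l , c) T)) ≡ k ⊓ (l + bit c) + size (take k T)
size-take-addColumn zero          l       c     T             _       = refl
size-take-addColumn (suc k)       zero    true  []            _       = trans (cong (λ w → size ((0 , true) ∷ w)) (take-[] k)) (cong suc (sym (trans (+-identityʳ _) (⊓-zeroʳ k))))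
size-take-addColumn (suc k)       zero    false []            _       = refl
size-take-addColumn (suc zero)    (suc l) c     []            _       = refl
size-take-addColumn (suc (suc k)) (suc l) c     []            _       = cong suc (size-take-addColumn (suc k) l c [] z≤n)
size-take-addColumn (suc k)       (suc l) c     ((a , d) ∷ T) (s≤s p) = begin
  size ((suc a , d) ∷ take k (addColumn (l , c) T))            ≡⟨ size-∷ (suc a , d) (take k (addColumn (l , c) T)) ⟩
  suc (a + bit d + size (take k (addColumn (l , c) T)))        ≡⟨ cong (λ s → suc (a + bit d + s)) (size-take-addColumn k l c T p) ⟩
  suc (a + bit d + (k ⊓ (l + bit c) + size (take k T)))        ≡⟨ cong suc (+-rotate (a + bit d) (k ⊓ (l + bit c)) (size (take k T))) ⟩
  suc (k ⊓ (l + bit c) + (a + bit d + size (take k T)))        ≡⟨ cong (λ s → suc (k ⊓ (l + bit c) + s)) (size-∷ (a , d) (take k T)) ⟨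
  suc (k ⊓ (l + bit c) + size ((a , d) ∷ take k T))            ∎
  where
  open ≡-Reasoning
  +-rotate : ∀ a b c → a + (b + c) ≡ b + (a + c)
  +-rotate = solveℕ-∀

transposeRows-stats : ∀ k R → Linked _≽_ R →
  degree (take k (transposeRows R)) ≡ boxBound k R × size (take k (transposeRows R)) ≡ sizeBound k R
transposeRows-stats k []            _ = cong degree (take-[] k) , cong size (take-[] k)
transposeRows-stats k ((l , c) ∷ R) s = let p , q = transposeRows-stats k R (tail-sorted s) in
  trans (degree-take-addColumn k l c (transposeRows R) (fits l c R s)) (cong (k ⊓ l +_) p) ,
  trans (size-take-addColumn k l c (transposeRows R) (fits l c R s)) (cong (k ⊓ (l + bit c) +_) q)

rows-conjugate : ∀ {n m} (Λ : Superpartition n m) → rows (conjugate Λ) ≡ transposeRows (rows Λ)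
rows-conjugate Λ = merge-parts (transposeRows (rows Λ)) (transpose-sorted Λ)

conjugate-stats : ∀ {n m} (Λ : Superpartition n m) {F} → F ↭ rows Λ → ∀ k →
  degree (take k (rows (conjugate Λ))) ≡ boxBound k F × size (take k (rows (conjugate Λ))) ≡ sizeBound k F
conjugate-stats Λ p k = let d , s = transposeRows-stats k (rows Λ) (rows-sorted Λ) in
  trans (cong (degree ∘ take k) (rows-conjugate Λ)) (trans d (sym (Sum.sum-↭ (↭.map⁺ (λ r → k ⊓ proj₁ r) p)))) ,
  trans (cong (size ∘ take k) (rows-conjugate Λ)) (trans s (sym (Sum.sum-↭ (↭.map⁺ (λ r → k ⊓ (proj₁ r + θ r)) p))))

paddedRows : ∀ {n m} → Superpartition n m → Monomial
paddedRows {n} {m} Λ = rows Λ ++ replicate (n + m ∸ length (rows Λ)) (0 , false)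

length-paddedRows : ∀ {n m} (Λ : Superpartition n m) → length (paddedRows Λ) ≡ n + m
length-paddedRows {n} {m} Λ = trans (length-++ (rows Λ)) (trans (cong (length (rows Λ) +_) (length-replicate _)) (m+[n∸m]≡n (length-rows Λ)))

take-padded : ∀ k w j → degree (take k (w ++ replicate j (0 , false))) ≡ degree (take k w) × θ-degree (take k (w ++ replicate j (0 , false))) ≡ θ-degree (take k w)
take-padded k       []      j = let p , q = take-replicate k j in trans p (sym (cong degree (take-[] k))) , trans q (sym (cong θ-degree (take-[] k)))
take-padded zero    (x ∷ w) j = refl , refl
take-padded (suc k) (x ∷ w) j = let p , q = take-padded k w j in cong (proj₁ x +_) p , cong (θ x +_) q

paddedRows-stats : ∀ {n m} (Λ : Superpartition n m) k →
  degree (take k (paddedRows Λ)) ≡ degree (take k (rows Λ)) × size (take k (paddedRows Λ)) ≡ size (take k (rows Λ))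
paddedRows-stats {n} {m} Λ k = let p , q = take-padded k (rows Λ) (n + m ∸ length (rows Λ)) in p , cong₂ _+_ p q

-- Both words have the column counts of the same diagram as prefix statistics, which spares a letter
-- by letter comparison of transposition with sums of strips. The order of `F` does not affect these
-- counts.
paddedRows-conjugate : ∀ {n m} (Λ : Superpartition n m) {F} → F ↭ rows Λ → AllPairs Apart F →
  paddedRows (conjugate Λ) ≡ leadingWord (n + m) F
paddedRows-conjugate {n} {m} Λ {F} p a = stats-injective (paddedRows (conjugate Λ)) (leadingWord (n + m) F)
  (trans (length-paddedRows (conjugate Λ)) (sym (length-leadingWord (n + m) F a)))
  (λ k _ → trans (proj₁ (paddedRows-stats (conjugate Λ) k)) (trans (proj₁ (conjugate-stats Λ p k)) (sym (proj₁ (leadingWord-stats k (n + m) F (fits-rows Λ p) a)))))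
  (λ k _ → trans (proj₂ (paddedRows-stats (conjugate Λ) k)) (trans (proj₂ (conjugate-stats Λ p k)) (sym (proj₂ (leadingWord-stats k (n + m) F (fits-rows Λ p) a)))))

∏-symmetric : ∀ {n m} (Λ : Superpartition n m) {F} → F ↭ rows Λ → Symmetric n m (∏ (map squarefreeFactor F))
∏-symmetric Λ {F} p = subst₂ (λ i j → Symmetric i j (∏ (map squarefreeFactor F)))
  (trans (degree-↭ p) (degree-rows Λ)) (trans (θ-degree-↭ p) (θ-degree-rows Λ)) (∏-squarefree-symmetric F)

∏-leading : ∀ {n m} (Λ : Superpartition n m) {F} → F ↭ rows Λ → AllPairs Apart F →
  ∏ (map squarefreeFactor F) (rows (conjugate Λ)) ≡ sgn (leadingCrossings (n + m) F)
∏-leading {n} {m} Λ {F} p a = begin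
  f (rows (conjugate Λ))               ≡⟨ pad-invariant (∏-symmetric Λ p) (rows (conjugate Λ)) _ ⟨
  f (paddedRows (conjugate Λ))         ≡⟨ cong f (paddedRows-conjugate Λ p a) ⟩
  f (leadingWord (n + m) F)            ≡⟨ leadingCoefficient (n + m) F (fits-rows Λ p) a ⟩
  sgn (leadingCrossings (n + m) F)     ∎
  where
  open ≡-Reasoning
  f = ∏ (map squarefreeFactor F)

infix 4 _⊑_
-- Exactly what the support bounds provide. It is used in two ways: it implies `≼`, and it makes
-- `rank` strictly increase.
record _⊑_ {n m} (Γ Δ : Superpartition n m) : Set where
  constructor dominated
  field
    boxes≤ : ∀ k → degree (take k (rows Γ)) ≤ degree (take k (rows Δ))
    sizes≤ : ∀ k → size (take k (rows Γ)) ≤ size (take k (rows Δ))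

∏-dominated : ∀ {n m} (Λ Γ : Superpartition n m) {F} → F ↭ rows Λ →
  ∏ (map squarefreeFactor F) (rows Γ) ≢ 0ℤ → Γ ⊑ conjugate Λ
∏-dominated Λ Γ {F} p f≢0 = dominated
  (λ k → ≤-trans (proj₁ (∏-bound k F (rows Γ) f≢0)) (≤-reflexive (sym (proj₁ (conjugate-stats Λ p k)))))
  (λ k → ≤-trans (proj₂ (∏-bound k F (rows Γ) f≢0)) (≤-reflexive (sym (proj₂ (conjugate-stats Λ p k)))))

e-symmetric : ∀ {n m} (Λ : Superpartition n m) → Symmetric n m e[ Λ ]
e-symmetric Λ = subst (Symmetric _ _) (sym (e-factors Λ)) (∏-symmetric Λ (factors-↭ Λ))

e⃖-symmetric : ∀ {n m} (Λ : Superpartition n m) → Symmetric n m e⃖[ Λ ]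
e⃖-symmetric Λ = subst (Symmetric _ _) (sym (e⃖-factors Λ)) (∏-symmetric Λ (factors⃖-↭ Λ))

e-dominated : ∀ {n m} (Λ Γ : Superpartition n m) → e[ Λ ] (rows Γ) ≢ 0ℤ → Γ ⊑ conjugate Λ
e-dominated Λ Γ e≢0 = ∏-dominated Λ Γ (factors-↭ Λ) λ f≡0 → e≢0 (trans (cong (λ f → f (rows Γ)) (e-factors Λ)) f≡0)

e⃖-dominated : ∀ {n m} (Λ Γ : Superpartition n m) → e⃖[ Λ ] (rows Γ) ≢ 0ℤ → Γ ⊑ conjugate Λ
e⃖-dominated Λ Γ e≢0 = ∏-dominated Λ Γ (factors⃖-↭ Λ) λ f≡0 → e≢0 (trans (cong (λ f → f (rows Γ)) (e⃖-factors Λ)) f≡0)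

e-leading : ∀ {n m} (Λ : Superpartition n m) → ∃ λ k → e[ Λ ] (rows (conjugate Λ)) ≡ sgn k
e-leading {n} {m} Λ = leadingCrossings (n + m) (factors Λ) , trans (cong (λ f → f (rows (conjugate Λ))) (e-factors Λ)) (∏-leading Λ (factors-↭ Λ) (factors-apart Λ))

e⃖-leading : ∀ {n m} (Λ : Superpartition n m) → e⃖[ Λ ] (rows (conjugate Λ)) ≡ 1ℤ
e⃖-leading {n} {m} Λ = begin
  e⃖[ Λ ] (rows (conjugate Λ))                          ≡⟨ cong (λ f → f (rows (conjugate Λ))) (e⃖-factors Λ) ⟩
  ∏ (map squarefreeFactor (factors⃖ Λ)) (rows (conjugate Λ))  ≡⟨ ∏-leading Λ (factors⃖-↭ Λ) (AllPairs.map Before⇒Apart (factors⃖-ordered Λ)) ⟩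
  sgn (leadingCrossings (n + m) (factors⃖ Λ))           ≡⟨ cong sgn (leadingCrossings-ordered (n + m) (factors⃖ Λ) (factors⃖-ordered Λ)) ⟩
  1ℤ                                                    ∎
  where open ≡-Reasoning

sum-mono : ∀ {N} {f g : Fin N → ℕ} → (∀ i → f i ≤ g i) → sum f ≤ sum g
sum-mono {zero}  f≤g = z≤n
sum-mono {suc N} f≤g = +-mono-≤ (f≤g zero) (sum-mono (f≤g ∘ suc))

sum-tight : ∀ {N} {f g : Fin N → ℕ} → (∀ i → f i ≤ g i) → sum f ≡ sum g → ∀ i → f i ≡ g i
sum-tight f≤g eq zero    = proj₁ (+-tight (f≤g zero) (sum-mono (f≤g ∘ suc)) eq)
sum-tight f≤g eq (suc i) = sum-tight (f≤g ∘ suc) (proj₂ (+-tight (f≤g zero) (sum-mono (f≤g ∘ suc)) eq)) i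

-- The index runs over 0, ..., n + m: with at most n + m rows, these prefixes already determine the
-- superpartition.
rank : ∀ {n m} → Superpartition n m → ℕ
rank {n} {m} Γ = sum {suc (n + m)} (λ i → degree (take (toℕ i) (rows Γ)) + size (take (toℕ i) (rows Γ)))

rank-strict : ∀ {n m} {Γ Δ : Superpartition n m} → Γ ⊑ Δ → Γ ≢ Δ → rank Γ < rank Δ
-- A sum of inequalities that is an equality is an equality termwise, so equal ranks give equal
-- padded rows. `m[ Γ ]` ignores padding but separates `rows Γ` from `rows Δ`, hence 1 = 0.
rank-strict {n} {m} {Γ} {Δ} (dominated b s) Γ≢Δ = ≤∧≢⇒< (sum-mono both) λ eq → contradiction (begin
  1ℤ                    ≡⟨ m-rows Γ ⟨
  m[ Γ ] (rows Γ)       ≡⟨ pad-invariant (m-symmetric Γ) (rows Γ) _ ⟨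
  m[ Γ ] (paddedRows Γ) ≡⟨ cong m[ Γ ] (same eq) ⟩
  m[ Γ ] (paddedRows Δ) ≡⟨ pad-invariant (m-symmetric Γ) (rows Δ) _ ⟩
  m[ Γ ] (rows Δ)       ≡⟨ m-rows-≢ Γ Δ Γ≢Δ ⟩
  0ℤ                    ∎) λ ()
  where
  open ≡-Reasoning
  both : ∀ i → degree (take (toℕ i) (rows Γ)) + size (take (toℕ i) (rows Γ)) ≤ degree (take (toℕ i) (rows Δ)) + size (take (toℕ i) (rows Δ))
  both i = +-mono-≤ (b (toℕ i)) (s (toℕ i))
  tight : rank Γ ≡ rank Δ → ∀ k → k ≤ n + m → degree (take k (rows Γ)) ≡ degree (take k (rows Δ)) × size (take k (rows Γ)) ≡ size (take k (rows Δ))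
  tight eq k k≤ = +-tight (b k) (s k) (subst (λ k → degree (take k (rows Γ)) + size (take k (rows Γ)) ≡ degree (take k (rows Δ)) + size (take k (rows Δ)))
    (Fin.toℕ-fromℕ< (s≤s k≤)) (sum-tight both eq (Fin.fromℕ< (s≤s k≤))))
  same : rank Γ ≡ rank Δ → paddedRows Γ ≡ paddedRows Δ
  same eq = stats-injective (paddedRows Γ) (paddedRows Δ) (trans (length-paddedRows Γ) (sym (length-paddedRows Δ)))
    (λ k k≤ → trans (proj₁ (paddedRows-stats Γ k)) (trans (proj₁ (tight eq k (≤-trans k≤ (≤-reflexive (length-paddedRows Γ))))) (sym (proj₁ (paddedRows-stats Δ k)))))
    (λ k k≤ → trans (proj₂ (paddedRows-stats Γ k)) (trans (proj₂ (tight eq k (≤-trans k≤ (≤-reflexive (length-paddedRows Γ))))) (sym (proj₂ (paddedRows-stats Δ k)))))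

-- Conjugation is an involution

cell-injective : ∀ l c l′ c′ → (∀ j → cell (l , c) j ≡ cell (l′ , c′) j) → (l , c) ≡ (l′ , c′)
cell-injective zero    true  zero     true  eq = refl
cell-injective zero    false zero     false eq = refl
cell-injective zero    true  zero     false eq with () ← eq 0
cell-injective zero    false zero     true  eq with () ← eq 0
cell-injective zero    true  (suc _)  _     eq with () ← eq 0
cell-injective zero    false (suc _)  _     eq with () ← eq 0
cell-injective (suc _) _     zero     true  eq with () ← eq 0
cell-injective (suc _) _     zero     false eq with () ← eq 0
cell-injective (suc l) c     (suc l′) c′    eq with refl ← cell-injective l c l′ c′ (eq ∘ suc) = refl

nonEmpty-cell : ∀ l c → NonEmpty (l , c) → cell (l , c) 0 ≢ blank
nonEmpty-cell zero    true _ ()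
nonEmpty-cell (suc l) c    _ ()

-- A row with neither box nor circle would be invisible at the end of a drawing; `NonEmpty` excludes
-- it, so the first blank row marks the end of the list.
drawRows-injective : ∀ {R R′} → All NonEmpty R → All NonEmpty R′ → (∀ i j → drawRows R i j ≡ drawRows R′ i j) → R ≡ R′
drawRows-injective []       []       eq = refl
drawRows-injective {R′ = (l , c) ∷ _} [] (p ∷ _) eq = contradiction (sym (eq 0 0)) (nonEmpty-cell l c p)
drawRows-injective {R = (l , c) ∷ _} (p ∷ _) [] eq = contradiction (eq 0 0) (nonEmpty-cell l c p)
drawRows-injective {(l , c) ∷ _} {(l′ , c′) ∷ _} (_ ∷ ps) (_ ∷ qs) eq =
  cong₂ _∷_ (cell-injective l c l′ c′ (eq 0)) (drawRows-injective ps qs (eq ∘ suc))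

rows-nonEmpty : ∀ {n m} (Λ : Superpartition n m) → All NonEmpty (rows Λ)
rows-nonEmpty Λ = merge-All (Λᵃ Λ) (Λˢ Λ)
  (All.universal (λ a → subst (0 <_) (+-comm 1 a) (s≤s z≤n)) (Λᵃ Λ)) (All.map (λ {b} → subst (0 <_) (sym (+-identityʳ b))) (Λˢ-positive Λ))

conjugate-involutive : ∀ {n m} (Λ : Superpartition n m) → conjugate (conjugate Λ) ≡ Λ
conjugate-involutive Λ = rows-injective (drawRows-injective (rows-nonEmpty (conjugate (conjugate Λ))) (rows-nonEmpty Λ)
  λ i j → trans (diagram-conjugate (conjugate Λ) i j) (diagram-conjugate Λ j i))

-- The Bruhat order

sum-<ᶠ : ∀ {N} (k : Fin (suc N)) → sum {N} (λ j → bit (j <ᶠ k)) ≡ toℕ k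
sum-<ᶠ {zero}  zero    = refl
sum-<ᶠ {suc N} zero    = sum-<ᶠ {N} zero
sum-<ᶠ {suc N} (suc k) = cong suc (sum-<ᶠ k)

-- The first position, sent to `k`, is inverted with exactly the positions that take the `k` smaller
-- values.
ℓ-insert : ∀ {N} (k : Fin (suc N)) (π : Permutation′ N) → ℓ (Perm.insert zero k π) ≡ toℕ k + ℓ π
ℓ-insert k π = trans (inversionsOn-suc (const true) (Perm.insert zero k π) k π refl (λ _ → refl))
  (cong (_+ ℓ π) (trans (sum-cong-≗ λ j → cong bit (∧-identityʳ (π ⟨$⟩ʳ j <ᶠ k)))
    (trans (sym (sum-permute (λ j → bit (j <ᶠ k)) π)) (sum-<ᶠ k))))

-- A transposition lifts to the shifted positions, and both lengths grow by the same `toℕ k`, so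
-- every step of a chain survives.
≤ᴮ-insert : ∀ {N} k {u v : Permutation′ N} → u ≤ᴮ v → Perm.insert zero k u ≤ᴮ Perm.insert zero k v
≤ᴮ-insert k = gmap (Perm.insert zero k) step
  where
  step : ∀ {u v} → u Perm.≈ v ⊎ (∃₂ λ i j → v Perm.≈ Perm.transpose i j ∘ₚ u × ℓ u < ℓ v) →
    Perm.insert zero k u Perm.≈ Perm.insert zero k v ⊎
    (∃₂ λ i j → Perm.insert zero k v Perm.≈ Perm.transpose i j ∘ₚ Perm.insert zero k u × ℓ (Perm.insert zero k u) < ℓ (Perm.insert zero k v))
  step (inj₁ u≈v) = inj₁ λ { zero → refl ; (suc x) → cong (punchIn k) (u≈v x) }
  step {u} {v} (inj₂ (i , j , v≈ , u<v)) = inj₂ (suc i , suc j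
    , (λ { zero → refl ; (suc x) → trans (cong (punchIn k) (v≈ x)) (cong (Perm.insert zero k u ⟨$⟩ʳ_) (sym (Perm.lift₀-transpose i j (suc x)))) })
    , subst₂ _<_ (sym (ℓ-insert k u)) (sym (ℓ-insert k v)) (+-monoʳ-< (toℕ k) u<v))

-- Typed as a position among N + 1, so that it can serve as an insertion point.
trueCount : ∀ {N} → Vec Bool N → Fin (suc N)
trueCount []          = zero
trueCount (true  ∷ b) = suc (trueCount b)
trueCount (false ∷ b) = inject₁ (trueCount b)

-- A marked first position stays in front; an unmarked one goes right behind all marked ones.
landing : ∀ {N} → Vec Bool (suc N) → Fin (suc N)
landing (true  ∷ b) = zero
landing (false ∷ b) = trueCount b

-- The shortest permutation moving the marked positions in front of the others.
unshuffle : ∀ {N} → Vec Bool N → Permutation′ N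
unshuffle []      = Perm.id
unshuffle (c ∷ b) = Perm.insert zero (landing (c ∷ b)) (unshuffle b)

prefixCount : ∀ {N} → ℕ → Vec Bool N → ℕ
prefixCount zero    _       = 0
prefixCount (suc k) []      = 0
prefixCount (suc k) (c ∷ b) = bit c + prefixCount k b

-- What remains when the first mark is lifted to a new position in front; see
-- `unshuffle-unmarkFirst`.
unmarkFirst : ∀ {N} → Vec Bool N → Vec Bool N
unmarkFirst []          = []
unmarkFirst (true  ∷ b) = false ∷ b
unmarkFirst (false ∷ b) = false ∷ unmarkFirst b

trueCount-unmarkFirst : ∀ {N} (b : Vec Bool N) → 0 < toℕ (trueCount b) → suc (trueCount (unmarkFirst b)) ≡ inject₁ (trueCount b)
trueCount-unmarkFirst (true  ∷ b) _ = refl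
trueCount-unmarkFirst (false ∷ b) p = cong inject₁ (trueCount-unmarkFirst b (subst (0 <_) (Fin.toℕ-inject₁ (trueCount b)) p))

prefixCount-unmarkFirst : ∀ {N} k (b : Vec Bool N) → prefixCount k (unmarkFirst b) ≡ pred (prefixCount k b)
prefixCount-unmarkFirst zero    b           = refl
prefixCount-unmarkFirst (suc k) []          = refl
prefixCount-unmarkFirst (suc k) (true  ∷ b) = refl
prefixCount-unmarkFirst (suc k) (false ∷ b) = prefixCount-unmarkFirst k b

-- Lowering a mark by one position is a single cover: the two permutations differ by the
-- transposition of the first two positions, and the length rises by one.
unshuffle-step : ∀ {N} (b : Vec Bool N) → unshuffle (true ∷ false ∷ b) ≤ᴮ unshuffle (false ∷ true ∷ b)
unshuffle-step b = inj₂ (zero , suc zero , (λ { zero → refl ; (suc zero) → refl ; (suc (suc x)) → refl }) , longer) ◅ ε⋆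
  where
  longer : ℓ (unshuffle (true ∷ false ∷ b)) < ℓ (unshuffle (false ∷ true ∷ b))
  longer = subst₂ _<_ (sym (trans (ℓ-insert zero (unshuffle (false ∷ b))) (ℓ-insert (trueCount b) (unshuffle b))))
    (sym (trans (ℓ-insert (suc (trueCount b)) (unshuffle (true ∷ b))) (cong (suc (toℕ (trueCount b)) +_) (ℓ-insert zero (unshuffle b))))) ≤-refl

≤ᴮ-insert′ : ∀ {N k k′} {u v : Permutation′ N} → k ≡ k′ → u ≤ᴮ v → Perm.insert zero k u ≤ᴮ Perm.insert zero k′ v
≤ᴮ-insert′ refl = ≤ᴮ-insert _

-- The mark in front descends one position at a time until it reaches the place of the first mark of
-- `b`; each further step takes place under an insertion.
unshuffle-unmarkFirst : ∀ {N} (b : Vec Bool N) → 0 < toℕ (trueCount b) → unshuffle (true ∷ unmarkFirst b) ≤ᴮ unshuffle (false ∷ b)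
unshuffle-unmarkFirst (true  ∷ b) _ = unshuffle-step b
unshuffle-unmarkFirst (false ∷ b) p = unshuffle-step (unmarkFirst b) ◅◅
  ≤ᴮ-insert′ (trueCount-unmarkFirst b p′) (unshuffle-unmarkFirst b p′)
  where p′ = subst (0 <_) (Fin.toℕ-inject₁ (trueCount b)) p

-- If only `b` starts with a mark, the first mark of `b′` is lifted to the front. Then both tails
-- lose one mark from their prefix counts, induction compares them, and the lifted mark descends
-- again by `unshuffle-unmarkFirst`.
unshuffle-mono : ∀ {N} (b b′ : Vec Bool N) → (∀ k → prefixCount k b′ ≤ prefixCount k b) →
  trueCount b ≡ trueCount b′ → unshuffle b ≤ᴮ unshuffle b′
unshuffle-mono []          []           _ _  = ε⋆
unshuffle-mono (true  ∷ b) (true  ∷ b′) p eq = ≤ᴮ-insert zero (unshuffle-mono b b′ (λ k → ≤-pred (p (suc k))) (Fin.suc-injective eq))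
unshuffle-mono (false ∷ b) (false ∷ b′) p eq = ≤ᴮ-insert′ (Fin.inject₁-injective eq) (unshuffle-mono b b′ (λ k → p (suc k)) (Fin.inject₁-injective eq))
unshuffle-mono (false ∷ b) (true  ∷ b′) p eq = contradiction (p 1) λ ()
unshuffle-mono (true  ∷ b) (false ∷ b′) p eq =
  ≤ᴮ-insert zero (unshuffle-mono b (unmarkFirst b′)
    (λ k → subst (_≤ prefixCount k b) (sym (prefixCount-unmarkFirst k b′)) (pred-mono-≤ (p (suc k))))
    (Fin.suc-injective (trans eq (sym (trueCount-unmarkFirst b′ some)))))
  ◅◅ unshuffle-unmarkFirst b′ some
  where
  some : 0 < toℕ (trueCount b′)
  some = subst (0 <_) (trans (cong toℕ eq) (Fin.toℕ-inject₁ (trueCount b′))) (s≤s z≤n)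

-- Minimal length of the permutation given by the circles

<ᵇ-irrefl : ∀ a → (a <ᵇ a) ≡ false
<ᵇ-irrefl zero    = refl
<ᵇ-irrefl (suc a) = <ᵇ-irrefl a

unshuffle-marked : ∀ {N} (b : Vec Bool N) j → (unshuffle b ⟨$⟩ʳ j <ᶠ trueCount b) ≡ Vec.lookup b j
unshuffle-marked (true  ∷ b) zero    = refl
unshuffle-marked (true  ∷ b) (suc j) = unshuffle-marked b j
unshuffle-marked (false ∷ b) zero    = trans (cong (toℕ (trueCount b) <ᵇ_) (Fin.toℕ-inject₁ (trueCount b))) (<ᵇ-irrefl (toℕ (trueCount b)))
unshuffle-marked (false ∷ b) (suc j) = trans (cong (toℕ (punchIn (trueCount b) (unshuffle b ⟨$⟩ʳ j)) <ᵇ_) (Fin.toℕ-inject₁ (trueCount b)))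
  (trans (punchIn-<ᶠ-self (trueCount b) (unshuffle b ⟨$⟩ʳ j)) (unshuffle-marked b j))

-- Only a marked position overtakes an earlier one. For diagrams the overtaking row is therefore
-- circled, hence strictly shorter than the row it overtakes.
unshuffle-inversion : ∀ {N} (b : Vec Bool N) i j → (i <ᶠ j) ≡ true → (unshuffle b ⟨$⟩ʳ j <ᶠ unshuffle b ⟨$⟩ʳ i) ≡ true →
  Vec.lookup b j ≡ true
unshuffle-inversion (true  ∷ b) zero    (suc j) _   ()
unshuffle-inversion (false ∷ b) zero    (suc j) _   w<w = trans (sym (unshuffle-marked b j)) (trans (sym (punchIn-<ᶠ-self (trueCount b) (unshuffle b ⟨$⟩ʳ j))) w<w)
unshuffle-inversion (c     ∷ b) (suc i) (suc j) i<j w<w = unshuffle-inversion b i j i<j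
  (trans (sym (punchIn-<ᶠ (landing (c ∷ b)) (unshuffle b ⟨$⟩ʳ j) (unshuffle b ⟨$⟩ʳ i))) w<w)

bit-mono : ∀ {a b} → (a ≡ true → b ≡ true) → bit a ≤ bit b
bit-mono {false}     _ = z≤n
bit-mono {true}  {b} f rewrite f refl = ≤-refl

∧-true : ∀ {a b} → a ∧ b ≡ true → a ≡ true × b ≡ true
∧-true {true} {true} _ = refl , refl

descents : ∀ {N} → (Fin N → Fin N) → (Fin N → ℕ) → ℕ
descents σ β = sum (λ i → sum (λ j → bit ((σ j <ᶠ σ i) ∧ (β j <ᵇ β i))))

-- Reindexing both sums by `σ` leaves a count depending on `α` alone, so it is the same for all
-- permutations carrying `β` to `α`.
descents-permute : ∀ {N} (σ : Permutation′ N) (α β : Fin N → ℕ) → (∀ i → α (σ ⟨$⟩ʳ i) ≡ β i) → descents (σ ⟨$⟩ʳ_) β ≡ descents id α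
descents-permute σ α β carries = trans
  (sum-cong-≗ λ i → trans (sum-cong-≗ λ j → cong₂ (λ x y → bit ((σ ⟨$⟩ʳ j <ᶠ σ ⟨$⟩ʳ i) ∧ (x <ᵇ y))) (sym (carries j)) (sym (carries i)))
    (sym (sum-permute (λ q → bit ((q <ᶠ σ ⟨$⟩ʳ i) ∧ (α q <ᵇ α (σ ⟨$⟩ʳ i)))) σ)))
  (sym (sum-permute (λ p → sum (λ q → bit ((q <ᶠ p) ∧ (α q <ᵇ α p)))) σ))

-- Every v with vβ = α inverts the pairs of unequal entries which α shows in
-- the wrong order, and w inverts no other pair.
shortest-carrier : ∀ {N} (α β : Fin N → ℕ) (w v : Permutation′ N) →
  (∀ i → α (w ⟨$⟩ʳ i) ≡ β i) → (∀ i → α (v ⟨$⟩ʳ i) ≡ β i) →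
  (∀ i j → (β j <ᵇ β i) ≡ true → (i <ᶠ j) ≡ true) →
  (∀ i j → (i <ᶠ j) ≡ true → (w ⟨$⟩ʳ j <ᶠ w ⟨$⟩ʳ i) ≡ true → (β j <ᵇ β i) ≡ true) →
  ℓ w ≤ ℓ v
shortest-carrier α β w v wβ vβ decreasing unequal = begin
  ℓ w                      ≡⟨ inversionsOn-sum (const true) w ⟩
  sum (λ i → sum (inverted (const true) (w ⟨$⟩ʳ_) i))
    ≤⟨ sum-mono (λ i → sum-mono λ j → bit-mono λ inv → let i<j , rest = ∧-true inv ; w<w , _ = ∧-true rest in cong₂ _∧_ w<w (unequal i j i<j w<w)) ⟩
  descents (w ⟨$⟩ʳ_) β     ≡⟨ descents-permute w α β wβ ⟩
  descents id α            ≡⟨ descents-permute v α β vβ ⟨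
  descents (v ⟨$⟩ʳ_) β
    ≤⟨ sum-mono (λ i → sum-mono λ j → bit-mono λ desc → let v<v , β<β = ∧-true desc in cong₂ _∧_ (decreasing i j β<β) (cong₂ _∧_ v<v refl)) ⟩
  sum (λ i → sum (inverted (const true) (v ⟨$⟩ʳ_) i))  ≡⟨ inversionsOn-sum (const true) v ⟨
  ℓ v                      ∎
  where open ≤-Reasoning

-- Built with the same insertion points as `unshuffle`, so that the permutation carries the row
-- lengths to it by construction.
arrange : ∀ {N} → Vec Row N → Vec ℕ N
arrange []            = []
arrange ((l , c) ∷ R) = Vec.insertAt (arrange R) (landing (c ∷ Vec.map proj₂ R)) l

arrange-carries : ∀ {N} (R : Vec Row N) → Carries (unshuffle (Vec.map proj₂ R)) (Vec.map proj₁ R) (arrange R)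
arrange-carries ((l , c) ∷ R) zero    = Vec.insertAt-lookup (arrange R) (landing (c ∷ Vec.map proj₂ R)) l
arrange-carries ((l , c) ∷ R) (suc i) = trans
  (Vec.insertAt-punchIn (arrange R) (landing (c ∷ Vec.map proj₂ R)) l (unshuffle (Vec.map proj₂ R) ⟨$⟩ʳ i)) (arrange-carries R i)

toℕ-trueCount : ∀ {N} (R : Vec Row N) → toℕ (trueCount (Vec.map proj₂ R)) ≡ length (marked (Vec.toList R))
toℕ-trueCount []                = refl
toℕ-trueCount ((_ , true)  ∷ R) = cong suc (toℕ-trueCount R)
toℕ-trueCount ((_ , false) ∷ R) = trans (Fin.toℕ-inject₁ (trueCount (Vec.map proj₂ R))) (toℕ-trueCount R)

toList-insertAt-++ : ∀ {N} (xs : Vec ℕ N) k x A {B} → Vec.toList xs ≡ A ++ B → toℕ k ≡ length A → Vec.toList (Vec.insertAt xs k x) ≡ A ++ x ∷ B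
toList-insertAt-++ xs       zero    x []      eq _  = cong (x ∷_) eq
toList-insertAt-++ (y ∷ xs) (suc k) x (a ∷ A) eq k≡ = let y≡a , eq′ = ∷-injective eq in
  cong₂ _∷_ y≡a (toList-insertAt-++ xs k x A eq′ (suc-injective k≡))

toList-arrange : ∀ {N} (R : Vec Row N) → Vec.toList (arrange R) ≡ marked (Vec.toList R) ++ unmarked (Vec.toList R)
toList-arrange []                = refl
toList-arrange ((l , true)  ∷ R) = cong (l ∷_) (toList-arrange R)
toList-arrange ((l , false) ∷ R) = toList-insertAt-++ (arrange R) (trueCount (Vec.map proj₂ R)) l (marked (Vec.toList R)) (toList-arrange R) (toℕ-trueCount R)

lookup-pairs : ∀ {N} (R : Vec Row N) → AllPairs _≽_ (Vec.toList R) → ∀ i j → (i <ᶠ j) ≡ true → Vec.lookup R i ≽ Vec.lookup R j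
lookup-pairs (r ∷ R) (p ∷ ps) zero    (suc j) _   = lookup-all R p j
  where
  lookup-all : ∀ {N} (R : Vec Row N) → All (r ≽_) (Vec.toList R) → ∀ j → r ≽ Vec.lookup R j
  lookup-all (_ ∷ R) (q ∷ qs) zero    = q
  lookup-all (_ ∷ R) (q ∷ qs) (suc j) = lookup-all R qs j
lookup-pairs (r ∷ R) (p ∷ ps) (suc i) (suc j) i<j = lookup-pairs R ps i j i<j

<⇒<ᵇ-true : ∀ {a b} → a < b → (a <ᵇ b) ≡ true
<⇒<ᵇ-true {zero}  {suc b} _       = refl
<⇒<ᵇ-true {suc a} {suc b} (s≤s p) = <⇒<ᵇ-true p

<ᵇ-true⇒< : ∀ {a b} → (a <ᵇ b) ≡ true → a < b
<ᵇ-true⇒< {a} {b} eq = <ᵇ⇒< a b (subst T (sym eq) _)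

unshuffle-shortest : ∀ {N} (R : Vec Row N) → AllPairs _≽_ (Vec.toList R) →
  ∀ v → Carries v (Vec.map proj₁ R) (arrange R) → ℓ (unshuffle (Vec.map proj₂ R)) ≤ ℓ v
unshuffle-shortest R sorted v vβ = shortest-carrier (Vec.lookup (arrange R)) (Vec.lookup β)
  (unshuffle (Vec.map proj₂ R)) v (arrange-carries R) vβ decreasing unequal
  where
  β = Vec.map proj₁ R
  lookupβ : ∀ i → Vec.lookup β i ≡ proj₁ (Vec.lookup R i)
  lookupβ i = Vec.lookup-map i proj₁ R
  decreasing : ∀ i j → (Vec.lookup β j <ᵇ Vec.lookup β i) ≡ true → (i <ᶠ j) ≡ true
  decreasing i j β<β with Fin.<-cmp i j
  ... | tri< i<j _ _    = <⇒<ᵇ-true i<j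
  ... | tri≈ _ refl _   = contradiction (<ᵇ-true⇒< {Vec.lookup β i} β<β) (n≮n _)
  ... | tri> _ _ j<i    = contradiction (<ᵇ-true⇒< {Vec.lookup β j} β<β)
    (≤⇒≯ (subst₂ _≤_ (sym (lookupβ i)) (sym (lookupβ j)) (≤-trans (m≤m+n _ _) (lookup-pairs R sorted j i (<⇒<ᵇ-true j<i)))))
  unequal : ∀ i j → (i <ᶠ j) ≡ true → (unshuffle (Vec.map proj₂ R) ⟨$⟩ʳ j <ᶠ unshuffle (Vec.map proj₂ R) ⟨$⟩ʳ i) ≡ true →
    (Vec.lookup β j <ᵇ Vec.lookup β i) ≡ true
  -- With a circle on row `j`, the relation `≽` is a strict inequality of lengths.
  unequal i j i<j w<w = <⇒<ᵇ-true (subst₂ _<_ (sym (lookupβ j)) (sym (lookupβ i)) (subst (_≤ proj₁ (Vec.lookup R i))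
    (trans (cong (λ c → proj₁ (Vec.lookup R j) + bit c) (trans (sym (Vec.lookup-map j proj₂ R)) (unshuffle-inversion (Vec.map proj₂ R) i j i<j w<w))) (+-comm _ 1))
    (lookup-pairs R sorted i j i<j)))

-- Superpartitions in the Bruhat order

toList-cast : ∀ {A : Set} {i j} (eq : i ≡ j) (xs : Vec A i) → Vec.toList (Vec.cast eq xs) ≡ Vec.toList xs
toList-cast refl xs = cong Vec.toList (Vec.cast-is-id refl xs)

toList-injective : ∀ {A : Set} {N} (xs ys : Vec A N) → Vec.toList xs ≡ Vec.toList ys → xs ≡ ys
toList-injective xs ys eq = trans (sym (Vec.cast-is-id refl xs)) (Vec.toList-injective refl xs ys eq)

toList-padRight : ∀ {A : Set} {i j} (i≤j : i ≤ j) (a : A) (xs : Vec A i) → Vec.toList (Vec.padRight i≤j a xs) ≡ Vec.toList xs ++ replicate (j ∸ i) a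
toList-padRight {j = j} z≤n a [] = zeros j
  where
  zeros : ∀ j → Vec.toList (Vec.replicate j a) ≡ replicate j a
  zeros zero    = refl
  zeros (suc j) = cong (a ∷_) (zeros j)
toList-padRight (s≤s i≤j) a (x ∷ xs) = cong (x ∷_) (toList-padRight i≤j a xs)

rowVector : ∀ {n m} → Superpartition n m → Vec Row (n + m)
rowVector Λ = Vec.cast (length-paddedRows Λ) (Vec.fromList (paddedRows Λ))

toList-rowVector : ∀ {n m} (Λ : Superpartition n m) → Vec.toList (rowVector Λ) ≡ paddedRows Λ
toList-rowVector Λ = trans (toList-cast (length-paddedRows Λ) _) (Vec.toList∘fromList (paddedRows Λ))

paddedRows-pairs : ∀ {n m} (Λ : Superpartition n m) → AllPairs _≽_ (paddedRows Λ)
paddedRows-pairs {n} {m} Λ = AllPairs.++⁺ (rows-pairs Λ) (zeros (n + m ∸ length (rows Λ))) (All.universal (λ _ → All.replicate⁺ _ z≤n) (rows Λ))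
  where
  zeros : ∀ k → AllPairs _≽_ (replicate k (0 , false))
  zeros zero    = []
  zeros (suc k) = All.replicate⁺ k z≤n ∷ zeros k

rowVector-pairs : ∀ {n m} (Λ : Superpartition n m) → AllPairs _≽_ (Vec.toList (rowVector Λ))
rowVector-pairs Λ = subst (AllPairs _≽_) (sym (toList-rowVector Λ)) (paddedRows-pairs Λ)

marked-zeros : ∀ k → marked (replicate k (0 , false)) ≡ []
marked-zeros zero    = refl
marked-zeros (suc k) = marked-zeros k

unmarked-zeros : ∀ k → unmarked (replicate k (0 , false)) ≡ replicate k 0
unmarked-zeros zero    = refl
unmarked-zeros (suc k) = cong (0 ∷_) (unmarked-zeros k)

arrange-rowVector : ∀ {n m} (Λ : Superpartition n m) → arrange (rowVector Λ) ≡ Λ ᶜ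
arrange-rowVector {n} {m} Λ = toList-injective (arrange (rowVector Λ)) (Λ ᶜ) (begin
  Vec.toList (arrange (rowVector Λ))                          ≡⟨ toList-arrange (rowVector Λ) ⟩
  marked (Vec.toList (rowVector Λ)) ++ unmarked (Vec.toList (rowVector Λ))  ≡⟨ cong (λ P → marked P ++ unmarked P) (toList-rowVector Λ) ⟩
  marked (rows Λ ++ Z) ++ unmarked (rows Λ ++ Z)              ≡⟨ cong₂ _++_ (marked-++ (rows Λ) Z) (unmarked-++ (rows Λ) Z) ⟩
  (marked (rows Λ) ++ marked Z) ++ (unmarked (rows Λ) ++ unmarked Z)  ≡⟨ cong₂ (λ A B → (A ++ marked Z) ++ (B ++ unmarked Z)) (marked-rows Λ) (unmarked-rows Λ) ⟩
  (Λᵃ Λ ++ marked Z) ++ (Λˢ Λ ++ unmarked Z)                  ≡⟨ cong₂ (λ A B → (Λᵃ Λ ++ A) ++ (Λˢ Λ ++ B)) (marked-zeros k) (unmarked-zeros k) ⟩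
  (Λᵃ Λ ++ []) ++ (Λˢ Λ ++ replicate k 0)                     ≡⟨ cong (_++ (Λˢ Λ ++ replicate k 0)) (++-identityʳ (Λᵃ Λ)) ⟩
  Λᵃ Λ ++ (Λˢ Λ ++ replicate k 0)                             ≡⟨ ++-assoc (Λᵃ Λ) (Λˢ Λ) (replicate k 0) ⟨
  (Λᵃ Λ ++ Λˢ Λ) ++ replicate k 0                             ≡⟨ cong (λ i → (Λᵃ Λ ++ Λˢ Λ) ++ replicate (n + m ∸ i) 0) (length-parts Λ) ⟩
  (Λᵃ Λ ++ Λˢ Λ) ++ replicate (n + m ∸ length (Λᵃ Λ ++ Λˢ Λ)) 0  ≡⟨ cong (_++ replicate (n + m ∸ length (Λᵃ Λ ++ Λˢ Λ)) 0) (Vec.toList∘fromList (Λᵃ Λ ++ Λˢ Λ)) ⟨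
  Vec.toList (Vec.fromList (Λᵃ Λ ++ Λˢ Λ)) ++ replicate (n + m ∸ length (Λᵃ Λ ++ Λˢ Λ)) 0  ≡⟨ toList-padRight (length≤weight Λ) 0 (Vec.fromList (Λᵃ Λ ++ Λˢ Λ)) ⟨
  Vec.toList (Λ ᶜ)                                            ∎)
  where
  open ≡-Reasoning
  k = n + m ∸ length (rows Λ)
  Z = replicate k (0 , false)

parts-↭ : ∀ R → marked R ++ unmarked R ↭ map proj₁ R
parts-↭ []                = ↭-refl
parts-↭ ((l , true)  ∷ R) = ↭.prep l (parts-↭ R)
parts-↭ ((l , false) ∷ R) = ↭-trans (↭.shift l (marked R) (unmarked R)) (↭.prep l (parts-↭ R))

toList-⁺ : ∀ {N} (α : Vec ℕ N) → Vec.toList (α ⁺) ≡ sort↓ (Vec.toList α)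
toList-⁺ α = trans (toList-cast (trans (↭.↭-length (sort↓-↭ (Vec.toList α))) (Vec.length-toList α)) (Vec.fromList (sort↓ (Vec.toList α)))) (Vec.toList∘fromList (sort↓ (Vec.toList α)))

arrange-⁺ : ∀ {N} (R : Vec Row N) → AllPairs _≽_ (Vec.toList R) → arrange R ⁺ ≡ Vec.map proj₁ R
arrange-⁺ R sorted = toList-injective (arrange R ⁺) (Vec.map proj₁ R) (trans (toList-⁺ (arrange R)) (sorted-unique (sort↓-pairs (Vec.toList (arrange R)))
  (subst (AllPairs _≥_) (sym (Vec.toList-map proj₁ R)) (AllPairs.map⁺ (AllPairs.map (≤-trans (m≤m+n _ _)) sorted)))
  (↭-trans (sort↓-↭ _) (↭-trans (↭-reflexive (toList-arrange R)) (↭-trans (parts-↭ (Vec.toList R)) (↭-reflexive (sym (Vec.toList-map proj₁ R))))))))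

ᶜ⁺ : ∀ {n m} (Λ : Superpartition n m) → Λ ᶜ ⁺ ≡ Vec.map proj₁ (rowVector Λ)
ᶜ⁺ Λ = trans (cong _⁺ (sym (arrange-rowVector Λ))) (arrange-⁺ (rowVector Λ) (rowVector-pairs Λ))

circleVector : ∀ {n m} → Superpartition n m → Vec Bool (n + m)
circleVector Λ = Vec.map proj₂ (rowVector Λ)

-- Identifies the permutation `w_α` of `α = Λ ᶜ`: it depends only on which rows of the padded
-- diagram are circled.
unshuffle-minimal : ∀ {n m} (Λ : Superpartition n m) → IsMinimal (unshuffle (circleVector Λ)) (Λ ᶜ)
unshuffle-minimal Λ = subst (IsMinimal w) (arrange-rowVector Λ) (subst (λ β → Carries w β α × (∀ v → Carries v β α → ℓ w ≤ ℓ v))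
  (sym (arrange-⁺ (rowVector Λ) (rowVector-pairs Λ)))
  (arrange-carries (rowVector Λ) , unshuffle-shortest (rowVector Λ) (rowVector-pairs Λ)))
  where
  w = unshuffle (circleVector Λ)
  α = arrange (rowVector Λ)

prefixCount-rows : ∀ {N} k (R : Vec Row N) → prefixCount k (Vec.map proj₂ R) ≡ θ-degree (take k (Vec.toList R))
prefixCount-rows zero    R       = refl
prefixCount-rows (suc k) []      = refl
prefixCount-rows (suc k) (r ∷ R) = cong (θ r +_) (prefixCount-rows k R)

trueCount-rows : ∀ {N} (R : Vec Row N) → toℕ (trueCount (Vec.map proj₂ R)) ≡ θ-degree (Vec.toList R)
trueCount-rows R = trans (toℕ-trueCount R) (length-marked (Vec.toList R))

sum-toList : ∀ {N} (xs : Vec ℕ N) → Vec.sum xs ≡ sumℕ (Vec.toList xs)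
sum-toList []       = refl
sum-toList (x ∷ xs) = cong (x +_) (sum-toList xs)

prefixSum-ᶜ⁺ : ∀ {n m} (Λ : Superpartition n m) k → sumℕ (take k (Vec.toList (Λ ᶜ ⁺))) ≡ degree (take k (paddedRows Λ))
prefixSum-ᶜ⁺ Λ k = begin
  sumℕ (take k (Vec.toList (Λ ᶜ ⁺)))                          ≡⟨ cong (sumℕ ∘ take k ∘ Vec.toList) (ᶜ⁺ Λ) ⟩
  sumℕ (take k (Vec.toList (Vec.map proj₁ (rowVector Λ))))    ≡⟨ cong (sumℕ ∘ take k) (Vec.toList-map proj₁ (rowVector Λ)) ⟩
  sumℕ (take k (map proj₁ (Vec.toList (rowVector Λ))))        ≡⟨ cong sumℕ (take-map k (Vec.toList (rowVector Λ))) ⟩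
  degree (take k (Vec.toList (rowVector Λ)))                  ≡⟨ cong (degree ∘ take k) (toList-rowVector Λ) ⟩
  degree (take k (paddedRows Λ))                              ∎
  where open ≡-Reasoning

sum-ᶜ⁺ : ∀ {n m} (Λ : Superpartition n m) → Vec.sum (Λ ᶜ ⁺) ≡ n
sum-ᶜ⁺ {n} {m} Λ = begin
  Vec.sum (Λ ᶜ ⁺)                                      ≡⟨ cong Vec.sum (ᶜ⁺ Λ) ⟩
  Vec.sum (Vec.map proj₁ (rowVector Λ))                ≡⟨ sum-toList (Vec.map proj₁ (rowVector Λ)) ⟩
  sumℕ (Vec.toList (Vec.map proj₁ (rowVector Λ)))      ≡⟨ cong sumℕ (Vec.toList-map proj₁ (rowVector Λ)) ⟩
  degree (Vec.toList (rowVector Λ))                    ≡⟨ cong degree (toList-rowVector Λ) ⟩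
  degree (paddedRows Λ)                                ≡⟨ degree-++ (rows Λ) _ ⟩
  degree (rows Λ) + degree (replicate (n + m ∸ length (rows Λ)) (0 , false))  ≡⟨ cong₂ _+_ (degree-rows Λ) (degree-replicate (n + m ∸ length (rows Λ))) ⟩
  n + 0                                                ≡⟨ +-identityʳ n ⟩
  n                                                    ∎
  where open ≡-Reasoning

θ-degree-rowVector : ∀ {n m} (Λ : Superpartition n m) → θ-degree (Vec.toList (rowVector Λ)) ≡ m
θ-degree-rowVector {n} {m} Λ = trans (cong θ-degree (toList-rowVector Λ)) (trans (θ-degree-++ (rows Λ) _)
  (trans (cong₂ _+_ (θ-degree-rows Λ) (θ-degree-replicate (n + m ∸ length (rows Λ)))) (+-identityʳ m)))

-- Different row lengths are compared by dominance. Equal row lengths cancel from the size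
-- inequalities, leaving inequalities between circle counts.
⊑⇒≼ : ∀ {n m} {Γ Δ : Superpartition n m} → Γ ⊑ Δ → Γ ≼ Δ
⊑⇒≼ {n} {m} {Γ} {Δ} (dominated b s) with Vec.≡-dec _≟_ (Γ ᶜ ⁺) (Δ ᶜ ⁺)
... | no  Γ≢Δ = inj₁ (((λ k → subst₂ _≤_ (sym (prefix Γ k)) (sym (prefix Δ k)) (b k)) , trans (sum-ᶜ⁺ Γ) (sym (sum-ᶜ⁺ Δ))) , Γ≢Δ)
  where
  prefix : ∀ (Λ : Superpartition n m) k → sumℕ (take k (Vec.toList (Λ ᶜ ⁺))) ≡ degree (take k (rows Λ))
  prefix Λ k = trans (prefixSum-ᶜ⁺ Λ k) (proj₁ (paddedRows-stats Λ k))
-- The order is reversed on permutations: the larger `Δ` has its circles higher and hence the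
-- smaller permutation.
... | yes Γ≡Δ = inj₂ (sym Γ≡Δ , unshuffle (circleVector Δ) , unshuffle (circleVector Γ) , unshuffle-minimal Δ , unshuffle-minimal Γ
    , unshuffle-mono (circleVector Δ) (circleVector Γ) circles≤
        (Fin.toℕ-injective (trans (count Δ) (sym (count Γ)))))
  where
  count : ∀ (Λ : Superpartition n m) → toℕ (trueCount (circleVector Λ)) ≡ m
  count Λ = trans (trueCount-rows (rowVector Λ)) (θ-degree-rowVector Λ)
  prefix : ∀ (Λ : Superpartition n m) k → prefixCount k (circleVector Λ) ≡ θ-degree (take k (paddedRows Λ))
  prefix Λ k = trans (prefixCount-rows k (rowVector Λ)) (cong (θ-degree ∘ take k) (toList-rowVector Λ))
  degrees : ∀ k → degree (take k (paddedRows Γ)) ≡ degree (take k (paddedRows Δ))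
  degrees k = trans (sym (prefixSum-ᶜ⁺ Γ k)) (trans (cong (sumℕ ∘ take k ∘ Vec.toList) Γ≡Δ) (prefixSum-ᶜ⁺ Δ k))
  circles≤ : ∀ k → prefixCount k (circleVector Γ) ≤ prefixCount k (circleVector Δ)
  circles≤ k = subst₂ _≤_ (sym (prefix Γ k)) (sym (prefix Δ k)) (+-cancelˡ-≤ (degree (take k (paddedRows Δ))) _ _ (subst₂ _≤_
    (trans (sym (proj₂ (paddedRows-stats Γ k))) (cong (_+ θ-degree (take k (paddedRows Γ))) (degrees k)))
    (sym (proj₂ (paddedRows-stats Δ k))) (s k)))

-- Triangularity and elimination

⊕-symmetric : ∀ {n m f g} → Symmetric n m f → Symmetric n m g → Symmetric n m (f ⊕ g)
⊕-symmetric {f = f} {g} F G = record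
  { wellDefined = λ w → cong₂ _+ℤ_ (F.wellDefined w) (G.wellDefined w)
  ; homogeneous = homogeneous
  ; adjacent    = λ u x y v → trans (cong₂ _+ℤ_ (F.adjacent u x y v) (G.adjacent u x y v)) (sym (ℤ.*-distribˡ-+ (sgn (θ x * θ y)) _ _))
  }
  where
  module F = Symmetric F
  module G = Symmetric G
  homogeneous : Homogeneous _ _ (f ⊕ g)
  homogeneous w fg≢0 with f w ℤ.≟ 0ℤ
  ... | no  f≢0 = F.homogeneous w f≢0
  ... | yes f≡0 = G.homogeneous w λ g≡0 → fg≢0 (cong₂ _+ℤ_ f≡0 g≡0)

⊙-symmetric : ∀ {n m f} c → Symmetric n m f → Symmetric n m (c ⊙ f)
⊙-symmetric {f = f} c F = record
  { wellDefined = λ w → cong (c *ℤ_) (F.wellDefined w)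
  ; homogeneous = λ w cf≢0 → F.homogeneous w λ f≡0 → cf≢0 (trans (cong (c *ℤ_) f≡0) (ℤ.*-zeroʳ c))
  ; adjacent    = λ u x y v → trans (cong (c *ℤ_) (F.adjacent u x y v)) (rotate c (sgn (θ x * θ y)) (f (u ++ x ∷ y ∷ v)))
  }
  where
  module F = Symmetric F
  rotate : ∀ a b d → a *ℤ (b *ℤ d) ≡ b *ℤ (a *ℤ d)
  rotate = solve-∀

linearCombination-symmetric : ∀ {n m} {I : Set} (c : I → ℤ) (v : I → Series) → (∀ i → Symmetric n m (v i)) →
  ∀ is → Symmetric n m (linearCombination c v is)
linearCombination-symmetric c v vs []       = record
  { wellDefined = λ _ → refl
  ; homogeneous = λ _ 0≢0 → contradiction refl 0≢0
  ; adjacent    = λ u x y v → sym (ℤ.*-zeroʳ (sgn (θ x * θ y)))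
  }
linearCombination-symmetric c v vs (i ∷ is) = ⊕-symmetric (⊙-symmetric (c i) (vs i)) (linearCombination-symmetric c v vs is)

linearCombination-∑ : {I : Set} (c : I → ℤ) (v : I → Series) → ∀ is w → linearCombination c v is w ≡ ∑ is (λ i → c i *ℤ v i w)
linearCombination-∑ c v []       w = refl
linearCombination-∑ c v (i ∷ is) w = cong (c i *ℤ v i w +ℤ_) (linearCombination-∑ c v is w)

∈⇒≤sum : {A : Set} (f : A → ℕ) {x : A} {xs : List A} → x ∈ xs → f x ≤ sumℕ (map f xs)
∈⇒≤sum f (here refl)               = m≤m+n _ _
∈⇒≤sum f {xs = y ∷ _} (there x∈xs) = ≤-trans (∈⇒≤sum f x∈xs) (m≤n+m _ (f y))

-- Enumeration of the superpartitions

boundedLists : ℕ → ℕ → List (List ℕ)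
boundedLists B zero    = [] ∷ []
boundedLists B (suc L) = [] ∷ cartesianProductWith _∷_ (upTo (suc B)) (boundedLists B L)

∈-boundedLists : ∀ {B} L {xs} → All (_≤ B) xs → length xs ≤ L → xs ∈ boundedLists B L
∈-boundedLists zero    []       _         = here refl
∈-boundedLists (suc L) []       _         = here refl
∈-boundedLists (suc L) (p ∷ ps) (s≤s len) = there (∈.∈-cartesianProductWith⁺ _∷_ (∈.∈-upTo⁺ (s≤s p)) (∈-boundedLists L ps len))

module _ {n m : ℕ} where

  infix 4 _≟ˢ_
  _≟ˢ_ : (Λ Ω : Superpartition n m) → Dec (Λ ≡ Ω)
  Λ ≟ˢ Ω = map′ (λ (a , s) → superpartition-≡ a s) (λ { refl → refl , refl })
    (≡-dec _≟_ (Λᵃ Λ) (Λᵃ Ω) ×-dec ≡-dec _≟_ (Λˢ Λ) (Λˢ Ω))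

  fromParts : List ℕ × List ℕ → List (Superpartition n m)
  fromParts (A , B) with linked? (λ a b → b <? a) A ×-dec linked? (λ a b → b ≤? a) B ×-dec all? (0 <?_) B ×-dec (length A ≟ m) ×-dec (sumℕ (A ++ B) ≟ n)
  ... | no  _ = []
  ... | yes (a , b , c , d , e) = record
    { Λᵃ = A ; Λˢ = B ; Λᵃ-strict = a ; Λˢ-weak = b ; Λˢ-positive = c ; Λᵃ-length = d ; Λ-weight = e } ∷ []

  ∈-fromParts : (Λ : Superpartition n m) → Λ ∈ fromParts (Λᵃ Λ , Λˢ Λ)
  ∈-fromParts Λ with linked? (λ a b → b <? a) (Λᵃ Λ) ×-dec linked? (λ a b → b ≤? a) (Λˢ Λ) ×-dec all? (0 <?_) (Λˢ Λ) ×-dec (length (Λᵃ Λ) ≟ m) ×-dec (sumℕ (Λᵃ Λ ++ Λˢ Λ) ≟ n)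
  ... | no ¬p = contradiction (Λᵃ-strict Λ , Λˢ-weak Λ , Λˢ-positive Λ , Λᵃ-length Λ , Λ-weight Λ) ¬p
  ... | yes _ = here (superpartition-≡ refl refl)

  -- Entries are at most n and lengths at most n + m, so a finite search finds all; `deduplicate`
  -- makes uniqueness independent of how the search runs.
  superpartitions : List (Superpartition n m)
  superpartitions = deduplicate _≟ˢ_
    (concatMap fromParts (cartesianProduct (boundedLists n (n + m)) (boundedLists n (n + m))))

  superpartitions-unique : Unique superpartitions
  superpartitions-unique = deduplicate-! (decSetoid _≟ˢ_) _

  ∈-superpartitions : ∀ Λ → Λ ∈ superpartitions
  ∈-superpartitions Λ = ∈.∈-deduplicate⁺ _≟ˢ_ (∈.∈-concatMap⁺ fromParts (lose
    (∈.∈-cartesianProduct⁺ (∈-boundedLists (n + m) (All.++⁻ˡ (Λᵃ Λ) small) (≤-trans (m≤m+n _ _) short))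
                           (∈-boundedLists (n + m) (All.++⁻ʳ (Λᵃ Λ) small) (≤-trans (m≤n+m _ _) short)))
    (∈-fromParts Λ)))
    where
    small : All (_≤ n) (Λᵃ Λ ++ Λˢ Λ)
    small = All.tabulate λ {x} x∈ → subst (x ≤_) (trans (cong sumℕ (map-id (Λᵃ Λ ++ Λˢ Λ))) (Λ-weight Λ)) (∈⇒≤sum id x∈)
    short : length (Λᵃ Λ) + length (Λˢ Λ) ≤ n + m
    short = subst (_≤ n + m) (length-++ (Λᵃ Λ)) (length≤weight Λ)

  conjugate-injective : ∀ {Λ Ω : Superpartition n m} → conjugate Λ ≡ conjugate Ω → Λ ≡ Ω
  conjugate-injective {Λ} {Ω} eq = trans (sym (conjugate-involutive Λ)) (trans (cong conjugate eq) (conjugate-involutive Ω))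

  -- The coefficient of `m[ Ω ]` must be the value at `rows Ω`, by duality of the monomial functions
  -- and these words. Restricting to nonzero values lets `e⃖-dominated` bound every index that is
  -- listed.
  triangular : (Λ : Superpartition n m) →
    Σ[ N ∈ (Superpartition n m → ℤ) ] Σ[ Ωs ∈ List (Superpartition n m) ]
      (Unique Ωs × All (_≺ conjugate Λ) Ωs × e⃖[ Λ ] ≈ m[ conjugate Λ ] ⊕ linearCombination N m[_] Ωs)
  triangular Λ = N , Ωs , Unique.filter⁺ occurs? superpartitions-unique
    , All.map (λ {Ω} (N≢0 , Ω≢Λ′) → ⊑⇒≼ (e⃖-dominated Λ Ω N≢0) , Ω≢Λ′) (All.all-filter occurs? superpartitions)
    , agree-on-rows (e⃖-symmetric Λ) (⊕-symmetric (m-symmetric Λ′) (linearCombination-symmetric N m[_] m-symmetric Ωs)) same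
    where
    open ≡-Reasoning
    Λ′ = conjugate Λ
    N : Superpartition n m → ℤ
    N Ω = e⃖[ Λ ] (rows Ω)
    occurs? : ∀ Ω → Dec (N Ω ≢ 0ℤ × Ω ≢ Λ′)
    occurs? Ω = ¬? (N Ω ℤ.≟ 0ℤ) ×-dec ¬? (Ω ≟ˢ Λ′)
    Ωs = filter occurs? superpartitions
    term : ∀ Γ Ω → Ω ≢ Γ → N Ω *ℤ m[ Ω ] (rows Γ) ≡ 0ℤ
    term Γ Ω Ω≢Γ = trans (cong (N Ω *ℤ_) (m-rows-≢ Ω Γ Ω≢Γ)) (ℤ.*-zeroʳ (N Ω))
    absent : ∀ Γ → All (_≢ Γ) Ωs → linearCombination N m[_] Ωs (rows Γ) ≡ 0ℤ
    absent Γ Γ∉ = trans (linearCombination-∑ N m[_] Ωs (rows Γ)) (∑-zero Ωs (All.map (λ {Ω} → term Γ Ω) Γ∉))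
    same : ∀ Γ → N Γ ≡ m[ Λ′ ] (rows Γ) +ℤ linearCombination N m[_] Ωs (rows Γ)
    same Γ with Γ ≟ˢ Λ′ | N Γ ℤ.≟ 0ℤ
    ... | yes refl | _       = trans (e⃖-leading Λ) (sym (cong₂ _+ℤ_ (m-rows Λ′) (absent Λ′ (All.map proj₂ (All.all-filter occurs? superpartitions)))))
    ... | no Γ≢Λ′  | yes N≡0 = trans N≡0 (sym (cong₂ _+ℤ_ (m-rows-≢ Λ′ Γ (Γ≢Λ′ ∘ sym))
      (absent Γ (All.map (λ { (N≢0 , _) refl → N≢0 N≡0 }) (All.all-filter occurs? superpartitions)))))
    ... | no Γ≢Λ′  | no N≢0  = begin
      N Γ                                                            ≡⟨ ℤ.*-identityʳ (N Γ) ⟨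
      N Γ *ℤ 1ℤ                                                      ≡⟨ cong (N Γ *ℤ_) (m-rows Γ) ⟨
      N Γ *ℤ m[ Γ ] (rows Γ)                                         ≡⟨ ∑-single (Unique.filter⁺ occurs? superpartitions-unique) (∈.∈-filter⁺ occurs? (∈-superpartitions Γ) (N≢0 , Γ≢Λ′)) (λ Ω → N Ω *ℤ m[ Ω ] (rows Γ)) (λ Ω _ → term Γ Ω) ⟨
      ∑ Ωs (λ Ω → N Ω *ℤ m[ Ω ] (rows Γ))                            ≡⟨ linearCombination-∑ N m[_] Ωs (rows Γ) ⟨
      linearCombination N m[_] Ωs (rows Γ)                           ≡⟨ ℤ.+-identityˡ _ ⟨
      0ℤ +ℤ linearCombination N m[_] Ωs (rows Γ)                     ≡⟨ cong (_+ℤ linearCombination N m[_] Ωs (rows Γ)) (m-rows-≢ Λ′ Γ (Γ≢Λ′ ∘ sym)) ⟨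
      m[ Λ′ ] (rows Γ) +ℤ linearCombination N m[_] Ωs (rows Γ)       ∎

  e-rank : ∀ (Λ Γ : Superpartition n m) → e[ Λ ] (rows Γ) ≢ 0ℤ → Γ ≢ conjugate Λ → rank Γ < rank (conjugate Λ)
  e-rank Λ Γ e≢0 = rank-strict (e-dominated Λ Γ e≢0)

  e-leading² : ∀ (Λ : Superpartition n m) → e[ Λ ] (rows (conjugate Λ)) *ℤ e[ Λ ] (rows (conjugate Λ)) ≡ 1ℤ
  e-leading² Λ = let k , eq = e-leading Λ in trans (cong₂ _*ℤ_ eq eq) (sgn² k)

  -- At `rows (conjugate Λ)` a term of another `Γ` survives only if `conjugate Γ` has larger rank,
  -- where the coefficient is already known to vanish. This isolates `c Λ` times a unit.
  independent : ∀ (c : Superpartition n m → ℤ) is → Unique is → linearCombination c e[_] is ≈ 𝟘 → All (λ Λ → c Λ ≡ 0ℤ) is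
  -- The number `d` is the fuel of the induction: each strict rise of the rank pays for one unit,
  -- and at 0 the rank would exceed `bound`, a sum that dominates every rank in the list.
  independent c is unique lc≈0 = All.tabulate λ {Λ} Λ∈ → vanish (suc bound) Λ Λ∈ (m≤n+m (suc bound) (rank (conjugate Λ)))
    where
    open ≡-Reasoning
    bound = sumℕ (map (rank ∘ conjugate) is)
    -- Descending induction on the rank of the conjugate.
    vanish : ∀ d Λ → Λ ∈ is → bound < rank (conjugate Λ) + d → c Λ ≡ 0ℤ
    vanish zero    Λ Λ∈ b< = contradiction (subst (bound <_) (+-identityʳ _) b<) (≤⇒≯ (∈⇒≤sum (rank ∘ conjugate) Λ∈))
    vanish (suc d) Λ Λ∈ b< = begin
      c Λ                                                    ≡⟨ ℤ.*-identityʳ (c Λ) ⟨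
      c Λ *ℤ 1ℤ                                              ≡⟨ cong (c Λ *ℤ_) (e-leading² Λ) ⟨
      c Λ *ℤ (s *ℤ s)                                        ≡⟨ ℤ.*-assoc (c Λ) s s ⟨
      c Λ *ℤ s *ℤ s                                          ≡⟨ cong (_*ℤ s) (∑-single unique Λ∈ (λ Γ → c Γ *ℤ e[ Γ ] (rows (conjugate Λ))) others) ⟨
      ∑ is (λ Γ → c Γ *ℤ e[ Γ ] (rows (conjugate Λ))) *ℤ s   ≡⟨ cong (_*ℤ s) (linearCombination-∑ c e[_] is (rows (conjugate Λ))) ⟨
      linearCombination c e[_] is (rows (conjugate Λ)) *ℤ s  ≡⟨ cong (_*ℤ s) (lc≈0 (rows (conjugate Λ))) ⟩
      0ℤ *ℤ s                                                ≡⟨⟩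
      0ℤ                                                     ∎
      where
      s = e[ Λ ] (rows (conjugate Λ))
      others : ∀ Γ → Γ ∈ is → Γ ≢ Λ → c Γ *ℤ e[ Γ ] (rows (conjugate Λ)) ≡ 0ℤ
      others Γ Γ∈ Γ≢Λ with e[ Γ ] (rows (conjugate Λ)) ℤ.≟ 0ℤ
      ... | yes e≡0 = trans (cong (c Γ *ℤ_) e≡0) (ℤ.*-zeroʳ (c Γ))
      ... | no  e≢0 = cong (_*ℤ e[ Γ ] (rows (conjugate Λ))) (vanish d Γ Γ∈ (≤-trans b<
        (≤-trans (≤-reflexive (+-suc (rank (conjugate Λ)) d))
          (+-monoˡ-≤ d (e-rank Γ (conjugate Λ) e≢0 (λ eq → Γ≢Λ (sym (conjugate-injective eq))))))))

  expand : (Superpartition n m → ℤ) → Superpartition n m → ℤ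
  expand c Γ = ∑ superpartitions (λ Λ → c Λ *ℤ e[ Λ ] (rows Γ))

  -- Elimination of the values of φ in order of decreasing rank.
  solve : ∀ r (φ : Superpartition n m → ℤ) → (∀ Γ → r ≤ rank Γ → φ Γ ≡ 0ℤ) → ∃ λ c → ∀ Γ → expand c Γ ≡ φ Γ
  solve zero    φ φ≡0 = (λ _ → 0ℤ) , λ Γ → trans (∑-zero superpartitions (All.universal (λ _ → refl) superpartitions)) (sym (φ≡0 Γ z≤n))
  solve (suc r) φ φ≡0 = (λ Λ → c₁ Λ +ℤ c₂ Λ) , λ Γ → begin
    ∑ superpartitions (λ Λ → (c₁ Λ +ℤ c₂ Λ) *ℤ e[ Λ ] (rows Γ))                         ≡⟨ ∑-cong′ superpartitions (λ Λ → ℤ.*-distribʳ-+ (e[ Λ ] (rows Γ)) (c₁ Λ) (c₂ Λ)) ⟩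
    ∑ superpartitions (λ Λ → c₁ Λ *ℤ e[ Λ ] (rows Γ) +ℤ c₂ Λ *ℤ e[ Λ ] (rows Γ))        ≡⟨ ∑-+ superpartitions _ _ ⟩
    expand c₁ Γ +ℤ expand c₂ Γ                                                          ≡⟨ cong (expand c₁ Γ +ℤ_) (proj₂ rest Γ) ⟩
    expand c₁ Γ +ℤ (φ Γ +ℤ - expand c₁ Γ)                                               ≡⟨ cancel (expand c₁ Γ) (φ Γ) ⟩
    φ Γ                                                                                 ∎
    where
    open ≡-Reasoning
    cancel : ∀ a b → a +ℤ (b +ℤ - a) ≡ b
    cancel = solve-∀
    lead : Superpartition n m → ℤ
    lead Λ = e[ Λ ] (rows (conjugate Λ))
    c₁ : Superpartition n m → ℤ
    -- Multiplying by `lead Λ` replaces a division: a leading coefficient 1 or -1 is its own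
    -- inverse.
    c₁ Λ = if does (rank (conjugate Λ) ≟ r) then φ (conjugate Λ) *ℤ lead Λ else 0ℤ
    c₁-≢ : ∀ Λ → rank (conjugate Λ) ≢ r → c₁ Λ ≡ 0ℤ
    c₁-≢ Λ ≢r = cong (λ b → if b then φ (conjugate Λ) *ℤ lead Λ else 0ℤ) (dec-false (rank (conjugate Λ) ≟ r) ≢r)
    c₁-≡ : ∀ Λ → rank (conjugate Λ) ≡ r → c₁ Λ ≡ φ (conjugate Λ) *ℤ lead Λ
    c₁-≡ Λ ≡r = cong (λ b → if b then φ (conjugate Λ) *ℤ lead Λ else 0ℤ) (dec-true (rank (conjugate Λ) ≟ r) ≡r)
    -- A nonzero coefficient away from the leading one needs a rank of `Γ` below that of
    -- `conjugate Λ`, which is `r` wherever `c₁` is nonzero. So `c₁` corrects rank `r` without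
    -- disturbing the zeros above it.
    off-diagonal : ∀ Λ Γ → r ≤ rank Γ → Γ ≢ conjugate Λ → c₁ Λ *ℤ e[ Λ ] (rows Γ) ≡ 0ℤ
    off-diagonal Λ Γ r≤ Γ≢ with e[ Λ ] (rows Γ) ℤ.≟ 0ℤ
    ... | yes e≡0 = trans (cong (c₁ Λ *ℤ_) e≡0) (ℤ.*-zeroʳ (c₁ Λ))
    ... | no  e≢0 = cong (_*ℤ e[ Λ ] (rows Γ)) (c₁-≢ Λ λ { refl → contradiction (e-rank Λ Γ e≢0 Γ≢) (≤⇒≯ r≤) })
    diagonal : ∀ Γ → r ≤ rank Γ → expand c₁ Γ ≡ c₁ (conjugate Γ) *ℤ lead (conjugate Γ)
    diagonal Γ r≤ = trans
      (∑-single superpartitions-unique (∈-superpartitions (conjugate Γ)) (λ Λ → c₁ Λ *ℤ e[ Λ ] (rows Γ))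
        λ Λ _ Λ≢ → off-diagonal Λ Γ r≤ λ { refl → Λ≢ (sym (conjugate-involutive Λ)) })
      (cong (λ Δ → c₁ (conjugate Γ) *ℤ e[ conjugate Γ ] (rows Δ)) (sym (conjugate-involutive Γ)))
    agrees : ∀ Γ → r ≤ rank Γ → expand c₁ Γ ≡ φ Γ
    agrees Γ r≤ with rank (conjugate (conjugate Γ)) ≟ r
    ... | yes ≡r = begin
      expand c₁ Γ                                                          ≡⟨ diagonal Γ r≤ ⟩
      c₁ (conjugate Γ) *ℤ lead (conjugate Γ)                               ≡⟨ cong (_*ℤ lead (conjugate Γ)) (c₁-≡ (conjugate Γ) ≡r) ⟩
      φ (conjugate (conjugate Γ)) *ℤ lead (conjugate Γ) *ℤ lead (conjugate Γ)  ≡⟨ ℤ.*-assoc (φ (conjugate (conjugate Γ))) (lead (conjugate Γ)) (lead (conjugate Γ)) ⟩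
      φ (conjugate (conjugate Γ)) *ℤ (lead (conjugate Γ) *ℤ lead (conjugate Γ))  ≡⟨ cong₂ _*ℤ_ (cong φ (conjugate-involutive Γ)) (e-leading² (conjugate Γ)) ⟩
      φ Γ *ℤ 1ℤ                                                            ≡⟨ ℤ.*-identityʳ (φ Γ) ⟩
      φ Γ                                                                  ∎
    ... | no  ≢r = trans (diagonal Γ r≤) (trans (cong (_*ℤ lead (conjugate Γ)) (c₁-≢ (conjugate Γ) ≢r))
      (sym (φ≡0 Γ (≤∧≢⇒< r≤ λ r≡ → ≢r (trans (cong rank (conjugate-involutive Γ)) (sym r≡))))))
    -- The remainder vanishes from rank `r` on; the values at smaller ranks that `c₁` has altered
    -- are left to the recursion.
    rest : ∃ λ c → ∀ Γ → expand c Γ ≡ φ Γ +ℤ - expand c₁ Γ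
    rest = solve r (λ Γ → φ Γ +ℤ - expand c₁ Γ) λ Γ r≤ → trans (cong (λ a → φ Γ +ℤ - a) (agrees Γ r≤)) (ℤ.+-inverseʳ (φ Γ))
    c₂ = proj₁ rest

  spanning : ∀ f → 𝒫 n m f → ∃₂ λ c is → Unique is × f ≈ linearCombination c (e[_] {n} {m}) is
  spanning f P = c , superpartitions , superpartitions-unique
    , agree-on-rows (𝒫⇒Symmetric P) (linearCombination-symmetric c e[_] e-symmetric superpartitions)
        (λ Γ → trans (sym (proj₂ solution Γ)) (sym (linearCombination-∑ c e[_] superpartitions (rows Γ))))
    where
    bound = sumℕ (map rank superpartitions)
    -- No superpartition has rank above the sum of all ranks, so the hypothesis of vanishing holds
    -- vacuously at the start.
    solution = solve (suc bound) (f ∘ rows) λ Γ b< → contradiction b< (≤⇒≯ (∈⇒≤sum rank (∈-superpartitions Γ)))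
    c = proj₁ solution

theorem18 : (n m : ℕ) →
    ((Λ : Superpartition n m) →
    Σ[ N ∈ (Superpartition n m → ℤ) ] Σ[ Ωs ∈ List (Superpartition n m) ]
    (Unique Ωs × All (_≺ conjugate Λ) Ωs × e⃖[ Λ ] ≈ m[ conjugate Λ ] ⊕ linearCombination N m[_] Ωs))
    × IsBasis (𝒫 n m) (λ (Λ : Superpartition n m) → e[ Λ ])
theorem18 n m = triangular , record
  { member      = Symmetric⇒𝒫 ∘ e-symmetric
  ; spanning    = spanning
  ; independent = independent
  }
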